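{- Let $q$ be a prime power and let $k\ge 2$ and $t\ge 0$ be fixed integers. For $d\ge 0$ put $$A_k(d)=\sum_{\substack{a_1,\dots,a_d\ge 0\\ 1a_1+2a_2+\cdots+da_d=d}}(-1)^{a_1+\cdots+a_d}\binom{I_k(1)}{a_1}\cdots\binom{I_k(d)}{a_d}$$ (so $A_k(0)=1$). Then for integers $m,n\ge 0$, $$P_k(m;n)=\sum_{d=0}^t N_k(m-d)N_k(n-d)A_k(d)+O\bigl(N_k(m-t-1)N_k(n-t-1)\bigr),$$ where the constant in the $O$-term depends only on $q,k,t$ (and not on $m,n$).
   Context: $\mathbb F_q$ is the finite field with $q$ elements. Two polynomials in $\mathbb F_q[x_1,\dots,x_k]$ are identified if they differ by a factor in $\mathbb F_q^\times$; the classes are called normalized polynomials. For an integer $m\ge 0$, $\mathcal N_k(m)$ is the set of normalized (nonzero) polynomials in $\mathbb F_q[x_1,\dots,x_k]$ of total degree $m$, and $N_k(m)=|\mathcal N_k(m)|$; $N_k(m)=0$ for $m<0$. $I_k(m)$ is the number of irreducible elements of $\mathcal N_k(m)$. For $m,n\ge 0$, $P_k(m;n)=|\{(f,g)\in\mathcal N_k(m)\times\mathcal N_k(n):\gcd(f,g)=1\}|$. -}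

module Defs where

open import Algebra.Apartness.Bundles using (HeytingField)
open import Algebra.Bundles.Raw using (RawSemiring)
import Algebra.Definitions as AlgebraicDefinitions
import Algebra.Definitions.RawSemiring as SemiringDefinitions
open import Data.Bool.Base using (if_then_else_)
open import Data.Fin.Base using (Fin; toℕ)
open import Data.Integer.Base as ℤ using (ℤ; +_; -[1+_]; 0ℤ; -1ℤ)
open import Data.List.Base using (List; []; _∷_; _++_; cartesianProductWith; filter; foldr; map; upTo)
open import Data.Nat.Base using (ℕ; zero; suc; _+_; _*_; _^_; _<_)
open import Data.Nat.Combinatorics using (_C_)
open import Data.Nat.Primality using (Prime)
import Data.Nat.Properties as ℕ
open import Data.Product.Base using (_×_; _,_; Σ-syntax; ∃-syntax; proj₁)
open import Data.Product.Relation.Binary.Pointwise.NonDependent using (×-setoid)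
open import Data.Vec.Base as Vec using (Vec; []; _∷_; lookup; replicate; tabulate; zipWith)
open import Data.Vec.Properties using (≡-dec)
open import Function.Bundles using (Bijection)
open import Level using (_⊔_)
open import Relation.Binary.Bundles using (Setoid)
import Relation.Binary.Construct.On as On
open import Relation.Binary.PropositionalEquality.Core using (_≡_)
import Relation.Binary.PropositionalEquality.Properties as ≡
import Relation.Binary.Reasoning.Setoid as SetoidReasoning
open import Relation.Nullary.Decidable.Core using (does)
open import Relation.Nullary.Negation.Core using (¬_)

-- The number of ≈-classes of S is n.
HasCardinality : ∀ {a ℓ} → Setoid a ℓ → ℕ → Set (a ⊔ ℓ)
HasCardinality S n = Bijection S (≡.setoid (Fin n))

PrimePower : ℕ → Set
PrimePower q = ∃[ p ] ∃[ r ] (Prime p × q ≡ p ^ suc r)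

module Polynomials {c ℓ₁ ℓ₂} (F : HeytingField c ℓ₁ ℓ₂) (k : ℕ) where

  private
    module F = HeytingField F
  open AlgebraicDefinitions F._≈_ using (Invertible)

  -- The exponent vector of a monomial in x₁, …, x_k.
  Monomial : Set
  Monomial = Vec ℕ k

  -- A polynomial is a formal finite sum of terms a·xᵉ, in which a monomial
  -- may be repeated or have coefficient zero; two such sums are identified
  -- by _≈_ below when all their coefficients agree.
  Poly : Set c
  Poly = List (F.Carrier × Monomial)

  coeff : Poly → Monomial → F.Carrier
  coeff []            e = F.0#
  coeff ((a , e′) ∷ f) e =
    (if does (≡-dec ℕ._≟_ e′ e) then a else F.0#) F.+ coeff f e

  infix 4 _≈_
  _≈_ : Poly → Poly → Set ℓ₁
  f ≈ g = ∀ e → coeff f e F.≈ coeff g e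

  polyRawSemiring : RawSemiring c ℓ₁
  polyRawSemiring = record
    { Carrier = Poly
    ; _≈_     = _≈_
    ; _+_     = _++_
    ; _*_     = cartesianProductWith
                  (λ (a , d) (b , e) → (a F.* b) , zipWith _+_ d e)
    ; 0#      = []
    ; 1#      = (F.1# , replicate k 0) ∷ []
    }

  open SemiringDefinitions polyRawSemiring public
    using (Irreducible; Coprime)

  HasTotalDegree : ℕ → Poly → Set ℓ₁
  HasTotalDegree m f =
    (∃[ e ] (Vec.sum e ≡ m × ¬ coeff f e F.≈ F.0#)) ×
    (∀ e → m < Vec.sum e → coeff f e F.≈ F.0#)

  -- f = u·g for some unit u of the field of constants.
  infix 4 _∼_
  _∼_ : Poly → Poly → Set (c ⊔ ℓ₁)
  f ∼ g = Σ[ u ∈ F.Carrier ]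
    (Invertible F.1# F._*_ u × (∀ e → coeff f e F.≈ u F.* coeff g e))

  ∼-setoid : Setoid c (c ⊔ ℓ₁)
  ∼-setoid = record
    { Carrier       = Poly
    ; _≈_           = _∼_
    ; isEquivalence = record
      { refl  = F.1# , (F.1# , F.*-identityˡ _ , F.*-identityˡ _)
              , λ e → F.sym (F.*-identityˡ _)
      ; sym   = λ {f} {g} (u , (v , vu≈1 , uv≈1) , f≈ug) →
          v , (u , uv≈1 , vu≈1) , λ e → begin
            coeff g e                ≈⟨ F.*-identityˡ _ ⟨
            F.1# F.* coeff g e       ≈⟨ F.*-congʳ vu≈1 ⟨
            (v F.* u) F.* coeff g e  ≈⟨ F.*-assoc _ _ _ ⟩
            v F.* (u F.* coeff g e)  ≈⟨ F.*-congˡ (f≈ug e) ⟨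
            v F.* coeff f e          ∎
      ; trans = λ {f} {g} {h} (u , (u⁻¹ , lu , ru) , f≈ug) (v , (v⁻¹ , lv , rv) , g≈vh) →
          u F.* v
          , (v⁻¹ F.* u⁻¹ , cancel lu lv , cancel rv ru)
          , λ e → begin
            coeff f e                ≈⟨ f≈ug e ⟩
            u F.* coeff g e          ≈⟨ F.*-congˡ (g≈vh e) ⟩
            u F.* (v F.* coeff h e)  ≈⟨ F.*-assoc _ _ _ ⟨
            (u F.* v) F.* coeff h e  ∎
      }
    }
    where
    open SetoidReasoning F.setoid

    cancel : ∀ {x x′ y y′} → x′ F.* x F.≈ F.1# → y′ F.* y F.≈ F.1# →
             (y′ F.* x′) F.* (x F.* y) F.≈ F.1#
    cancel {x} {x′} {y} {y′} p r = begin
      (y′ F.* x′) F.* (x F.* y)  ≈⟨ F.*-assoc _ _ _ ⟩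
      y′ F.* (x′ F.* (x F.* y))  ≈⟨ F.*-congˡ (F.*-assoc _ _ _) ⟨
      y′ F.* ((x′ F.* x) F.* y)  ≈⟨ F.*-congˡ (F.*-congʳ p) ⟩
      y′ F.* (F.1# F.* y)        ≈⟨ F.*-congˡ (F.*-identityˡ _) ⟩
      y′ F.* y                   ≈⟨ r ⟩
      F.1#                       ∎

  𝒩 : ℕ → Setoid (c ⊔ ℓ₁) (c ⊔ ℓ₁)
  𝒩 m = On.setoid {B = Σ[ f ∈ Poly ] HasTotalDegree m f} ∼-setoid proj₁

  Irreducibles : ℕ → Setoid (c ⊔ ℓ₁) (c ⊔ ℓ₁)
  Irreducibles m =
    On.setoid {B = Σ[ f ∈ Setoid.Carrier (𝒩 m) ] Irreducible (proj₁ f)} (𝒩 m) proj₁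

  CoprimePairs : ℕ → ℕ → Setoid (c ⊔ ℓ₁) (c ⊔ ℓ₁)
  CoprimePairs m n =
    On.setoid
      {B = Σ[ (f , g) ∈ Setoid.Carrier (𝒩 m) × Setoid.Carrier (𝒩 n) ]
             Coprime (proj₁ f) (proj₁ g)}
      (×-setoid (𝒩 m) (𝒩 n)) proj₁

extendByZero : (ℕ → ℕ) → ℤ → ℕ
extendByZero N (+ m)    = N m
extendByZero N -[1+ _ ] = 0

sumℤ : List ℤ → ℤ
sumℤ = foldr ℤ._+_ 0ℤ

tuples≤ : ℕ → (d : ℕ) → List (Vec ℕ d)
tuples≤ b zero    = [] ∷ []
tuples≤ b (suc d) = cartesianProductWith _∷_ (upTo (suc b)) (tuples≤ b d)

-- 1·a₁ + 2·a₂ + ⋯ + d·a_d; here and below position i of a vector holds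
-- the entry with index i + 1.
weight : ∀ {d} → Vec ℕ d → ℕ
weight a = Vec.sum (tabulate λ i → suc (toℕ i) * lookup a i)

-- A weight equal to d forces every aᵢ ≤ d, so the sum over all
-- (a₁, …, a_d) of weight d is found among the tuples bounded by d.
A : (ℕ → ℕ) → ℕ → ℤ
A I d = sumℤ (map term (filter (λ a → weight a ℕ.≟ d) (tuples≤ d d)))
  where
  term : Vec ℕ d → ℤ
  term a = (-1ℤ ℤ.^ Vec.sum a) ℤ.*
    + Vec.foldr _ _*_ 1 (tabulate λ i → I (suc (toℕ i)) C lookup a i)

{-# OPTIONS --safe #-}
module Submission where

-- Irreducible polynomials are prime (Gauss's lemma), so the pairs (f , g)
-- divisible by an irreducible p of degree e and free of the irreducibles
-- treated before correspond to the free pairs of degrees (m - e , n - e).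
-- Hence P(m;n) = Σ_d A(d) N(m-d) N(n-d), summed over all d, where A(d) is the
-- coefficient of xᵈ in ∏ᵢ (1 - xⁱ)^I(i).  The same sieve on single polynomials
-- shows that Σ_d A(d) xᵈ is the inverse of Σ_m N(m) xᵐ.  Let G(d) = q^w(d),
-- where w(d) is the number of nonconstant monomials of degree at most d.
-- Then G ≤ N ≤ q G, the recursion for the inverse series gives
-- |A(d)| ≤ (q+1)ᵈ G(d), and G is supermultiplicative, so the term with
-- d = t + 1 + e is at most a constant times
-- (q+1)^d G(d) / G(e)² · N(m-t-1) N(n-t-1).  For k ≥ 2 the exponent
-- w(e+t+1) - 2 w(e) tends to -∞ faster than linearly, and the tail of the
-- sum is dominated by a geometric series.

-- Formal sums of terms come without ring laws. They are sent by `φ` to k-fold iterated univariate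
-- polynomials, and the monoid laws, cancellation and the primality of irreducibles are pulled back
-- along it. The property carried through the iteration is the existence of gcds: it passes from R
-- to R[x] by Euclid's algorithm over the fractions of R together with Gauss's lemma, and it makes
-- irreducible elements prime. What the sieve takes from arithmetic is this primality and the
-- existence of an irreducible factor. The argument is constructive, so questions such as whether a
-- polynomial is divisible by a given irreducible, or is itself irreducible, are settled by
-- searching a finite set of classes. The constant has to be fixed before the field and the counting
-- functions are given. Hence `N` is compared with powers of `q` whose exponents depend only on `k`
-- and on the degree. Power series occur only through finite sums: a product of factors 1 - xᵉ acts
-- as a product of difference operators on sequences that vanish from some index on.

-- GCD domains: irreducible elements are prime

module GCDDomains where
  open import Algebra.Bundles using (CommutativeRing)
  import Algebra.Properties.CommutativeSemigroup.Divisibility as CommutativeDivisibility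
  import Algebra.Properties.Group as GroupProperties
  import Algebra.Properties.Ring as RingProperties
  import Algebra.Properties.Semiring.Divisibility as Divisibility
  open import Data.Product.Base using (_×_; _,_; Σ-syntax)
  open import Data.Sum.Base using (_⊎_; inj₁; inj₂)
  open import Level using (_⊔_; suc)
  open import Relation.Binary.Definitions using (Decidable)
  import Relation.Binary.Reasoning.Setoid as SetoidReasoning
  open import Relation.Nullary.Decidable.Core using (yes; no)
  open import Relation.Nullary.Negation.Core using (¬_; contradiction)

  record GCDDomain c ℓ : Set (suc (c ⊔ ℓ)) where
    field
      commutativeRing : CommutativeRing c ℓ
    open CommutativeRing commutativeRing public
    open Divisibility semiring public using (_∣_; ∣ʳ-trans; ∣ʳ-refl; ∣ʳ-respʳ-≈; ∣ʳ-respˡ-≈; x∣ʳyx; x∣ʳy⇒x∣ʳzy; ε∣ʳ_; 0∣x⇒x≈0; _,_)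
    field
      _≟_     : Decidable _≈_
      1≉0     : ¬ 1# ≈ 0#
      x*y≈0⇒x≈0⊎y≈0 : ∀ {x y} → x * y ≈ 0# → x ≈ 0# ⊎ y ≈ 0#
      gcd     : ∀ a b → Σ[ g ∈ Carrier ] (g ∣ a × g ∣ b × (∀ {d} → d ∣ a → d ∣ b → d ∣ g))

  module GCDDomainProperties {c ℓ} (D : GCDDomain c ℓ) where
    open GCDDomain D
    open CommutativeDivisibility *-commutativeSemigroup using (x∣y⇒zx∣zy; x∣xy)
    open GroupProperties +-group using () renaming (x∙y⁻¹≈ε⇒x≈y to x-y≈0⇒x≈y)
    open RingProperties ring using (x[y-z]≈xy-xz; -‿distribˡ-*)
    open SetoidReasoning setoid

    x*y≉0 : ∀ {x y} → ¬ x ≈ 0# → ¬ y ≈ 0# → ¬ x * y ≈ 0#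
    x*y≉0 x≉0 y≉0 xy≈0 with x*y≈0⇒x≈0⊎y≈0 xy≈0
    ... | inj₁ x≈0 = x≉0 x≈0
    ... | inj₂ y≈0 = y≉0 y≈0

    *-cancelˡ-≉0 : ∀ {c x y} → ¬ c ≈ 0# → c * x ≈ c * y → x ≈ y
    *-cancelˡ-≉0 {c} {x} {y} c≉0 cx≈cy with x*y≈0⇒x≈0⊎y≈0 (begin
        c * (x - y)      ≈⟨ x[y-z]≈xy-xz c x y ⟩
        c * x - c * y    ≈⟨ +-congʳ cx≈cy ⟩
        c * y - c * y    ≈⟨ -‿inverseʳ _ ⟩
        0#               ∎)
    ... | inj₁ c≈0   = contradiction c≈0 c≉0
    ... | inj₂ x-y≈0 = x-y≈0⇒x≈y x y x-y≈0

    ∣-cancelˡ-≉0 : ∀ {c x y} → ¬ c ≈ 0# → c * x ∣ c * y → x ∣ y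
    ∣-cancelˡ-≉0 {c} {x} {y} c≉0 (q , q*cx≈cy) = q , *-cancelˡ-≉0 c≉0 (begin
      c * (q * x)  ≈⟨ *-assoc c q x ⟨
      (c * q) * x  ≈⟨ *-congʳ (*-comm c q) ⟩
      (q * c) * x  ≈⟨ *-assoc q c x ⟩
      q * (c * x)  ≈⟨ q*cx≈cy ⟩
      c * y        ∎)

    ∣x∣y⇒∣x+y : ∀ {d x y} → d ∣ x → d ∣ y → d ∣ x + y
    ∣x∣y⇒∣x+y (p , pd≈x) (q , qd≈y) = p + q , trans (distribʳ _ p q) (+-cong pd≈x qd≈y)

    ∣x⇒∣-x : ∀ {d x} → d ∣ x → d ∣ - x
    ∣x⇒∣-x (p , pd≈x) = - p , trans (sym (-‿distribˡ-* p _)) (-‿cong pd≈x)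

    ∣x∣x+y⇒∣y : ∀ {d x y} → d ∣ x → d ∣ x + y → d ∣ y
    ∣x∣x+y⇒∣y {d} {x} {y} d∣x d∣x+y = ∣ʳ-respʳ-≈ (begin
      - x + (x + y)  ≈⟨ +-assoc _ _ _ ⟨
      (- x + x) + y  ≈⟨ +-congʳ (-‿inverseˡ x) ⟩
      0# + y         ≈⟨ +-identityˡ y ⟩
      y              ∎) (∣x∣y⇒∣x+y (∣x⇒∣-x d∣x) d∣x+y)

    ∣0 : ∀ {d} → d ∣ 0#
    ∣0 = 0# , zeroˡ _

    -- Let h be a gcd of ca and cb. As c divides both, h = ck for some k; cancelling c shows that k
    -- divides a and b, hence g. So d divides h = ck, which divides cg. Only the universal property
    -- of g enters, which allows g = `1#` for coprime elements.
    gcd-distrib : ∀ {d g a b} c → (∀ {e} → e ∣ a → e ∣ b → e ∣ g) →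
                  d ∣ c * a → d ∣ c * b → d ∣ c * g
    gcd-distrib {d} {g} {a} {b} c universal d∣ca d∣cb with c ≟ 0#
    ... | yes c≈0 = ∣ʳ-respʳ-≈ (sym (trans (*-congʳ c≈0) (zeroˡ g))) ∣0
    ... | no  c≉0 with gcd (c * a) (c * b)
    ... | h , h∣ca , h∣cb , h-universal with h-universal (x∣xy c a) (x∣xy c b)
    ... | k , kc≈h = ∣ʳ-trans (h-universal d∣ca d∣cb)
        (∣ʳ-respˡ-≈ ck≈h (x∣y⇒zx∣zy c (universal (reduce h∣ca) (reduce h∣cb))))
      where
      ck≈h = trans (*-comm c k) kc≈h
      reduce : ∀ {x} → h ∣ c * x → k ∣ x
      reduce h∣cx = ∣-cancelˡ-≉0 c≉0 (∣ʳ-respˡ-≈ (sym ck≈h) h∣cx)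

    Coprime : Carrier → Carrier → Set _
    Coprime x y = ∀ {z} → z ∣ x → z ∣ y → z ∣ 1#

    -- p divides both yp and yx, hence y times the gcd `1#` of p and x.
    coprime⇒∣x*y⇒∣y : ∀ {p x y} → Coprime p x → p ∣ x * y → p ∣ y
    coprime⇒∣x*y⇒∣y {p} {x} {y} coprime p∣xy = ∣ʳ-respʳ-≈ (*-identityʳ y)
      (gcd-distrib y coprime (x∣ʳyx p y) (∣ʳ-respʳ-≈ (*-comm x y) p∣xy))

    -- Write p = sg with g a gcd of p and x. If g is a unit, then p is coprime to x and divides y;
    -- if s is a unit, then p is associated to g, which divides x.
    irreducible⇒prime : ∀ {p} → (∀ {x y} → p ≈ x * y → x ∣ 1# ⊎ y ∣ 1#) →
                        ∀ {x y} → p ∣ x * y → p ∣ x ⊎ p ∣ y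
    irreducible⇒prime {p} split {x} {y} p∣xy with gcd p x
    ... | g , (s , sg≈p) , g∣x , universal with split (sym sg≈p)
    ... | inj₂ g∣1 = inj₂ (coprime⇒∣x*y⇒∣y (λ d∣p d∣x → ∣ʳ-trans (universal d∣p d∣x) g∣1) p∣xy)
    ... | inj₁ (u , us≈1) = inj₁ (∣ʳ-trans (u , (begin
      u * p        ≈⟨ *-congˡ sg≈p ⟨
      u * (s * g)  ≈⟨ *-assoc u s g ⟨
      (u * s) * g  ≈⟨ *-congʳ us≈1 ⟩
      1# * g       ≈⟨ *-identityˡ g ⟩
      g            ∎)) g∣x)

-- The ring of univariate polynomials, as lists of coefficients

module Univariate where
  open import Algebra.Bundles using (CommutativeRing)
  open import Algebra.Consequences.Setoid using (comm∧idˡ⇒id; comm∧distrʳ⇒distr)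
  import Algebra.Properties.CommutativeSemigroup as CommutativeSemigroupProperties
  open import Data.List.Base using (List; []; _∷_; map)
  open import Data.Nat.Base using (ℕ; zero; suc)
  open import Data.Product.Base using (_,_)
  open import Relation.Binary.Structures using (IsEquivalence)
  open import Relation.Binary.Bundles using (Setoid)
  import Relation.Binary.Reasoning.Setoid as SetoidReasoning

  module UnivariatePolynomials {c ℓ} (R : CommutativeRing c ℓ) where
    open CommutativeRing R
    open CommutativeSemigroupProperties +-commutativeSemigroup using (interchange; x∙yz≈y∙xz)
    open SetoidReasoning setoid

    coef : List Carrier → ℕ → Carrier
    coef []      _       = 0#
    coef (a ∷ f) zero    = a
    coef (a ∷ f) (suc n) = coef f n

    -- A record rather than a function type, so that f and g can be inferred.
    infix 4 _≋_
    record _≋_ (f g : List Carrier) : Set ℓ where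
      constructor coefwise
      field at : ∀ n → coef f n ≈ coef g n
    open _≋_ public

    infixl 6 _⊞_
    _⊞_ : List Carrier → List Carrier → List Carrier
    []      ⊞ g       = g
    (a ∷ f) ⊞ []      = a ∷ f
    (a ∷ f) ⊞ (b ∷ g) = (a + b) ∷ (f ⊞ g)

    scale : Carrier → List Carrier → List Carrier
    scale a = map (a *_)

    neg : List Carrier → List Carrier
    neg = map λ a → - a

    infixl 7 _⊠_
    _⊠_ : List Carrier → List Carrier → List Carrier
    []      ⊠ g = []
    (a ∷ f) ⊠ g = scale a g ⊞ (0# ∷ f ⊠ g)

    coef-⊞ : ∀ f g n → coef (f ⊞ g) n ≈ coef f n + coef g n
    coef-⊞ []      g       n       = sym (+-identityˡ _)
    coef-⊞ (a ∷ f) []      n       = sym (+-identityʳ _)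
    coef-⊞ (a ∷ f) (b ∷ g) zero    = refl
    coef-⊞ (a ∷ f) (b ∷ g) (suc n) = coef-⊞ f g n

    coef-scale : ∀ a f n → coef (scale a f) n ≈ a * coef f n
    coef-scale a []      n       = sym (zeroʳ a)
    coef-scale a (b ∷ f) zero    = refl
    coef-scale a (b ∷ f) (suc n) = coef-scale a f n

    coef-neg : ∀ f n → coef (neg f) n ≈ - coef f n
    coef-neg []      n       = sym -0#≈0#
      where open import Algebra.Properties.Ring ring using (-0#≈0#)
    coef-neg (b ∷ f) zero    = refl
    coef-neg (b ∷ f) (suc n) = coef-neg f n

    coef-⊠ : ∀ a f g n → coef ((a ∷ f) ⊠ g) n ≈ a * coef g n + coef (0# ∷ f ⊠ g) n
    coef-⊠ a f g n = trans (coef-⊞ (scale a g) (0# ∷ f ⊠ g) n) (+-congʳ (coef-scale a g n))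

    ≋-isEquivalence : IsEquivalence _≋_
    ≋-isEquivalence = record
      { refl  = coefwise λ n → refl
      ; sym   = λ p → coefwise λ n → sym (at p n)
      ; trans = λ p q → coefwise λ n → trans (at p n) (at q n)
      }

    ≋-setoid : Setoid c ℓ
    ≋-setoid = record { isEquivalence = ≋-isEquivalence }

    open IsEquivalence ≋-isEquivalence public using ()
      renaming (refl to ≋-refl; sym to ≋-sym; trans to ≋-trans)

    ∷-cong : ∀ {a b f g} → a ≈ b → f ≋ g → (a ∷ f) ≋ (b ∷ g)
    ∷-cong a≈b f≋g = coefwise λ { zero → a≈b ; (suc n) → at f≋g n }

    ⊞-cong : ∀ {f f′ g g′} → f ≋ f′ → g ≋ g′ → f ⊞ g ≋ f′ ⊞ g′
    ⊞-cong {f} {f′} {g} {g′} p q = coefwise λ n →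
      trans (coef-⊞ f g n) (trans (+-cong (at p n) (at q n)) (sym (coef-⊞ f′ g′ n)))

    ⊞-comm : ∀ f g → f ⊞ g ≋ g ⊞ f
    ⊞-comm f g = coefwise λ n → trans (coef-⊞ f g n) (trans (+-comm _ _) (sym (coef-⊞ g f n)))

    ⊞-assoc : ∀ f g h → (f ⊞ g) ⊞ h ≋ f ⊞ (g ⊞ h)
    ⊞-assoc f g h = coefwise λ n → begin
      coef ((f ⊞ g) ⊞ h) n                ≈⟨ coef-⊞ (f ⊞ g) h n ⟩
      coef (f ⊞ g) n + coef h n           ≈⟨ +-congʳ (coef-⊞ f g n) ⟩
      (coef f n + coef g n) + coef h n    ≈⟨ +-assoc _ _ _ ⟩
      coef f n + (coef g n + coef h n)    ≈⟨ +-congˡ (coef-⊞ g h n) ⟨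
      coef f n + coef (g ⊞ h) n           ≈⟨ coef-⊞ f (g ⊞ h) n ⟨
      coef (f ⊞ (g ⊞ h)) n                ∎

    scale-cong : ∀ {a b f g} → a ≈ b → f ≋ g → scale a f ≋ scale b g
    scale-cong {a} {b} {f} {g} p q = coefwise λ n →
      trans (coef-scale a f n) (trans (*-cong p (at q n)) (sym (coef-scale b g n)))

    scale-⊞ : ∀ a f g → scale a (f ⊞ g) ≋ scale a f ⊞ scale a g
    scale-⊞ a f g = coefwise λ n → begin
      coef (scale a (f ⊞ g)) n                    ≈⟨ coef-scale a (f ⊞ g) n ⟩
      a * coef (f ⊞ g) n                          ≈⟨ *-congˡ (coef-⊞ f g n) ⟩
      a * (coef f n + coef g n)                   ≈⟨ distribˡ _ _ _ ⟩
      a * coef f n + a * coef g n                 ≈⟨ +-cong (coef-scale a f n) (coef-scale a g n) ⟨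
      coef (scale a f) n + coef (scale a g) n     ≈⟨ coef-⊞ (scale a f) (scale a g) n ⟨
      coef (scale a f ⊞ scale a g) n              ∎

    scale-+ : ∀ a b f → scale (a + b) f ≋ scale a f ⊞ scale b f
    scale-+ a b f = coefwise λ n → begin
      coef (scale (a + b) f) n                    ≈⟨ coef-scale (a + b) f n ⟩
      (a + b) * coef f n                          ≈⟨ distribʳ _ _ _ ⟩
      a * coef f n + b * coef f n                 ≈⟨ +-cong (coef-scale a f n) (coef-scale b f n) ⟨
      coef (scale a f) n + coef (scale b f) n     ≈⟨ coef-⊞ (scale a f) (scale b f) n ⟨
      coef (scale a f ⊞ scale b f) n              ∎

    scale-* : ∀ a b f → scale (a * b) f ≋ scale a (scale b f)
    scale-* a b f = coefwise λ n → begin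
      coef (scale (a * b) f) n      ≈⟨ coef-scale (a * b) f n ⟩
      (a * b) * coef f n            ≈⟨ *-assoc _ _ _ ⟩
      a * (b * coef f n)            ≈⟨ *-congˡ (coef-scale b f n) ⟨
      a * coef (scale b f) n        ≈⟨ coef-scale a (scale b f) n ⟨
      coef (scale a (scale b f)) n  ∎

    scale-1 : ∀ f → scale 1# f ≋ f
    scale-1 f = coefwise λ n → trans (coef-scale 1# f n) (*-identityˡ _)

    scale-0 : ∀ f → scale 0# f ≋ []
    scale-0 f = coefwise λ n → trans (coef-scale 0# f n) (zeroˡ _)

    ⊞-interchange : ∀ f g h k → (f ⊞ g) ⊞ (h ⊞ k) ≋ (f ⊞ h) ⊞ (g ⊞ k)
    ⊞-interchange f g h k = coefwise λ n → begin
      coef ((f ⊞ g) ⊞ (h ⊞ k)) n                              ≈⟨ expand f g h k n ⟩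
      (coef f n + coef g n) + (coef h n + coef k n)           ≈⟨ interchange _ _ _ _ ⟩
      (coef f n + coef h n) + (coef g n + coef k n)           ≈⟨ expand f h g k n ⟨
      coef ((f ⊞ h) ⊞ (g ⊞ k)) n                              ∎
      where
      expand : ∀ f g h k n → coef ((f ⊞ g) ⊞ (h ⊞ k)) n ≈
                             (coef f n + coef g n) + (coef h n + coef k n)
      expand f g h k n = trans (coef-⊞ (f ⊞ g) (h ⊞ k) n) (+-cong (coef-⊞ f g n) (coef-⊞ h k n))

    0∷-⊞ : ∀ f g → (0# ∷ (f ⊞ g)) ≋ (0# ∷ f) ⊞ (0# ∷ g)
    0∷-⊞ f g = ∷-cong (sym (+-identityˡ 0#)) ≋-refl

    0∷[]≋[] : (0# ∷ []) ≋ []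
    0∷[]≋[] = coefwise λ { zero → refl ; (suc n) → refl }

    ⊞-identityʳ : ∀ f → f ⊞ [] ≋ f
    ⊞-identityʳ f = ⊞-comm f []

    ⊠-congˡ : ∀ f {g g′} → g ≋ g′ → f ⊠ g ≋ f ⊠ g′
    ⊠-congˡ []      p = ≋-refl
    ⊠-congˡ (a ∷ f) p = ⊞-cong (scale-cong refl p) (∷-cong refl (⊠-congˡ f p))

    ⊠-zeroʳ : ∀ f → f ⊠ [] ≋ []
    ⊠-zeroʳ []      = ≋-refl
    ⊠-zeroʳ (a ∷ f) = ≋-trans (∷-cong refl (⊠-zeroʳ f)) 0∷[]≋[]

    -- The recursion of `_⊠_` in its second argument. It is the induction step of commutativity,
    -- through which laws proved on one side of the product are moved to the other.
    ⊠-∷ : ∀ f b g → f ⊠ (b ∷ g) ≋ scale b f ⊞ (0# ∷ f ⊠ g)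
    ⊠-∷ []      b g = ≋-sym 0∷[]≋[]
    ⊠-∷ (a ∷ f) b g = coefwise λ where
      zero    → +-congʳ (*-comm a b)
      (suc n) → begin
        coef (scale a g ⊞ f ⊠ (b ∷ g)) n
          ≈⟨ coef-⊞ (scale a g) _ n ⟩
        coef (scale a g) n + coef (f ⊠ (b ∷ g)) n
          ≈⟨ +-congˡ (at (⊠-∷ f b g) n) ⟩
        coef (scale a g) n + coef (scale b f ⊞ (0# ∷ f ⊠ g)) n
          ≈⟨ +-congˡ (coef-⊞ (scale b f) _ n) ⟩
        coef (scale a g) n + (coef (scale b f) n + coef (0# ∷ f ⊠ g) n)
          ≈⟨ x∙yz≈y∙xz _ _ _ ⟩
        coef (scale b f) n + (coef (scale a g) n + coef (0# ∷ f ⊠ g) n)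
          ≈⟨ +-congˡ (coef-⊞ (scale a g) _ n) ⟨
        coef (scale b f) n + coef ((a ∷ f) ⊠ g) n
          ≈⟨ coef-⊞ (scale b f) _ n ⟨
        coef (scale b f ⊞ (a ∷ f) ⊠ g) n
          ∎

    ⊠-comm : ∀ f g → f ⊠ g ≋ g ⊠ f
    ⊠-comm []      g = ≋-sym (⊠-zeroʳ g)
    ⊠-comm (a ∷ f) g = ≋-trans (⊞-cong ≋-refl (∷-cong refl (⊠-comm f g))) (≋-sym (⊠-∷ g a f))

    ⊠-congʳ : ∀ {f f′} g → f ≋ f′ → f ⊠ g ≋ f′ ⊠ g
    ⊠-congʳ {f} {f′} g p = ≋-trans (⊠-comm f g) (≋-trans (⊠-congˡ g p) (⊠-comm g f′))

    ⊠-distribʳ : ∀ h f g → (f ⊞ g) ⊠ h ≋ f ⊠ h ⊞ g ⊠ h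
    ⊠-distribʳ h []      g       = ≋-refl
    ⊠-distribʳ h (a ∷ f) []      = ≋-sym (⊞-identityʳ _)
    ⊠-distribʳ h (a ∷ f) (b ∷ g) = ≋-trans
      (⊞-cong (scale-+ a b h) (≋-trans (∷-cong refl (⊠-distribʳ h f g)) (0∷-⊞ (f ⊠ h) (g ⊠ h))))
      (⊞-interchange (scale a h) (scale b h) (0# ∷ f ⊠ h) (0# ∷ g ⊠ h))

    scale-⊠ : ∀ a f g → scale a f ⊠ g ≋ scale a (f ⊠ g)
    scale-⊠ a []      g = ≋-refl
    scale-⊠ a (b ∷ f) g = ≋-trans
      (⊞-cong (scale-* a b g) (∷-cong (sym (zeroʳ a)) (scale-⊠ a f g)))
      (≋-sym (scale-⊞ a (scale b g) (0# ∷ f ⊠ g)))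

    0∷-⊠ : ∀ f g → (0# ∷ f) ⊠ g ≋ (0# ∷ f ⊠ g)
    0∷-⊠ f g = ⊞-cong (scale-0 g) ≋-refl

    ⊠-assoc : ∀ f g h → (f ⊠ g) ⊠ h ≋ f ⊠ (g ⊠ h)
    ⊠-assoc []      g h = ≋-refl
    ⊠-assoc (a ∷ f) g h = ≋-trans (⊠-distribʳ h (scale a g) (0# ∷ f ⊠ g))
      (⊞-cong (scale-⊠ a g h) (≋-trans (0∷-⊠ (f ⊠ g) h) (∷-cong refl (⊠-assoc f g h))))

    [_]⊠ : ∀ a f → (a ∷ []) ⊠ f ≋ scale a f
    [ a ]⊠ f = ≋-trans (⊞-cong ≋-refl 0∷[]≋[]) (⊞-identityʳ (scale a f))

    ⊠-identityˡ : ∀ f → (1# ∷ []) ⊠ f ≋ f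
    ⊠-identityˡ f = ≋-trans ([ 1# ]⊠ f) (scale-1 f)

    polynomialRing : CommutativeRing c ℓ
    polynomialRing = record
      { Carrier = List Carrier
      ; _≈_     = _≋_
      ; _+_     = _⊞_
      ; _*_     = _⊠_
      ; -_      = neg
      ; 0#      = []
      ; 1#      = 1# ∷ []
      ; isCommutativeRing = record
        { isRing = record
          { +-isAbelianGroup = record
            { isGroup = record
              { isMonoid = record
                { isSemigroup = record
                  { isMagma = record { isEquivalence = ≋-isEquivalence ; ∙-cong = ⊞-cong }
                  ; assoc   = ⊞-assoc
                  }
                ; identity = (λ f → ≋-refl) , ⊞-identityʳ
                }
              ; inverse = (λ f → ≋-trans (⊞-comm (neg f) f) (⊞-inverseʳ f)) , ⊞-inverseʳ
              ; ⁻¹-cong = λ {f} {g} p → coefwise λ n →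
                  trans (coef-neg f n) (trans (-‿cong (at p n)) (sym (coef-neg g n)))
              }
            ; comm = ⊞-comm
            }
          ; *-cong     = λ {f} {f′} {g} {g′} p q → ≋-trans (⊠-congʳ g p) (⊠-congˡ f′ q)
          ; *-assoc    = ⊠-assoc
          ; *-identity = comm∧idˡ⇒id ≋-setoid ⊠-comm ⊠-identityˡ
          ; distrib    = comm∧distrʳ⇒distr ≋-setoid ⊞-cong ⊠-comm ⊠-distribʳ
          }
        ; *-comm = ⊠-comm
        }
      }
      where
      ⊞-inverseʳ : ∀ f → f ⊞ neg f ≋ []
      ⊞-inverseʳ f = coefwise λ n →
        trans (coef-⊞ f (neg f) n) (trans (+-congˡ (coef-neg f n)) (-‿inverseʳ _))

-- Gauss's lemma: gcds of polynomials over a GCD domain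

module GaussLemma where
  open GCDDomains
  open Univariate
  open import Algebra.Bundles using (CommutativeRing)
  import Algebra.Properties.CommutativeSemigroup.Divisibility as CommutativeDivisibility
  import Algebra.Properties.Group as GroupProperties
  import Algebra.Properties.Ring as RingProperties
  import Algebra.Properties.Semiring.Divisibility as Divisibility
  import Algebra.Solver.Ring.NaturalCoefficients.Default as Solver
  open import Data.List.Base using (List; []; _∷_; length)
  open import Data.Nat.Base as ℕ using (ℕ; zero; suc; _≤_; z≤n; s≤s; s≤s⁻¹)
  import Data.Nat.Properties as ℕ
  open import Data.Product.Base using (_×_; _,_; Σ-syntax; proj₁; proj₂)
  open import Data.Sum.Base using (_⊎_; inj₁; inj₂)
  open import Level using (_⊔_)
  open import Relation.Binary.PropositionalEquality.Core as ≡ using (_≡_)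
  import Relation.Binary.Reasoning.Setoid as SetoidReasoning
  open import Relation.Nullary.Decidable.Core using (Dec; yes; no)
  open import Relation.Nullary.Negation.Core using (¬_; contradiction)

  module PolynomialsOverGCDDomain {c ℓ} (D : GCDDomain c ℓ) where
    open GCDDomain D
    open GCDDomainProperties D
    open UnivariatePolynomials commutativeRing
    private
      module R[x] = CommutativeRing polynomialRing
      module P where
        open R[x] public
        open Divisibility R[x].semiring public using (_∣_; ∣ʳ-trans; ∣ʳ-respʳ-≈; ∣ʳ-respˡ-≈; x∣ʳyx; x∣ʳy⇒x∣ʳzy; _,_)
        open CommutativeDivisibility R[x].*-commutativeSemigroup public using (x∣xy; ∙-cong-∣)
    open CommutativeDivisibility *-commutativeSemigroup using (x∣xy; x∣y⇒zx∣zy)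
    open RingProperties ring using (-‿distribˡ-*)

    -- Lists may end in zeros, so degrees are read off the coefficients and the length is only a
    -- bound. `Below 0 f` means that f is zero.
    Below : ℕ → List Carrier → Set ℓ
    Below n f = ∀ m → n ≤ m → coef f m ≈ 0#

    HasDegree : List Carrier → ℕ → Set ℓ
    HasDegree f n = ¬ coef f n ≈ 0# × Below (suc n) f

    below-length : ∀ f → Below (length f) f
    below-length []      m       p = refl
    below-length (a ∷ f) (suc m) p = below-length f m (s≤s⁻¹ p)

    -- The formula for the top coefficient holds whether or not that coefficient vanishes. It gives
    -- the additivity of degrees and also the cancellation of leading terms in pseudo-division.
    below-⊠ : ∀ m n f g → Below (suc m) f → Below (suc n) g →
              Below (suc (m ℕ.+ n)) (f ⊠ g) × coef (f ⊠ g) (m ℕ.+ n) ≈ coef f m * coef g n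
    below-⊠ m n [] g f< g< = (λ _ _ → refl) , sym (zeroˡ _)
    below-⊠ zero n (a ∷ f) g f< g< =
      (λ k n<k → trans (constant k) (trans (*-congˡ (g< k n<k)) (zeroʳ a))) , constant n
      where
      f≋[] : f ≋ []
      f≋[] = coefwise λ k → f< (suc k) (s≤s z≤n)
      shifted≋[] : (0# ∷ f ⊠ g) ≋ []
      shifted≋[] = ≋-trans (∷-cong refl (⊠-congʳ g f≋[])) 0∷[]≋[]
      constant : ∀ k → coef ((a ∷ f) ⊠ g) k ≈ a * coef g k
      constant k = trans (coef-⊠ a f g k) (trans (+-congˡ (at shifted≋[] k)) (+-identityʳ _))
    below-⊠ (suc m) n (a ∷ f) g f< g<
      with below-⊠ m n f g (λ k m<k → f< (suc k) (s≤s m<k)) g<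
    ... | fg< , top = below , trans (reduce (m ℕ.+ n) (s≤s (ℕ.m≤n+m n m))) top
      where
      reduce : ∀ k → suc n ≤ suc k → coef ((a ∷ f) ⊠ g) (suc k) ≈ coef (f ⊠ g) k
      reduce k n<k = trans (coef-⊠ a f g (suc k))
        (trans (+-congʳ (trans (*-congˡ (g< (suc k) n<k)) (zeroʳ a))) (+-identityˡ _))
      below : Below (suc (suc m ℕ.+ n)) ((a ∷ f) ⊠ g)
      below (suc k) p = trans
        (reduce k (ℕ.≤-trans (s≤s (ℕ.m≤n+m n (suc m))) p))
        (fg< k (s≤s⁻¹ p))

    degree? : ∀ f → f ≋ [] ⊎ (Σ[ n ∈ ℕ ] HasDegree f n)
    degree? [] = inj₁ ≋-refl
    degree? (a ∷ f) with degree? f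
    ... | inj₂ (n , f≉0 , f<) = inj₂ (suc n , f≉0 , λ { (suc m) p → f< m (s≤s⁻¹ p) })
    ... | inj₁ f≋[] with a ≟ 0#
    ... | yes a≈0 = inj₁ (≋-trans (∷-cong a≈0 f≋[]) 0∷[]≋[])
    ... | no  a≉0 = inj₂ (0 , a≉0 , λ { (suc m) p → at f≋[] m })

    hasDegree-⊠ : ∀ f g {m n} → HasDegree f m → HasDegree g n → HasDegree (f ⊠ g) (m ℕ.+ n)
    hasDegree-⊠ f g {m} {n} (f≉0 , f<) (g≉0 , g<) with below-⊠ m n f g f< g<
    ... | fg< , top = (λ p → x*y≉0 f≉0 g≉0 (trans (sym top) p)) , fg<

    f⊠g≋[]⇒f≋[]⊎g≋[] : ∀ {f g} → f ⊠ g ≋ [] → f ≋ [] ⊎ g ≋ []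
    f⊠g≋[]⇒f≋[]⊎g≋[] {f} {g} fg≋[] with degree? f | degree? g
    ... | inj₁ f≋[]    | _            = inj₁ f≋[]
    ... | inj₂ _       | inj₁ g≋[]    = inj₂ g≋[]
    ... | inj₂ (m , p) | inj₂ (n , q) =
      contradiction (at fg≋[] (m ℕ.+ n)) (proj₁ (hasDegree-⊠ f g p q))

    _≋?_ : ∀ f g → Dec (f ≋ g)
    []      ≋? []      = yes ≋-refl
    []      ≋? (b ∷ g) with 0# ≟ b | [] ≋? g
    ... | yes p | yes q = yes (coefwise λ { zero → p ; (suc n) → at q n })
    ... | no ¬p | _     = no λ p → ¬p (at p 0)
    ... | _     | no ¬q = no λ p → ¬q (coefwise λ n → at p (suc n))
    (a ∷ f) ≋? []      with a ≟ 0# | f ≋? []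
    ... | yes p | yes q = yes (coefwise λ { zero → p ; (suc n) → at q n })
    ... | no ¬p | _     = no λ p → ¬p (at p 0)
    ... | _     | no ¬q = no λ p → ¬q (coefwise λ n → at p (suc n))
    (a ∷ f) ≋? (b ∷ g) with a ≟ b | f ≋? g
    ... | yes p | yes q = yes (∷-cong p q)
    ... | no ¬p | _     = no λ p → ¬p (at p 0)
    ... | _     | no ¬q = no λ p → ¬q (coefwise λ n → at p (suc n))

    const : Carrier → List Carrier
    const a = a ∷ []

    const-* : ∀ a b → const (a * b) ≋ const a ⊠ const b
    const-* a b = ≋-sym ([ a ]⊠ (const b))

    const≉0 : ∀ {a} → ¬ a ≈ 0# → ¬ const a ≋ []
    const≉0 a≉0 p = a≉0 (at p 0)

    monomial : Carrier → ℕ → List Carrier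
    monomial a zero    = const a
    monomial a (suc n) = 0# ∷ monomial a n

    monomial-below : ∀ a n → Below (suc n) (monomial a n)
    monomial-below a zero    (suc m) p = refl
    monomial-below a (suc n) (suc m) p = monomial-below a n m (s≤s⁻¹ p)

    coef-monomial : ∀ a n → coef (monomial a n) n ≈ a
    coef-monomial a zero    = refl
    coef-monomial a (suc n) = coef-monomial a n

    -- Leading coefficients have no inverses, so each step multiplies f by the leading coefficient b
    -- of g before subtracting a·xᵏ·g, where a is the coefficient of f at k + n. The multiplier l
    -- collects one factor b per step, and s is the negative of a quotient.
    pseudo-divide : ∀ {g n} → HasDegree g n → ∀ k f → Below (k ℕ.+ n) f →
      Σ[ l ∈ Carrier ] Σ[ s ∈ List Carrier ] Σ[ r ∈ List Carrier ]
        (¬ l ≈ 0# × const l ⊠ f ⊞ s ⊠ g ≋ r × Below n r)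
    pseudo-divide {g} {n} g-deg zero f f< =
      1# , [] , f , 1≉0 , ≋-trans (⊞-identityʳ _) (⊠-identityˡ f) , f<
    pseudo-divide {g} {n} g-deg@(b≉0 , g<) (suc k) f f<
      with pseudo-divide {g} {n} g-deg k f′ f′<
      where
      a = coef f (k ℕ.+ n)
      b = coef g n
      x = monomial (- a) k
      f′ = const b ⊠ f ⊞ x ⊠ g
      xg = below-⊠ k n x g (monomial-below (- a) k) g<
      expand : ∀ m → coef f′ m ≈ b * coef f m + coef (x ⊠ g) m
      expand m = trans (coef-⊞ (const b ⊠ f) (x ⊠ g) m)
        (+-congʳ (trans (at ([ b ]⊠ f) m) (coef-scale b f m)))
      f′< : Below (k ℕ.+ n) f′
      f′< m k+n≤m with ℕ.m≤n⇒m<n∨m≡n k+n≤m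
      ... | inj₁ k+n<m = trans (expand m) (trans
          (+-cong (trans (*-congˡ (f< m k+n<m)) (zeroʳ b)) (proj₁ xg m k+n<m)) (+-identityˡ 0#))
      ... | inj₂ ≡.refl = begin
        coef f′ (k ℕ.+ n)                  ≈⟨ expand _ ⟩
        b * a + coef (x ⊠ g) (k ℕ.+ n)     ≈⟨ +-congˡ (proj₂ xg) ⟩
        b * a + coef x k * b               ≈⟨ +-congˡ (*-congʳ (coef-monomial (- a) k)) ⟩
        b * a + - a * b                    ≈⟨ +-cong (*-comm b a) (sym (-‿distribˡ-* a b)) ⟩
        a * b + - (a * b)                  ≈⟨ -‿inverseʳ _ ⟩
        0#                                 ∎
        where open SetoidReasoning setoid
    ... | l , s , r , l≉0 , lf′+sg≋r , r< = l * b , s ⊞ const l ⊠ x , r , x*y≉0 l≉0 b≉0 , (begin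
        const (l * b) ⊠ f ⊞ (s ⊞ const l ⊠ x) ⊠ g
          ≈⟨ ⊞-cong (⊠-congʳ f (const-* l b)) ≋-refl ⟩
        (const l ⊠ const b) ⊠ f ⊞ (s ⊞ const l ⊠ x) ⊠ g
          ≈⟨ rearrange (const l) (const b) f s x g ⟩
        const l ⊠ (const b ⊠ f ⊞ x ⊠ g) ⊞ s ⊠ g
          ≈⟨ lf′+sg≋r ⟩
        r ∎) , r<
      where
      open SetoidReasoning ≋-setoid
      b = coef g n
      x = monomial (- coef f (k ℕ.+ n)) k
      open Solver P.commutativeSemiring using (solve; _:=_; _:+_; _:*_)
      rearrange : ∀ l b f s x g → (l ⊠ b) ⊠ f ⊞ (s ⊞ l ⊠ x) ⊠ g ≋ l ⊠ (b ⊠ f ⊞ x ⊠ g) ⊞ s ⊠ g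
      rearrange = solve 6 (λ l b f s x g →
        (l :* b) :* f :+ (s :+ l :* x) :* g := l :* (b :* f :+ x :* g) :+ s :* g) ≋-refl

    -- A gcd of f and g over the field of fractions of the coefficients.
    record PseudoGCD (f g : List Carrier) : Set (c ⊔ ℓ) where
      field
        h α β q₁ q₂ : List Carrier
        c₁ c₂       : Carrier
        c₁≉0        : ¬ c₁ ≈ 0#
        c₂≉0        : ¬ c₂ ≈ 0#
        bezout      : α ⊠ f ⊞ β ⊠ g ≋ h
        c₁f≋hq₁     : const c₁ ⊠ f ≋ h ⊠ q₁
        c₂g≋hq₂     : const c₂ ⊠ g ≋ h ⊠ q₂

    pseudoGCD-0 : ∀ f {g} → g ≋ [] → PseudoGCD f g
    pseudoGCD-0 f {g} g≋[] = record
      { h = f ; α = P.1# ; β = [] ; q₁ = P.1# ; q₂ = [] ; c₁ = 1# ; c₂ = 1# ; c₁≉0 = 1≉0 ; c₂≉0 = 1≉0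
      ; bezout  = ≋-trans (⊞-identityʳ _) (⊠-identityˡ f)
      ; c₁f≋hq₁ = ⊠-comm P.1# f
      ; c₂g≋hq₂ = ≋-trans (≋-trans (⊠-identityˡ g) g≋[]) (≋-sym (⊠-zeroʳ f))
      }

    -- Euclid's algorithm, recursing on a bound for the degree of the second argument. From lf + sg
    -- = r, c₁g = hq₁ and c₂r = hq₂ follows c₁c₂l·f = h(c₁q₂ - s·c₂q₁), which gives the new
    -- multiplier and cofactor of f.
    pseudoGCD : ∀ N f g → Below N g → PseudoGCD f g
    pseudoGCD zero    f g g< = pseudoGCD-0 f (coefwise λ n → g< n z≤n)
    pseudoGCD (suc N) f g g< with degree? g
    ... | inj₁ g≋[] = pseudoGCD-0 f g≋[]
    ... | inj₂ (n , g-deg) with pseudo-divide {g} g-deg (length f) f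
                                  (λ m p → below-length f m (ℕ.≤-trans (ℕ.m≤m+n _ n) p))
    ... | l , s , r , l≉0 , lf+sg≋r , r< = record
      { h = h ; α = β ⊠ const l ; β = α ⊞ β ⊠ s
      ; q₁ = const c₁ ⊠ q₂ ⊞ neg s ⊠ (const c₂ ⊠ q₁) ; q₂ = q₁
      ; c₁ = c₁ * (c₂ * l) ; c₂ = c₁
      ; c₁≉0 = x*y≉0 c₁≉0 (x*y≉0 c₂≉0 l≉0) ; c₂≉0 = c₁≉0
      ; bezout = begin
          (β ⊠ const l) ⊠ f ⊞ (α ⊞ β ⊠ s) ⊠ g   ≈⟨ rearrange₁ α β (const l) s f g ⟩
          α ⊠ g ⊞ β ⊠ (const l ⊠ f ⊞ s ⊠ g)     ≈⟨ ⊞-cong ≋-refl (⊠-congˡ β lf+sg≋r) ⟩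
          α ⊠ g ⊞ β ⊠ r                         ≈⟨ bezout ⟩
          h                                     ∎
      ; c₁f≋hq₁ = begin
          const (c₁ * (c₂ * l)) ⊠ f
            ≈⟨ ⊠-congʳ f (≋-trans (const-* c₁ (c₂ * l)) (⊠-congˡ (const c₁) (const-* c₂ l))) ⟩
          (const c₁ ⊠ (const c₂ ⊠ const l)) ⊠ f
            ≈⟨ rearrange₂ (const c₁) (const c₂) (const l) f ⟩
          const c₁ ⊠ (const c₂ ⊠ (const l ⊠ f))
            ≈⟨ ⊠-congˡ (const c₁) (⊠-congˡ (const c₂) lf≋r-sg) ⟩
          const c₁ ⊠ (const c₂ ⊠ (r ⊞ neg s ⊠ g))
            ≈⟨ rearrange₃ (const c₁) (const c₂) r (neg s) g ⟩
          const c₁ ⊠ (const c₂ ⊠ r) ⊞ (neg s ⊠ const c₂) ⊠ (const c₁ ⊠ g)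
            ≈⟨ ⊞-cong (⊠-congˡ (const c₁) c₂g≋hq₂) (⊠-congˡ (neg s ⊠ const c₂) c₁f≋hq₁) ⟩
          const c₁ ⊠ (h ⊠ q₂) ⊞ (neg s ⊠ const c₂) ⊠ (h ⊠ q₁)
            ≈⟨ rearrange₄ (const c₁) (const c₂) h (neg s) q₁ q₂ ⟩
          h ⊠ (const c₁ ⊠ q₂ ⊞ neg s ⊠ (const c₂ ⊠ q₁)) ∎
      ; c₂g≋hq₂ = c₁f≋hq₁
      }
      where
      open SetoidReasoning ≋-setoid
      open Solver P.commutativeSemiring using (solve; _:=_; _:+_; _:*_)
      n≤N : n ≤ N
      n≤N with ℕ.≤-<-connex n N
      ... | inj₁ n≤N = n≤N
      ... | inj₂ N<n = contradiction (g< n N<n) (proj₁ g-deg)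
      open PseudoGCD (pseudoGCD N g r (λ m N≤m → r< m (ℕ.≤-trans n≤N N≤m)))
      lf≋r-sg : const l ⊠ f ≋ r ⊞ neg s ⊠ g
      lf≋r-sg = begin
        const l ⊠ f                                 ≈⟨ ⊞-identityʳ _ ⟨
        const l ⊠ f ⊞ []                            ≈⟨ ⊞-cong ≋-refl (⊠-congʳ g (P.-‿inverseʳ s)) ⟨
        const l ⊠ f ⊞ (s ⊞ neg s) ⊠ g               ≈⟨ ⊞-cong ≋-refl (⊠-distribʳ g s (neg s)) ⟩
        const l ⊠ f ⊞ (s ⊠ g ⊞ neg s ⊠ g)           ≈⟨ ⊞-assoc (const l ⊠ f) _ _ ⟨
        (const l ⊠ f ⊞ s ⊠ g) ⊞ neg s ⊠ g           ≈⟨ ⊞-cong lf+sg≋r ≋-refl ⟩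
        r ⊞ neg s ⊠ g                               ∎
      rearrange₁ : ∀ α β l s f g → (β ⊠ l) ⊠ f ⊞ (α ⊞ β ⊠ s) ⊠ g ≋ α ⊠ g ⊞ β ⊠ (l ⊠ f ⊞ s ⊠ g)
      rearrange₁ = solve 6 (λ α β l s f g →
        (β :* l) :* f :+ (α :+ β :* s) :* g := α :* g :+ β :* (l :* f :+ s :* g)) ≋-refl
      rearrange₂ : ∀ a b l f → (a ⊠ (b ⊠ l)) ⊠ f ≋ a ⊠ (b ⊠ (l ⊠ f))
      rearrange₂ = solve 4 (λ a b l f → (a :* (b :* l)) :* f := a :* (b :* (l :* f))) ≋-refl
      rearrange₃ : ∀ a b r s g → a ⊠ (b ⊠ (r ⊞ s ⊠ g)) ≋ a ⊠ (b ⊠ r) ⊞ (s ⊠ b) ⊠ (a ⊠ g)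
      rearrange₃ = solve 5 (λ a b r s g →
        a :* (b :* (r :+ s :* g)) := a :* (b :* r) :+ (s :* b) :* (a :* g)) ≋-refl
      rearrange₄ : ∀ a b h s q₁ q₂ → a ⊠ (h ⊠ q₂) ⊞ (s ⊠ b) ⊠ (h ⊠ q₁) ≋ h ⊠ (a ⊠ q₂ ⊞ s ⊠ (b ⊠ q₁))
      rearrange₄ = solve 6 (λ a b h s q₁ q₂ →
        a :* (h :* q₂) :+ (s :* b) :* (h :* q₁) := h :* (a :* q₂ :+ s :* (b :* q₁))) ≋-refl

    infix 4 _∣ᶜ_
    _∣ᶜ_ : Carrier → List Carrier → Set (c ⊔ ℓ)
    d ∣ᶜ f = ∀ n → d ∣ coef f n

    ∣ᶜ-resp-≋ : ∀ {d f g} → f ≋ g → d ∣ᶜ f → d ∣ᶜ g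
    ∣ᶜ-resp-≋ f≋g d∣f n = ∣ʳ-respʳ-≈ (at f≋g n) (d∣f n)

    ∣ᶜ⇒∣ : ∀ {d} f → d ∣ᶜ f → const d P.∣ f
    ∣ᶜ⇒∣ {d} f d∣f with quotient f d∣f
      where
      quotient : ∀ f → d ∣ᶜ f → Σ[ q ∈ List Carrier ] scale d q ≋ f
      quotient []      d∣f = [] , ≋-refl
      quotient (a ∷ f) d∣f with d∣f 0 | quotient f (λ n → d∣f (suc n))
      ... | b , bd≈a | q , dq≋f = b ∷ q , ∷-cong (trans (*-comm d b) bd≈a) dq≋f
    ... | q , dq≋f = q P., ≋-trans (⊠-comm q (const d)) (≋-trans ([ d ]⊠ q) dq≋f)

    ∣⇒∣ᶜ : ∀ {d f} → const d P.∣ f → d ∣ᶜ f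
    ∣⇒∣ᶜ {d} {f} (q P., qd≋f) n = coef q n , trans (*-comm _ d)
      (trans (sym (coef-scale d q n)) (at (≋-trans (≋-sym ([ d ]⊠ q)) (≋-trans (⊠-comm (const d) q) qd≋f)) n))

    gcdᶜ : ∀ f → Σ[ g ∈ Carrier ] (g ∣ᶜ f × (∀ {d} → d ∣ᶜ f → d ∣ g))
    gcdᶜ []      = 0# , (λ _ → ∣0) , (λ d∣f → d∣f 0)
    gcdᶜ (a ∷ f) with gcdᶜ f
    ... | g , g∣f , g-universal with gcd a g
    ... | h , h∣a , h∣g , h-universal =
      h , (λ { zero → h∣a ; (suc n) → ∣ʳ-trans h∣g (g∣f n) })
        , λ d∣af → h-universal (d∣af 0) (g-universal (λ n → d∣af (suc n)))

    Primitive : List Carrier → Set (c ⊔ ℓ)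
    Primitive f = ∀ {d} → d ∣ᶜ f → d ∣ 1#

    -- The content of af is a up to a unit. Let g be the gcd of the coefficients of af; a divides g,
    -- so g = ka, and cancelling a shows that k divides every coefficient of f. Hence k is a unit
    -- and g divides a.
    ∣ᶜ-scale-primitive : ∀ {d} a f → Primitive f → d ∣ᶜ scale a f → d ∣ a
    ∣ᶜ-scale-primitive {d} a f prim d∣af with a ≟ 0#
    ... | yes a≈0 = ∣ʳ-respʳ-≈ (sym a≈0) ∣0
    ... | no  a≉0 with gcdᶜ (scale a f)
    ... | g , g∣af , universal
        with universal {a} (λ n → ∣ʳ-respʳ-≈ (sym (coef-scale a f n)) (x∣xy a (coef f n)))
    ... | k , ka≈g = ∣ʳ-trans (universal d∣af) (∣ʳ-respˡ-≈ ak≈g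
        (∣ʳ-respʳ-≈ (*-identityʳ a) (x∣y⇒zx∣zy a (prim λ n →
          ∣-cancelˡ-≉0 a≉0 (∣ʳ-respˡ-≈ (sym ak≈g) (∣ʳ-respʳ-≈ (coef-scale a f n) (g∣af n)))))))
      where ak≈g = trans (*-comm a k) ka≈g

    -- The length is preserved because `primitive-⊠` recurses on lengths. A list of zeros gets the
    -- factor `0#` and a list with head `1#`, which is primitive.
    primitivePart : ∀ a f → Σ[ d ∈ Carrier ] Σ[ a′ ∈ Carrier ] Σ[ f′ ∈ List Carrier ]
      (scale d (a′ ∷ f′) ≋ (a ∷ f) × length f′ ≡ length f × Primitive (a′ ∷ f′))
    primitivePart a [] = a , 1# , [] , ∷-cong (*-identityʳ a) ≋-refl , ≡.refl , λ p → p 0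
    primitivePart a (b ∷ f) with primitivePart b f
    ... | d , b′ , f′ , df′≋f , same , prim with gcd a d
    ... | g , g∣a@(a′ , a′g≈a) , (k , kg≈d) , universal with g ≟ 0#
    ... | yes g≈0 = 0# , 1# , b ∷ f
        , ≋-trans (scale-0 (1# ∷ b ∷ f)) (≋-sym (coefwise λ { zero → a≈0 ; (suc n) → bf≈0 n }))
        , ≡.refl , λ p → p 0
      where
      a≈0 : a ≈ 0#
      a≈0 = trans (sym a′g≈a) (trans (*-congˡ g≈0) (zeroʳ a′))
      d≈0 : d ≈ 0#
      d≈0 = trans (sym kg≈d) (trans (*-congˡ g≈0) (zeroʳ k))
      bf≈0 : ∀ n → coef (b ∷ f) n ≈ 0#
      bf≈0 n = trans (sym (at df′≋f n)) (trans (coef-scale d (b′ ∷ f′) n) (trans (*-congʳ d≈0) (zeroˡ _)))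
    ... | no g≉0 = g , a′ , scale k (b′ ∷ f′)
        , ∷-cong (trans (*-comm g a′) a′g≈a) (≋-trans (≋-sym (scale-* g k (b′ ∷ f′)))
            (≋-trans (scale-cong (trans (*-comm g k) kg≈d) ≋-refl) df′≋f))
        , ≡.cong suc (≡.trans (length-map (k *_) f′) same)
        , λ {e} e∣ → ∣-cancelˡ-≉0 g≉0 (∣ʳ-respʳ-≈ (sym (*-identityʳ g))
            (universal (∣ʳ-respʳ-≈ (trans (*-comm g a′) a′g≈a) (x∣y⇒zx∣zy g (e∣ 0)))
                       (∣ʳ-respʳ-≈ (trans (*-comm g k) kg≈d)
                         (x∣y⇒zx∣zy g (∣ᶜ-scale-primitive k (b′ ∷ f′) prim (λ n → e∣ (suc n)))))))
      where open import Data.List.Properties using (length-map)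

    -- Gauss's lemma.  A divisor d of f ⊠ g is shown to be coprime to the
    -- constant coefficient of f, hence by symmetry to that of g; but d
    -- divides the product of the two.
    primitive-⊠ : ∀ N f g → length f ℕ.+ length g ≤ N → Primitive f → Primitive g → Primitive (f ⊠ g)
    primitive-⊠ N [] g _ prim-f _ _ = contradiction (0∣x⇒x≈0 (prim-f (λ _ → ∣0))) 1≉0
    primitive-⊠ N (a ∷ f) [] _ _ prim-g _ = contradiction (0∣x⇒x≈0 (prim-g (λ _ → ∣0))) 1≉0
    primitive-⊠ (suc N) (a ∷ f) (b ∷ g) (s≤s len) prim-f prim-g {d} d∣fg =
      coprime-head b g (a ∷ f) prim-g prim-f len′ (∣ᶜ-resp-≋ (⊠-comm (a ∷ f) (b ∷ g)) d∣fg) ∣ʳ-refl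
        (coprime⇒∣x*y⇒∣y (coprime-head a f (b ∷ g) prim-f prim-g len d∣fg)
          (∣ʳ-respʳ-≈ (+-identityʳ (a * b)) (d∣fg 0)))
      where
      len′ : length g ℕ.+ suc (length f) ≤ N
      len′ = ℕ.≤-trans (ℕ.≤-reflexive (≡.trans (ℕ.+-suc (length g) (length f))
        (≡.trans (≡.cong suc (ℕ.+-comm (length g) (length f))) (≡.sym (ℕ.+-suc (length f) (length g)))))) len
      coprime-head : ∀ a f g → Primitive (a ∷ f) → Primitive g → length f ℕ.+ length g ≤ N →
                     d ∣ᶜ (a ∷ f) ⊠ g → Coprime d a
      coprime-head a f g prim-f prim-g len d∣fg {e} e∣d e∣a =
        prim-f λ { zero → e∣a ; (suc n) → e∣f f len e∣fg n }
        where
        e∣fg : e ∣ᶜ f ⊠ g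
        e∣fg n = ∣x∣x+y⇒∣y (∣ʳ-trans e∣a (x∣xy a (coef g (suc n))))
          (∣ʳ-respʳ-≈ (coef-⊠ a f g (suc n)) (∣ʳ-trans e∣d (d∣fg (suc n))))
        -- The tail of a primitive list need not be primitive. Its content k is split off; by
        -- induction the primitive part times g is primitive, so e divides k and with it every
        -- coefficient of the tail.
        e∣f : ∀ f → length f ℕ.+ length g ≤ N → e ∣ᶜ f ⊠ g → e ∣ᶜ f
        e∣f []      _   _    n = ∣0
        e∣f (b ∷ f) len e∣fg n with primitivePart b f
        ... | k , b′ , f′ , kf′≋f , same , prim = ∣ʳ-respʳ-≈ (at kf′≋f n)
          (∣ʳ-respʳ-≈ (sym (coef-scale k (b′ ∷ f′) n)) (∣ʳ-trans e∣k (x∣xy k _)))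
          where
          e∣k : e ∣ k
          e∣k = ∣ᶜ-scale-primitive k ((b′ ∷ f′) ⊠ g)
            (primitive-⊠ N (b′ ∷ f′) g
              (ℕ.≤-trans (ℕ.≤-reflexive (≡.cong (λ m → suc m ℕ.+ length g) same)) len) prim prim-g)
            (∣ᶜ-resp-≋ (≋-trans (⊠-congʳ g (≋-sym kf′≋f)) (scale-⊠ k (b′ ∷ f′) g)) e∣fg)

    content : ∀ f → Σ[ d ∈ Carrier ] Σ[ f′ ∈ List Carrier ] (const d ⊠ f′ ≋ f × Primitive f′)
    content []      = 0# , P.1# , ≋-trans ([ 0# ]⊠ P.1#) (scale-0 P.1#) , λ p → p 0
    content (a ∷ f) with primitivePart a f
    ... | d , a′ , f′ , p , _ , prim = d , a′ ∷ f′ , ≋-trans ([ d ]⊠ (a′ ∷ f′)) p , prim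

    ⊠-cancelˡ : ∀ {f} → ¬ f ≋ [] → ∀ {g h} → f ⊠ g ≋ f ⊠ h → g ≋ h
    ⊠-cancelˡ {f} f≉0 {g} {h} fg≋fh with f⊠g≋[]⇒f≋[]⊎g≋[] {f} {g ⊞ neg h} (begin
        f ⊠ (g ⊞ neg h)         ≈⟨ P.distribˡ f g (neg h) ⟩
        f ⊠ g ⊞ f ⊠ neg h       ≈⟨ ⊞-cong fg≋fh ≋-refl ⟩
        f ⊠ h ⊞ f ⊠ neg h       ≈⟨ P.distribˡ f h (neg h) ⟨
        f ⊠ (h ⊞ neg h)         ≈⟨ ⊠-congˡ f (P.-‿inverseʳ h) ⟩
        f ⊠ []                  ≈⟨ ⊠-zeroʳ f ⟩
        []                      ∎)
      where open SetoidReasoning ≋-setoid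
    ... | inj₁ f≋0 = contradiction f≋0 f≉0
    ... | inj₂ g-h≋0 = x-y≈0⇒x≈y g h g-h≋0
      where open GroupProperties P.+-group using () renaming (x∙y⁻¹≈ε⇒x≈y to x-y≈0⇒x≈y)

    -- A primitive divisor over the field of fractions is a divisor. With q = dq′ and q′ primitive,
    -- hq′ is primitive by Gauss's lemma, so kf = d·hq′ forces k to divide d, and k cancels.
    primitive∣const⊠⇒∣ : ∀ {k} h f q → ¬ k ≈ 0# → Primitive h → const k ⊠ f ≋ h ⊠ q → h P.∣ f
    primitive∣const⊠⇒∣ {k} h f q k≉0 prim-h kf≋hq with content q
    ... | d , q′ , dq′≋q , prim-q′ with ∣ᶜ-scale-primitive {k} d (h ⊠ q′) (primitive-⊠ _ h q′ ℕ.≤-refl prim-h prim-q′)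
          (∣ᶜ-resp-≋ kf≋dhq′ (∣⇒∣ᶜ {k} {const k ⊠ f} (P.x∣xy (const k) f)))
      where
      open SetoidReasoning ≋-setoid
      kf≋dhq′ : const k ⊠ f ≋ scale d (h ⊠ q′)
      kf≋dhq′ = begin
        const k ⊠ f             ≈⟨ kf≋hq ⟩
        h ⊠ q                   ≈⟨ ⊠-comm h q ⟩
        q ⊠ h                   ≈⟨ ⊠-congʳ h dq′≋q ⟨
        (const d ⊠ q′) ⊠ h      ≈⟨ ⊠-assoc (const d) q′ h ⟩
        const d ⊠ (q′ ⊠ h)      ≈⟨ ⊠-congˡ (const d) (⊠-comm q′ h) ⟩
        const d ⊠ (h ⊠ q′)      ≈⟨ [ d ]⊠ (h ⊠ q′) ⟩
        scale d (h ⊠ q′)        ∎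
    ... | e , ek≈d = const e ⊠ q′ P., ≋-sym (⊠-cancelˡ (const≉0 k≉0) (begin
        const k ⊠ f                     ≈⟨ kf≋hq ⟩
        h ⊠ q                           ≈⟨ ⊠-congˡ h dq′≋q ⟨
        h ⊠ (const d ⊠ q′)              ≈⟨ ⊠-congˡ h (⊠-congʳ q′ (≋-trans (∷-cong (sym ek≈d) ≋-refl) (const-* e k))) ⟩
        h ⊠ ((const e ⊠ const k) ⊠ q′)  ≈⟨ rearrange h (const e) (const k) q′ ⟩
        const k ⊠ ((const e ⊠ q′) ⊠ h)  ∎))
      where
      open SetoidReasoning ≋-setoid
      open Solver P.commutativeSemiring using (solve; _:=_; _:+_; _:*_)
      rearrange : ∀ h e k q → h ⊠ ((e ⊠ k) ⊠ q) ≋ k ⊠ ((e ⊠ q) ⊠ h)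
      rearrange = solve 4 (λ h e k q → h :* ((e :* k) :* q) := k :* ((e :* q) :* h)) ≋-refl

    -- The gcd is the gcd of the two contents times the primitive part of the pseudo-gcd. The Bézout
    -- identity shows that it is greatest: the primitive part of a common divisor divides a multiple
    -- of h′ by a nonzero constant, hence h′ itself.
    polynomial-gcd : ∀ f g → Σ[ h ∈ List Carrier ]
      (h P.∣ f × h P.∣ g × (∀ {d} → d P.∣ f → d P.∣ g → d P.∣ h))
    polynomial-gcd f g with pseudoGCD (length g) f g (below-length g)
    ... | pg with content (PseudoGCD.h pg) | content f | content g
    ... | e , h′ , eh′≋h , prim-h′ | c₁ , f′ , c₁f′≋f , prim-f′ | c₂ , g′ , c₂g′≋g , prim-g′
        with gcd c₁ c₂
    ... | γ , γ∣c₁ , γ∣c₂ , universal =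
      const γ ⊠ h′
      , divides c₁f′≋f γ∣c₁ prim-f′ PG.c₁≉0 PG.c₁f≋hq₁
      , divides c₂g′≋g γ∣c₂ prim-g′ PG.c₂≉0 PG.c₂g≋hq₂
      , greatest
      where
      module PG = PseudoGCD pg
      h≋h′e = ≋-trans (≋-sym eh′≋h) (⊠-comm (const e) h′)
      const-∣ : ∀ {a b} → a ∣ b → const a P.∣ const b
      const-∣ {a} (q , qa≈b) = const q P., ≋-trans (≋-sym (const-* q a)) (∷-cong qa≈b ≋-refl)
      divides : ∀ {k f k₁ f₁ q} → const k₁ ⊠ f₁ ≋ f → γ ∣ k₁ → Primitive f₁ → ¬ k ≈ 0# →
                const k ⊠ f ≋ PG.h ⊠ q → const γ ⊠ h′ P.∣ f
      divides {k} {f} {k₁} {f₁} {q} k₁f₁≋f γ∣k₁ prim-f₁ k≉0 kf≋hq with k₁ ≟ 0#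
      ... | yes k₁≈0 = P.∣ʳ-respʳ-≈ k₁f₁≋f ([] P., ≋-sym (≋-trans ([ k₁ ]⊠ f₁)
                         (≋-trans (scale-cong k₁≈0 ≋-refl) (scale-0 f₁))))
      ... | no  k₁≉0 = P.∣ʳ-respʳ-≈ k₁f₁≋f (P.∙-cong-∣ (const-∣ γ∣k₁)
        (primitive∣const⊠⇒∣ {k * k₁} h′ f₁ (const e ⊠ q) (x*y≉0 k≉0 k₁≉0) prim-h′ (begin
          const (k * k₁) ⊠ f₁        ≈⟨ ⊠-congʳ f₁ (const-* k k₁) ⟩
          (const k ⊠ const k₁) ⊠ f₁  ≈⟨ ⊠-assoc (const k) (const k₁) f₁ ⟩
          const k ⊠ (const k₁ ⊠ f₁)  ≈⟨ ⊠-congˡ (const k) k₁f₁≋f ⟩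
          const k ⊠ f                ≈⟨ kf≋hq ⟩
          PG.h ⊠ q                   ≈⟨ ⊠-congʳ q h≋h′e ⟩
          (h′ ⊠ const e) ⊠ q         ≈⟨ ⊠-assoc h′ (const e) q ⟩
          h′ ⊠ (const e ⊠ q)         ∎)))
        where open SetoidReasoning ≋-setoid
      greatest : ∀ {d} → d P.∣ f → d P.∣ g → d P.∣ const γ ⊠ h′
      greatest {d} d∣f d∣g with e ≟ 0#
      -- Here the pseudo-gcd is zero, so f and g are zero, their contents are zero, and the proposed
      -- gcd is zero as well.
      ... | yes e≈0 = P.∣ʳ-respʳ-≈ (≋-sym (≋-trans ([ γ ]⊠ h′)
                        (≋-trans (scale-cong γ≈0 ≋-refl) (scale-0 h′)))) ([] P., ≋-refl)
        where
        h≋[] : PG.h ≋ []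
        h≋[] = ≋-trans (≋-sym eh′≋h) (≋-trans ([ e ]⊠ h′) (≋-trans (scale-cong e≈0 ≋-refl) (scale-0 h′)))
        0∣ : ∀ {k f q a f₁} → ¬ k ≈ 0# → const k ⊠ f ≋ PG.h ⊠ q → const a ⊠ f₁ ≋ f → Primitive f₁ → 0# ∣ a
        0∣ {k} {f} {q} {a} {f₁} k≉0 kf≋hq af₁≋f prim-f₁
          with f⊠g≋[]⇒f≋[]⊎g≋[] {const k} {f} (≋-trans kf≋hq (⊠-congʳ q h≋[]))
        ... | inj₁ k≋[] = contradiction k≋[] (const≉0 k≉0)
        ... | inj₂ f≋[] = ∣ᶜ-scale-primitive a f₁ prim-f₁
          (∣ᶜ-resp-≋ (≋-trans (≋-sym f≋[]) (≋-trans (≋-sym af₁≋f) ([ a ]⊠ f₁))) (λ _ → ∣0))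
        γ≈0 : γ ≈ 0#
        γ≈0 = 0∣x⇒x≈0 (universal (0∣ PG.c₁≉0 PG.c₁f≋hq₁ c₁f′≋f prim-f′)
                                 (0∣ PG.c₂≉0 PG.c₂g≋hq₂ c₂g′≋g prim-g′))
      ... | no e≉0 with content d
      ... | k , d′ , kd′≋d , prim-d′ = P.∣ʳ-respˡ-≈ kd′≋d
          (P.∙-cong-∣ (const-∣ (universal (k∣ c₁f′≋f prim-f′ d∣f) (k∣ c₂g′≋g prim-g′ d∣g))) d′∣h′)
        where
        k∣d : k ∣ᶜ d
        k∣d = ∣ᶜ-resp-≋ (≋-trans (≋-sym ([ k ]⊠ d′)) kd′≋d)
          (λ n → ∣ʳ-respʳ-≈ (sym (coef-scale k d′ n)) (x∣xy k (coef d′ n)))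
        k∣ : ∀ {a f f₁} → const a ⊠ f₁ ≋ f → Primitive f₁ → d P.∣ f → k ∣ a
        k∣ {a} {f} {f₁} af₁≋f prim-f₁ d∣f = ∣ᶜ-scale-primitive a f₁ prim-f₁
          (∣ᶜ-resp-≋ (≋-trans (≋-sym af₁≋f) ([ a ]⊠ f₁)) (∣⇒∣ᶜ {k} {f} (P.∣ʳ-trans (∣ᶜ⇒∣ d k∣d) d∣f)))
        d′∣h′ : d′ P.∣ h′
        d′∣h′ with P.∣ʳ-trans (const k P., kd′≋d) d∣f | P.∣ʳ-trans (const k P., kd′≋d) d∣g
        ... | u P., ud′≋f | v P., vd′≋g =
          primitive∣const⊠⇒∣ {e} d′ h′ (PG.α ⊠ u ⊞ PG.β ⊠ v) e≉0 prim-d′ (begin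
            const e ⊠ h′                              ≈⟨ eh′≋h ⟩
            PG.h                                      ≈⟨ PG.bezout ⟨
            PG.α ⊠ f ⊞ PG.β ⊠ g                       ≈⟨ ⊞-cong (⊠-congˡ PG.α ud′≋f) (⊠-congˡ PG.β vd′≋g) ⟨
            PG.α ⊠ (u ⊠ d′) ⊞ PG.β ⊠ (v ⊠ d′)         ≈⟨ rearrange PG.α PG.β u v d′ ⟩
            d′ ⊠ (PG.α ⊠ u ⊞ PG.β ⊠ v)                ∎)
          where
          open SetoidReasoning ≋-setoid
          open Solver P.commutativeSemiring using (solve; _:=_; _:+_; _:*_)
          rearrange : ∀ α β u v d → α ⊠ (u ⊠ d) ⊞ β ⊠ (v ⊠ d) ≋ d ⊠ (α ⊠ u ⊞ β ⊠ v)
          rearrange = solve 5 (λ α β u v d →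
            α :* (u :* d) :+ β :* (v :* d) := d :* (α :* u :+ β :* v)) ≋-refl

    polynomialGCDDomain : GCDDomain c ℓ
    polynomialGCDDomain = record
      { commutativeRing = polynomialRing
      ; _≟_ = _≋?_
      ; 1≉0 = const≉0 1≉0
      ; x*y≈0⇒x≈0⊎y≈0 = λ {f} {g} → f⊠g≋[]⇒f≋[]⊎g≋[] {f} {g}
      ; gcd = polynomial-gcd
      }

-- Finite sets of classes; a finite Heyting field is a GCD domain

module FiniteFields where
  open import Defs
  open GCDDomains
  open import Algebra.Apartness.Bundles using (HeytingField; HeytingCommutativeRing)
  open import Algebra.Bundles using (CommutativeRing)
  open import Data.Fin.Base using (Fin)
  import Data.Fin.Properties as Fin
  open import Data.Product.Base using (_×_; _,_; ∃-syntax; proj₁; proj₂)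
  open import Data.Sum.Base using (_⊎_; inj₁; inj₂)
  open import Function.Bundles using (Bijection)
  open import Relation.Binary.Bundles using (Setoid)
  open import Relation.Binary.Definitions using (Decidable)
  open import Relation.Binary.PropositionalEquality.Core as ≡ using (_≡_)
  open import Relation.Nullary.Decidable.Core using (yes; no; map′)
  open import Relation.Nullary.Negation.Core using (¬_; contradiction)

  module Enumerated {a ℓ} {S : Setoid a ℓ} {n} (card : HasCardinality S n) where
    open Setoid S
    open Bijection card public using (to; cong; injective)

    from : Fin n → Carrier
    from i = proj₁ (Bijection.surjective card i)

    to-from : ∀ i → to (from i) ≡ i
    to-from i = proj₂ (Bijection.surjective card i) refl

    from-to : ∀ x → from (to x) ≈ x
    from-to x = injective (to-from (to x))

    from-injective : ∀ {i j} → from i ≈ from j → i ≡ j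
    from-injective {i} {j} p = ≡.trans (≡.sym (to-from i)) (≡.trans (cong p) (to-from j))

    decidable : Decidable _≈_
    decidable x y = map′ injective cong (to x Fin.≟ to y)

  module FiniteHeytingField {c ℓ₁ ℓ₂} (F : HeytingField c ℓ₁ ℓ₂) {q}
                            (card : HasCardinality (HeytingField.setoid F) q) where
    open CommutativeRing (HeytingCommutativeRing.commutativeRing (HeytingField.heytingCommutativeRing F))
    open HeytingField F using (_#_; #-irrefl; #⇒invertible; invertible⇒#; tight)
    open import Algebra.Properties.Ring ring using (-0#≈0#)
    open Enumerated {S = setoid} card using (from; to; from-to; decidable)
    open import Algebra.Properties.Semiring.Divisibility semiring using (_∣_; ∣ʳ-refl; ∣ʳ-respʳ-≈; _∣0; _,_)

    x-0≈x : ∀ x → x - 0# ≈ x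
    x-0≈x x = trans (+-congˡ -0#≈0#) (+-identityʳ x)

    1≉0 : ¬ 1# ≈ 0#
    1≉0 1≈0 = #-irrefl 1≈0 (invertible⇒# (1# , trans (*-identityˡ _) (x-0≈x 1#) , trans (*-identityʳ _) (x-0≈x 1#)))

    -- `¬ x ≈ 0#` does not yield apartness from `0#` directly. A search through the finite field
    -- decides whether an inverse exists; if the search fails, x is not apart from `0#`, so it
    -- equals `0#` by tightness.
    inverse : ∀ {x} → ¬ x ≈ 0# → ∃[ y ] y * x ≈ 1#
    inverse {x} x≉0 with Fin.any? (λ i → decidable (from i * x) 1#)
    ... | yes (i , p) = from i , p
    ... | no none = contradiction (proj₁ (tight x 0#) λ x#0 →
            let y , yx≈1 , _ = #⇒invertible x#0
            in none (to y , trans (*-congʳ (from-to y)) (trans (*-congˡ (sym (x-0≈x x))) yx≈1)))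
          x≉0

    gcdDomain : GCDDomain c ℓ₁
    gcdDomain = record
      { commutativeRing = HeytingCommutativeRing.commutativeRing (HeytingField.heytingCommutativeRing F)
      ; _≟_ = decidable
      ; 1≉0 = 1≉0
      ; x*y≈0⇒x≈0⊎y≈0 = no-zero-divisors
      ; gcd = gcd
      }
      where
      no-zero-divisors : ∀ {x y} → x * y ≈ 0# → x ≈ 0# ⊎ y ≈ 0#
      no-zero-divisors {x} {y} xy≈0 with decidable x 0#
      ... | yes x≈0 = inj₁ x≈0
      ... | no  x≉0 with inverse x≉0
      ... | z , zx≈1 = inj₂ (trans (sym (*-identityˡ y)) (trans (*-congʳ (sym zx≈1))
                         (trans (*-assoc z x y) (trans (*-congˡ xy≈0) (zeroʳ z)))))
      gcd : ∀ a b → ∃[ g ] (g ∣ a × g ∣ b × (∀ {d} → d ∣ a → d ∣ b → d ∣ g))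
      gcd a b with decidable a 0#
      ... | yes a≈0 = b , ∣ʳ-respʳ-≈ (sym a≈0) (b ∣0) , ∣ʳ-refl , λ _ d∣b → d∣b
      ... | no  a≉0 with inverse a≉0
      ... | z , za≈1 = a , ∣ʳ-refl , (b * z , trans (*-assoc b z a) (trans (*-congˡ za≈1) (*-identityʳ b)))
                     , λ d∣a _ → d∣a

-- Iterated polynomial rings and their monomials

module SeveralVariables where
  open GCDDomains
  open Univariate
  open GaussLemma
  open import Data.List.Base using ([]; _∷_)
  open import Data.Nat.Base as ℕ using (ℕ; zero; suc)
  import Data.Nat.Properties as ℕ
  open import Data.Product.Base using (_,_; ∃-syntax)
  open import Data.Sum.Base using (inj₁; inj₂)
  open import Data.Vec.Base as Vec using (Vec; []; _∷_; zipWith; replicate)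
  open import Relation.Binary.PropositionalEquality.Core as ≡ using (_≡_; _≢_)
  open import Relation.Nullary.Negation.Core using (¬_; contradiction)
  open import Relation.Nullary.Decidable.Core using (yes; no)

  module IteratedPolynomials {c ℓ} (D : GCDDomain c ℓ) where
    open GCDDomain D

    iterated : ℕ → GCDDomain c ℓ
    iterated zero    = D
    iterated (suc k) = PolynomialsOverGCDDomain.polynomialGCDDomain (iterated k)

    module T k = GCDDomain (iterated k)
    module U (k : ℕ) where
      open UnivariatePolynomials (T.commutativeRing k) public
      open PolynomialsOverGCDDomain (iterated k) public

    coefᵥ : ∀ k → T.Carrier k → Vec ℕ k → Carrier
    coefᵥ zero    a []      = a
    coefᵥ (suc k) f (n ∷ e) = coefᵥ k (U.coef k f n) e

    coefᵥ-cong : ∀ k {x y} → T._≈_ k x y → ∀ e → coefᵥ k x e ≈ coefᵥ k y e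
    coefᵥ-cong zero    x≈y []      = x≈y
    coefᵥ-cong (suc k) x≈y (n ∷ e) = coefᵥ-cong k (U.at {k} x≈y n) e

    -- Equality in the iterated ring can thus be tested on exponent vectors, the form in which
    -- equality of formal sums is defined.
    coefᵥ-injective : ∀ k {x y} → (∀ e → coefᵥ k x e ≈ coefᵥ k y e) → T._≈_ k x y
    coefᵥ-injective zero    p = p []
    coefᵥ-injective (suc k) p = U.coefwise {k} λ n → coefᵥ-injective k (λ e → p (n ∷ e))

    coefᵥ-+ : ∀ k x y e → coefᵥ k (T._+_ k x y) e ≈ coefᵥ k x e + coefᵥ k y e
    coefᵥ-+ zero    x y []      = refl
    coefᵥ-+ (suc k) f g (n ∷ e) = trans (coefᵥ-cong k (U.coef-⊞ k f g n) e) (coefᵥ-+ k _ _ e)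

    coefᵥ-0 : ∀ k e → coefᵥ k (T.0# k) e ≈ 0#
    coefᵥ-0 zero    []      = refl
    coefᵥ-0 (suc k) (n ∷ e) = coefᵥ-0 k e

    nonzero-coefᵥ : ∀ k {x} → ¬ T._≈_ k x (T.0# k) → ∃[ e ] ¬ coefᵥ k x e ≈ 0#
    nonzero-coefᵥ zero    x≉0 = [] , x≉0
    nonzero-coefᵥ (suc k) {f} f≉0 with U.degree? k f
    ... | inj₁ f≈0 = contradiction f≈0 f≉0
    ... | inj₂ (n , fₙ≉0 , _) with nonzero-coefᵥ k fₙ≉0
    ... | e , p = n ∷ e , p

    term : ∀ k → Carrier → Vec ℕ k → T.Carrier k
    term zero    a []      = a
    term (suc k) a (n ∷ e) = U.monomial k (term k a e) n

    coef-monomial-≢ : ∀ k x {m n} → m ≢ n → T._≈_ k (U.coef k (U.monomial k x m) n) (T.0# k)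
    coef-monomial-≢ k x {zero}  {zero}  m≢n = contradiction ≡.refl m≢n
    coef-monomial-≢ k x {zero}  {suc n} m≢n = T.refl k
    coef-monomial-≢ k x {suc m} {zero}  m≢n = T.refl k
    coef-monomial-≢ k x {suc m} {suc n} m≢n = coef-monomial-≢ k x (λ p → m≢n (≡.cong suc p))

    coefᵥ-term-≡ : ∀ k a e → coefᵥ k (term k a e) e ≈ a
    coefᵥ-term-≡ zero    a []      = refl
    coefᵥ-term-≡ (suc k) a (n ∷ e) =
      trans (coefᵥ-cong k (U.coef-monomial k (term k a e) n) e) (coefᵥ-term-≡ k a e)

    coefᵥ-term-≢ : ∀ k a {d e} → d ≢ e → coefᵥ k (term k a d) e ≈ 0#
    coefᵥ-term-≢ zero    a {[]}    {[]}    d≢e = contradiction ≡.refl d≢e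
    coefᵥ-term-≢ (suc k) a {m ∷ d} {n ∷ e} d≢e with m ℕ.≟ n
    ... | yes ≡.refl = trans (coefᵥ-cong k (U.coef-monomial k (term k a d) m) e)
                         (coefᵥ-term-≢ k a (λ p → d≢e (≡.cong (m ∷_) p)))
    ... | no m≢n = trans (coefᵥ-cong k (coef-monomial-≢ k (term k a d) m≢n) e) (coefᵥ-0 k e)

    monomial-cong : ∀ k {x y} n → T._≈_ k x y → U._≋_ k (U.monomial k x n) (U.monomial k y n)
    monomial-cong k zero    p = U.∷-cong k p (U.≋-refl k)
    monomial-cong k (suc n) p = U.∷-cong k (T.refl k) (monomial-cong k n p)

    monomial-* : ∀ k x y m n →
      U._≋_ k (U.monomial k (T._*_ k x y) (m ℕ.+ n)) (U._⊠_ k (U.monomial k x m) (U.monomial k y n))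
    monomial-* k x y (suc m) n = U.≋-trans k (U.∷-cong k (T.refl k) (monomial-* k x y m n))
      (U.≋-sym k (U.0∷-⊠ k (U.monomial k x m) (U.monomial k y n)))
    monomial-* k x y zero    n = U.≋-trans k (scale-monomial n) (U.≋-sym k (U.[_]⊠ k x (U.monomial k y n)))
      where
      scale-monomial : ∀ n → U._≋_ k (U.monomial k (T._*_ k x y) n) (U.scale k x (U.monomial k y n))
      scale-monomial zero    = U.≋-refl k
      scale-monomial (suc n) = U.∷-cong k (T.sym k (T.zeroʳ k x)) (scale-monomial n)

    term-* : ∀ k a b d e → T._≈_ k (term k (a * b) (zipWith ℕ._+_ d e)) (T._*_ k (term k a d) (term k b e))
    term-* zero    a b []      []      = refl
    term-* (suc k) a b (m ∷ d) (n ∷ e) =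
      U.≋-trans k (monomial-cong k (m ℕ.+ n) (term-* k a b d e)) (monomial-* k (term k a d) (term k b e) m n)

    term-1 : ∀ k → T._≈_ k (term k 1# (replicate k 0)) (T.1# k)
    term-1 zero    = refl
    term-1 (suc k) = U.∷-cong k (term-1 k) (U.≋-refl k)

-- Arithmetic of formal polynomials: primality, total degree, units

module MultivariateArithmetic where
  open import Defs
  open GCDDomains
  open Univariate
  open GaussLemma
  open FiniteFields
  open SeveralVariables
  open import Algebra.Apartness.Bundles using (HeytingField)
  open import Algebra.Bundles using (CommutativeMonoid; CommutativeRing)
  open import Algebra.Bundles.Raw using (RawSemiring)
  import Algebra.Properties.CommutativeSemigroup as CommutativeSemigroupProperties
  import Algebra.Properties.CommutativeSemigroup.Divisibility as CommutativeDivisibility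
  import Algebra.Properties.Monoid.Divisibility as MonoidDivisibility
  open import Data.Bool.Base using (Bool; true; false; if_then_else_)
  open import Data.List.Base using (List; []; _∷_; _++_; map; foldr; cartesianProductWith)
  open import Data.Nat.Base as ℕ using (ℕ; zero; suc; _<_)
  import Data.Nat.Properties as ℕ
  open import Data.Product.Base using (_×_; _,_; ∃-syntax; proj₁; proj₂; uncurry)
  open import Data.Sum.Base as Sum using (_⊎_; inj₁; inj₂)
  open import Data.Vec.Base as Vec using (Vec; []; _∷_; zipWith; replicate)
  open import Data.Vec.Properties using (≡-dec; zipWith-identityˡ; ∷-injectiveˡ; ∷-injectiveʳ)
  open import Relation.Binary.Bundles using (Setoid)
  open import Relation.Binary.Definitions using (tri<; tri≈; tri>)
  open import Relation.Binary.PropositionalEquality.Core as ≡ using (_≡_; _≢_)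
  import Relation.Binary.Reasoning.Setoid as SetoidReasoning
  open import Relation.Nullary.Negation.Core using (¬_; contradiction)
  open import Relation.Nullary.Decidable.Core using (does; yes; no)

  sum≡0⇒replicate-0 : ∀ {n} (e : Vec ℕ n) → Vec.sum e ≡ 0 → replicate n 0 ≡ e
  sum≡0⇒replicate-0 []         _ = ≡.refl
  sum≡0⇒replicate-0 (zero ∷ e) p = ≡.cong (0 ∷_) (sum≡0⇒replicate-0 e p)

  sum-replicate-0 : ∀ n → Vec.sum (replicate n 0) ≡ 0
  sum-replicate-0 zero    = ≡.refl
  sum-replicate-0 (suc n) = sum-replicate-0 n

  module Evaluation {a c ℓ} {X : Set a} (_∙_ : X → X → X) (R : CommutativeRing c ℓ)
                    (τ : X → CommutativeRing.Carrier R)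
                    (τ-∙ : ∀ x y → CommutativeRing._≈_ R (τ (x ∙ y)) (CommutativeRing._*_ R (τ x) (τ y))) where
    open CommutativeRing R
    open SetoidReasoning setoid

    -- The extension of a multiplicative map on terms to formal sums. It is used for `φ`, with
    -- values in k variables, and for `θ`, where a further variable records the total degree.
    evaluate : List X → Carrier
    evaluate = foldr (λ x s → τ x + s) 0#

    evaluate-++ : ∀ f g → evaluate (f ++ g) ≈ evaluate f + evaluate g
    evaluate-++ []      g = sym (+-identityˡ _)
    evaluate-++ (x ∷ f) g = trans (+-congˡ (evaluate-++ f g)) (sym (+-assoc _ _ _))

    evaluate-* : ∀ f g → evaluate (cartesianProductWith _∙_ f g) ≈ evaluate f * evaluate g
    evaluate-* []      g = sym (zeroˡ _)
    evaluate-* (x ∷ f) g = begin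
      evaluate (map (x ∙_) g ++ cartesianProductWith _∙_ f g)  ≈⟨ evaluate-++ (map (x ∙_) g) _ ⟩
      evaluate (map (x ∙_) g) + evaluate (cartesianProductWith _∙_ f g)
                                                              ≈⟨ +-cong (single g) (evaluate-* f g) ⟩
      τ x * evaluate g + evaluate f * evaluate g              ≈⟨ distribʳ _ _ _ ⟨
      (τ x + evaluate f) * evaluate g                         ∎
      where
      single : ∀ g → evaluate (map (x ∙_) g) ≈ τ x * evaluate g
      single []      = sym (zeroʳ _)
      single (y ∷ g) = trans (+-cong (τ-∙ x y) (single g)) (sym (distribˡ _ _ _))

  module PolynomialArithmetic {c ℓ₁ ℓ₂} (F : HeytingField c ℓ₁ ℓ₂) {q}
                              (card : HasCardinality (HeytingField.setoid F) q) (k : ℕ) where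
    open Polynomials F k public
    open FiniteHeytingField F card using (gcdDomain; inverse)
    private
      module F = HeytingField F
      module 𝔽 = GCDDomain gcdDomain
    open IteratedPolynomials gcdDomain

    infixl 7 _·_
    _·_ : Poly → Poly → Poly
    _·_ = RawSemiring._*_ polyRawSemiring

    𝟙 : Poly
    𝟙 = RawSemiring.1# polyRawSemiring

    open import Algebra.Definitions.RawMagma (RawSemiring.*-rawMagma polyRawSemiring) public
      using (_∣_; _,_)

    private
      module R = T k
      module Ev = Evaluation {X = F.Carrier × Monomial} (λ (a , d) (b , e) → (a F.* b) , zipWith ℕ._+_ d e)
                             R.commutativeRing (uncurry (term k)) (λ (a , d) (b , e) → term-* k a b d e)

    -- An isomorphism of formal sums, up to `_≈_`, with the iterated ring. Injectivity comes from
    -- comparing coefficients, surjectivity from `φ⁻¹`.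
    φ : Poly → R.Carrier
    φ = Ev.evaluate

    coefᵥ-φ : ∀ f e → coefᵥ k (φ f) e F.≈ coeff f e
    coefᵥ-φ [] e = coefᵥ-0 k e
    coefᵥ-φ ((a , d) ∷ f) e = F.trans (coefᵥ-+ k (term k a d) (φ f) e) (F.+-cong leading (coefᵥ-φ f e))
      where
      leading : coefᵥ k (term k a d) e F.≈ (if does (≡-dec ℕ._≟_ d e) then a else F.0#)
      leading with ≡-dec ℕ._≟_ d e
      ... | yes ≡.refl = coefᵥ-term-≡ k a d
      ... | no d≢e     = coefᵥ-term-≢ k a d≢e

    φ-cong : ∀ {f g} → f ≈ g → φ f R.≈ φ g
    φ-cong {f} {g} f≈g = coefᵥ-injective k λ e →
      F.trans (coefᵥ-φ f e) (F.trans (f≈g e) (F.sym (coefᵥ-φ g e)))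

    φ-injective : ∀ {f g} → φ f R.≈ φ g → f ≈ g
    φ-injective {f} {g} p e =
      F.trans (F.sym (coefᵥ-φ f e)) (F.trans (coefᵥ-cong k p e) (coefᵥ-φ g e))

    φ-· : ∀ f g → φ (f · g) R.≈ φ f R.* φ g
    φ-· = Ev.evaluate-*

    φ-𝟙 : φ 𝟙 R.≈ R.1#
    φ-𝟙 = R.trans (R.+-identityʳ _) (term-1 k)

    *-commutativeMonoid : CommutativeMonoid c ℓ₁
    *-commutativeMonoid = record
      { Carrier = Poly
      ; _≈_     = _≈_
      ; _∙_     = _·_
      ; ε       = 𝟙
      ; isCommutativeMonoid = record
        { isMonoid = record
          { isSemigroup = record
            { isMagma = record
              { isEquivalence = record
                { refl  = λ e → F.refl
                ; sym   = λ p e → F.sym (p e)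
                ; trans = λ p r e → F.trans (p e) (r e)
                }
              ; ∙-cong = λ {f} {f′} {g} {g′} p r → φ-injective {f · g} {f′ · g′} (R.trans (φ-· f g)
                  (R.trans (R.*-cong (φ-cong {f} {f′} p) (φ-cong {g} {g′} r)) (R.sym (φ-· f′ g′))))
              }
            ; assoc = λ f g h → φ-injective {(f · g) · h} {f · (g · h)} (begin
                φ ((f · g) · h)         ≈⟨ φ-· (f · g) h ⟩
                φ (f · g) R.* φ h       ≈⟨ R.*-congʳ (φ-· f g) ⟩
                (φ f R.* φ g) R.* φ h   ≈⟨ R.*-assoc _ _ _ ⟩
                φ f R.* (φ g R.* φ h)   ≈⟨ R.*-congˡ (φ-· g h) ⟨
                φ f R.* φ (g · h)       ≈⟨ φ-· f (g · h) ⟨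
                φ (f · (g · h))         ∎)
            }
          ; identity = (λ f → φ-injective {𝟙 · f} {f} (identityˡ f))
                     , (λ f → φ-injective {f · 𝟙} {f} (R.trans (swap f 𝟙) (identityˡ f)))
          }
        ; comm = λ f g → φ-injective {f · g} {g · f} (swap f g)
        }
      }
      where
      open SetoidReasoning R.setoid
      identityˡ : ∀ f → φ (𝟙 · f) R.≈ φ f
      identityˡ f = R.trans (φ-· 𝟙 f) (R.trans (R.*-congʳ φ-𝟙) (R.*-identityˡ _))
      swap : ∀ f g → φ (f · g) R.≈ φ (g · f)
      swap f g = R.trans (φ-· f g) (R.trans (R.*-comm _ _) (R.sym (φ-· g f)))

    open CommutativeMonoid *-commutativeMonoid public using ()
      renaming ( refl to ≈-refl; sym to ≈-sym; trans to ≈-trans; setoid to ≈-setoid; ∙-cong to ·-cong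
               ; assoc to ·-assoc; comm to ·-comm; identityˡ to ·-identityˡ; identityʳ to ·-identityʳ)
    private
      module M = CommutativeMonoid *-commutativeMonoid
      module Div = MonoidDivisibility M.monoid
      module CDiv = CommutativeDivisibility M.commutativeSemigroup

    -- Horner's scheme: the terms of the constant coefficient come with exponent 0 in the outermost
    -- variable, and those of the remaining list have that exponent raised by one. The number of
    -- variables is a separate argument because the recursion lowers it.
    monomials : ∀ k → T.Carrier k → List (F.Carrier × Vec ℕ k)
    monomials zero    a = (a , []) ∷ []
    monomials (suc k) f = layers f
      where
      layers : List (T.Carrier k) → List (F.Carrier × Vec ℕ (suc k))
      layers []      = []
      layers (x ∷ f) = map (λ (a , e) → a , 0 ∷ e) (monomials k x)
                    ++ map (λ (a , e) → a , suc (Vec.head e) ∷ Vec.tail e) (layers f)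

    φ⁻¹ : R.Carrier → Poly
    φ⁻¹ = monomials k

    coeff-monomials : ∀ k x e → Polynomials.coeff F k (monomials k x) e F.≈ coefᵥ k x e
    coeff-monomials zero    a []      = F.+-identityʳ a
    coeff-monomials (suc k) f (n ∷ e) = coeff-layers f n
      where
      open Polynomials F using () renaming (coeff to coeffₖ)
      open SetoidReasoning F.setoid
      coeff-++ : ∀ f g e → coeffₖ (suc k) (f ++ g) e F.≈ coeffₖ (suc k) f e F.+ coeffₖ (suc k) g e
      coeff-++ []      g e = F.sym (F.+-identityˡ _)
      coeff-++ (x ∷ f) g e = F.trans (F.+-congˡ (coeff-++ f g e)) (F.sym (F.+-assoc _ _ _))
      coeff-layers : ∀ f n → coeffₖ (suc k) (monomials (suc k) f) (n ∷ e) F.≈ coefᵥ (suc k) f (n ∷ e)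
      coeff-layers [] n = F.sym (coefᵥ-0 k e)
      coeff-layers (x ∷ f) zero = begin
        coeffₖ (suc k) (monomials (suc k) (x ∷ f)) (0 ∷ e)   ≈⟨ coeff-++ (map _ (monomials k x)) _ (0 ∷ e) ⟩
        _ F.+ _   ≈⟨ F.+-cong (constant (monomials k x)) (raised (monomials (suc k) f)) ⟩
        coeffₖ k (monomials k x) e F.+ F.0#                  ≈⟨ F.+-identityʳ _ ⟩
        coeffₖ k (monomials k x) e                           ≈⟨ coeff-monomials k x e ⟩
        coefᵥ k x e                                          ∎
        where
        constant : ∀ f → coeffₖ (suc k) (map (λ (a , e) → a , 0 ∷ e) f) (0 ∷ e) F.≈ coeffₖ k f e
        constant []      = F.refl
        constant ((a , d) ∷ f) = F.+-congˡ (constant f)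
        raised : ∀ f → coeffₖ (suc k) (map (λ (a , e) → a , suc (Vec.head e) ∷ Vec.tail e) f) (0 ∷ e) F.≈ F.0#
        raised []                = F.refl
        raised ((a , n ∷ d) ∷ f) = F.trans (F.+-identityˡ _) (raised f)
      coeff-layers (x ∷ f) (suc n) = begin
        coeffₖ (suc k) (monomials (suc k) (x ∷ f)) (suc n ∷ e)  ≈⟨ coeff-++ (map _ (monomials k x)) _ (suc n ∷ e) ⟩
        _ F.+ _   ≈⟨ F.+-cong (constant (monomials k x)) (raised (monomials (suc k) f)) ⟩
        F.0# F.+ coeffₖ (suc k) (monomials (suc k) f) (n ∷ e)   ≈⟨ F.+-identityˡ _ ⟩
        coeffₖ (suc k) (monomials (suc k) f) (n ∷ e)            ≈⟨ coeff-layers f n ⟩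
        coefᵥ (suc k) f (n ∷ e)                                 ∎
        where
        constant : ∀ f → coeffₖ (suc k) (map (λ (a , e) → a , 0 ∷ e) f) (suc n ∷ e) F.≈ F.0#
        constant []      = F.refl
        constant ((a , d) ∷ f) = F.trans (F.+-identityˡ _) (constant f)
        raised : ∀ f → coeffₖ (suc k) (map (λ (a , e) → a , suc (Vec.head e) ∷ Vec.tail e) f) (suc n ∷ e) F.≈
                       coeffₖ (suc k) f (n ∷ e)
        raised []                = F.refl
        raised ((a , m ∷ d) ∷ f) = F.+-congˡ (raised f)

    φ-φ⁻¹ : ∀ x → φ (φ⁻¹ x) R.≈ x
    φ-φ⁻¹ x = coefᵥ-injective k λ e → F.trans (coefᵥ-φ (φ⁻¹ x) e) (coeff-monomials k x e)

    φ-∣ : ∀ {f g} → f ∣ g → φ f R.∣ φ g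
    φ-∣ {f} {g} (h , hf≈g) = φ h R., R.trans (R.sym (φ-· h f)) (φ-cong {h · f} {g} hf≈g)

    φ-∣⁻¹ : ∀ {f g} → φ f R.∣ φ g → f ∣ g
    φ-∣⁻¹ {f} {g} (x R., xφf≈φg) = φ⁻¹ x , φ-injective {φ⁻¹ x · f} {g}
      (R.trans (φ-· (φ⁻¹ x) f) (R.trans (R.*-congʳ (φ-φ⁻¹ x)) xφf≈φg))

    irreducible⇒prime : ∀ {p} → Irreducible p → ∀ {f g} → p ∣ f · g → p ∣ f ⊎ p ∣ g
    irreducible⇒prime {p} irr {f} {g} p∣fg = Sum.map φ-∣⁻¹ φ-∣⁻¹
      (GCDDomainProperties.irreducible⇒prime (iterated k) split
        (R.∣ʳ-respʳ-≈ (φ-· f g) (φ-∣ p∣fg)))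
      where
      unit : ∀ {x} → φ⁻¹ x ∣ 𝟙 → x R.∣ R.1#
      unit {x} d = R.∣ʳ-respˡ-≈ (φ-φ⁻¹ x) (R.∣ʳ-respʳ-≈ φ-𝟙 (φ-∣ d))
      split : ∀ {x y} → φ p R.≈ x R.* y → x R.∣ R.1# ⊎ y R.∣ R.1#
      -- Irreducibility speaks of factorizations into formal sums, so a factorization in the
      -- iterated ring is first carried back by `φ⁻¹`.
      split {x} {y} φp≈xy = Sum.map unit unit (Irreducible.split-∣1 irr {φ⁻¹ x} {φ⁻¹ y}
        (φ-injective {p} {φ⁻¹ x · φ⁻¹ y} (R.trans φp≈xy (R.trans
          (R.*-cong (R.sym (φ-φ⁻¹ x)) (R.sym (φ-φ⁻¹ y))) (R.sym (φ-· (φ⁻¹ x) (φ⁻¹ y)))))))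

    ·-cancelˡ : ∀ f {g h} → ¬ f ≈ [] → f · g ≈ f · h → g ≈ h
    ·-cancelˡ f {g} {h} f≉0 fg≈fh = φ-injective {g} {h}
      (GCDDomainProperties.*-cancelˡ-≉0 (iterated k) (λ φf≈0 → f≉0 (φ-injective {f} {[]} φf≈0))
        (R.trans (R.sym (φ-· f g)) (R.trans (φ-cong {f · g} {f · h} fg≈fh) (φ-· f h))))

    private
      module S = T (suc k)
      weigh : F.Carrier × Monomial → S.Carrier
      weigh (a , e) = term (suc k) a (Vec.sum e ∷ e)

      sum-zipWith-+ : ∀ {n} (d e : Vec ℕ n) → Vec.sum (zipWith ℕ._+_ d e) ≡ Vec.sum d ℕ.+ Vec.sum e
      sum-zipWith-+ []      []      = ≡.refl
      sum-zipWith-+ (m ∷ d) (n ∷ e) = ≡.trans (≡.cong ((m ℕ.+ n) ℕ.+_) (sum-zipWith-+ d e))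
        (CommutativeSemigroupProperties.interchange ℕ.+-commutativeSemigroup m n (Vec.sum d) (Vec.sum e))

      weigh-* : ∀ x y → weigh ((proj₁ x F.* proj₁ y) , zipWith ℕ._+_ (proj₂ x) (proj₂ y)) S.≈ weigh x S.* weigh y
      weigh-* (a , d) (b , e) = S.trans
        (S.reflexive (≡.cong (λ n → term (suc k) (a F.* b) (n ∷ zipWith ℕ._+_ d e)) (sum-zipWith-+ d e)))
        (term-* (suc k) a b (Vec.sum d ∷ d) (Vec.sum e ∷ e))

      module Ew = Evaluation {X = F.Carrier × Monomial} (λ (a , d) (b , e) → (a F.* b) , zipWith ℕ._+_ d e)
                             S.commutativeRing weigh weigh-*

    -- f(x₁, …, x_k) ↦ f(x₁y, …, x_k y), which turns the total degree into the degree in y.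
    θ : Poly → List R.Carrier
    θ = Ew.evaluate

    private
      coefᵥ-θ-≡ : ∀ f e → coefᵥ k (U.coef k (θ f) (Vec.sum e)) e F.≈ coeff f e
      coefᵥ-θ-≡ [] e = coefᵥ-0 k e
      coefᵥ-θ-≡ ((a , d) ∷ f) e =
        F.trans (coefᵥ-+ (suc k) (weigh (a , d)) (θ f) (Vec.sum e ∷ e)) (F.+-cong leading (coefᵥ-θ-≡ f e))
        where
        leading : coefᵥ (suc k) (weigh (a , d)) (Vec.sum e ∷ e) F.≈ (if does (≡-dec ℕ._≟_ d e) then a else F.0#)
        leading with ≡-dec ℕ._≟_ d e
        ... | yes ≡.refl = coefᵥ-term-≡ (suc k) a (Vec.sum d ∷ d)
        ... | no d≢e     = coefᵥ-term-≢ (suc k) a {Vec.sum d ∷ d} {Vec.sum e ∷ e} (λ p → d≢e (∷-injectiveʳ p))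

      coefᵥ-θ-≢ : ∀ f {n} e → Vec.sum e ≢ n → coefᵥ k (U.coef k (θ f) n) e F.≈ F.0#
      coefᵥ-θ-≢ [] e _ = coefᵥ-0 k e
      coefᵥ-θ-≢ ((a , d) ∷ f) {n} e e≢n =
        F.trans (coefᵥ-+ (suc k) (weigh (a , d)) (θ f) (n ∷ e))
          (F.trans (F.+-cong (coefᵥ-term-≢ (suc k) a {Vec.sum d ∷ d} {n ∷ e} λ p → e≢n
            (≡.trans (≡.cong Vec.sum (≡.sym (∷-injectiveʳ p))) (∷-injectiveˡ p)))
            (coefᵥ-θ-≢ f e e≢n)) (F.+-identityˡ _))

    hasTotalDegree⇒ : ∀ {m} f → HasTotalDegree m f → U.HasDegree k (θ f) m
    hasTotalDegree⇒ {m} f ((e , ≡.refl , fₑ≉0) , f<) =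
      (λ p → fₑ≉0 (F.trans (F.sym (coefᵥ-θ-≡ f e)) (F.trans (coefᵥ-cong k p e) (coefᵥ-0 k e))))
      , λ n m<n → coefᵥ-injective k (λ d → F.trans (vanishes n m<n d) (F.sym (coefᵥ-0 k d)))
      where
      vanishes : ∀ n → m < n → ∀ d → coefᵥ k (U.coef k (θ f) n) d F.≈ F.0#
      vanishes n m<n d with Vec.sum d ℕ.≟ n
      ... | yes ≡.refl = F.trans (coefᵥ-θ-≡ f d) (f< d m<n)
      ... | no d≢n     = coefᵥ-θ-≢ f d d≢n

    hasTotalDegree⇐ : ∀ {m} f → U.HasDegree k (θ f) m → HasTotalDegree m f
    hasTotalDegree⇐ {m} f (θfₘ≉0 , θf<) with nonzero-coefᵥ k θfₘ≉0
    ... | e , p with Vec.sum e ℕ.≟ m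
    ... | no e≢m     = contradiction (coefᵥ-θ-≢ f e e≢m) p
    ... | yes ≡.refl = (e , ≡.refl , λ fₑ≈0 → p (F.trans (coefᵥ-θ-≡ f e) fₑ≈0)) , λ d m<d →
      F.trans (F.sym (coefᵥ-θ-≡ f d)) (F.trans (coefᵥ-cong k (θf< (Vec.sum d) m<d) d) (coefᵥ-0 k d))

    hasTotalDegree-unique : ∀ {m n f} → HasTotalDegree m f → HasTotalDegree n f → m ≡ n
    hasTotalDegree-unique {m} {n} ((d , ≡.refl , f_d≉0) , f<m) ((e , ≡.refl , fₑ≉0) , f<n) with ℕ.<-cmp m n
    ... | tri< m<n _ _ = contradiction (f<m e m<n) fₑ≉0
    ... | tri≈ _ m≡n _ = m≡n
    ... | tri> _ _ n<m = contradiction (f<n d n<m) f_d≉0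

    hasTotalDegree-resp : ∀ {m f g} → f ≈ g → HasTotalDegree m f → HasTotalDegree m g
    hasTotalDegree-resp f≈g ((e , e≡m , fₑ≉0) , f<) =
      (e , e≡m , λ gₑ≈0 → fₑ≉0 (F.trans (f≈g e) gₑ≈0)) , λ d m<d → F.trans (F.sym (f≈g d)) (f< d m<d)

    hasTotalDegree⇒≉0 : ∀ {m f} → HasTotalDegree m f → ¬ f ≈ []
    hasTotalDegree⇒≉0 ((e , _ , fₑ≉0) , _) f≈0 = fₑ≉0 (f≈0 e)

    hasTotalDegree-· : ∀ {m n} f g → HasTotalDegree m f → HasTotalDegree n g → HasTotalDegree (m ℕ.+ n) (f · g)
    hasTotalDegree-· {m} {n} f g f-deg g-deg with
      U.hasDegree-⊠ k (θ f) (θ g) (hasTotalDegree⇒ f f-deg) (hasTotalDegree⇒ g g-deg)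
    ... | top , below = hasTotalDegree⇐ (f · g)
      ( (λ p → top (R.trans (U.at {k} (S.sym (Ew.evaluate-* f g)) (m ℕ.+ n)) p))
      , λ i p → R.trans (U.at {k} (Ew.evaluate-* f g) i) (below i p))

    totalDegree? : ∀ f → f ≈ [] ⊎ (∃[ m ] HasTotalDegree m f)
    totalDegree? f with U.degree? k (θ f)
    ... | inj₂ (m , p) = inj₂ (m , hasTotalDegree⇐ f p)
    ... | inj₁ θf≈0 = inj₁ λ e → F.trans (F.sym (coefᵥ-θ-≡ f e))
      (F.trans (coefᵥ-cong k (U.at {k} θf≈0 (Vec.sum e)) e) (coefᵥ-0 k e))

    ·-zeroʳ : ∀ f → f · [] ≈ []
    ·-zeroʳ f = φ-injective {f · []} {[]} (R.trans (φ-· f []) (R.zeroʳ _))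

    -- Since h is nonzero, so are both factors. Each of them therefore has a degree, and the degrees
    -- add up to that of h.
    hasTotalDegree-factor : ∀ {m} f g {h} → f · g ≈ h → HasTotalDegree m h →
      ∃[ i ] ∃[ j ] (HasTotalDegree i f × HasTotalDegree j g × i ℕ.+ j ≡ m)
    hasTotalDegree-factor {m} f g {h} fg≈h h-deg with totalDegree? f | totalDegree? g
    ... | inj₂ (i , f-deg) | inj₂ (j , g-deg) = i , j , f-deg , g-deg ,
      hasTotalDegree-unique {f = h} (hasTotalDegree-resp {f = f · g} {h} fg≈h (hasTotalDegree-· f g f-deg g-deg)) h-deg
    ... | inj₁ f≈0 | _ = contradiction
      (≈-trans {h} {f · g} {[]} (≈-sym {f · g} {h} fg≈h) (·-cong {f} {[]} {g} {g} f≈0 (≈-refl {g})))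
      (hasTotalDegree⇒≉0 {f = h} h-deg)
    ... | inj₂ _ | inj₁ g≈0 = contradiction
      (≈-trans {h} {f · g} {[]} (≈-sym {f · g} {h} fg≈h)
        (≈-trans {f · g} {f · []} {[]} (·-cong {f} {f} {g} {[]} (≈-refl {f}) g≈0) (·-zeroʳ f)))
      (hasTotalDegree⇒≉0 {f = h} h-deg)

    constant : F.Carrier → Poly
    constant u = (u , replicate k 0) ∷ []

    coeff-constant-· : ∀ u g e → coeff (constant u · g) e F.≈ u F.* coeff g e
    coeff-constant-· u [] e = F.sym (F.zeroʳ u)
    coeff-constant-· u ((b , d) ∷ g) e = F.trans
      (F.+-cong (F.trans (F.reflexive (≡.cong (λ d → if does (≡-dec ℕ._≟_ d e) then u F.* b else F.0#)
                                              (zipWith-identityˡ ℕ.+-identityˡ d)))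
                         (pull (does (≡-dec ℕ._≟_ d e))))
                (coeff-constant-· u g e)) (F.sym (F.distribˡ _ _ _))
      where
      pull : ∀ (β : Bool) → (if β then u F.* b else F.0#) F.≈ u F.* (if β then b else F.0#)
      pull true  = F.refl
      pull false = F.sym (F.zeroʳ u)

    constant-cong : ∀ {u v} → u F.≈ v → constant u ≈ constant v
    constant-cong u≈v e with does (≡-dec ℕ._≟_ (replicate k 0) e)
    ... | true  = F.+-congʳ u≈v
    ... | false = F.refl

    constant-* : ∀ u v → constant u · constant v ≈ constant (u F.* v)
    constant-* u v e = F.trans (coeff-constant-· u (constant v) e) pull
      where
      pull : u F.* coeff (constant v) e F.≈ coeff (constant (u F.* v)) e
      pull with does (≡-dec ℕ._≟_ (replicate k 0) e)
      ... | true  = F.trans (F.*-congˡ (F.+-identityʳ v)) (F.sym (F.+-identityʳ _))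
      ... | false = F.trans (F.*-congˡ (F.+-identityʳ F.0#)) (F.trans (F.zeroʳ u) (F.sym (F.+-identityʳ F.0#)))

    constant-unit : ∀ {u v} → v F.* u F.≈ F.1# → constant u ∣ 𝟙
    constant-unit {u} {v} vu≈1 = constant v ,
      ≈-trans {constant v · constant u} {constant (v F.* u)} {𝟙} (constant-* v u) (constant-cong vu≈1)

    hasTotalDegree-𝟙 : HasTotalDegree 0 𝟙
    hasTotalDegree-𝟙 = (replicate k 0 , sum-replicate-0 k , one) , zeros
      where
      one : ¬ coeff 𝟙 (replicate k 0) F.≈ F.0#
      one p with ≡-dec ℕ._≟_ (replicate k 0) (replicate k 0)
      ... | yes _ = 𝔽.1≉0 (F.trans (F.sym (F.+-identityʳ F.1#)) p)
      ... | no ¬p = ¬p ≡.refl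
      zeros : ∀ e → 0 < Vec.sum e → coeff 𝟙 e F.≈ F.0#
      zeros e 0<e with ≡-dec ℕ._≟_ (replicate k 0) e
      ... | yes ≡.refl = contradiction (sum-replicate-0 k) (ℕ.>⇒≢ 0<e)
      ... | no _       = F.+-identityʳ F.0#

    hasTotalDegree-0 : ∀ {f} → HasTotalDegree 0 f → ∃[ u ] (¬ u F.≈ F.0# × f ≈ constant u)
    hasTotalDegree-0 {f} ((e , e≡0 , fₑ≉0) , f<) = coeff f e , fₑ≉0 , agree
      where
      agree : ∀ d → coeff f d F.≈ coeff (constant (coeff f e)) d
      agree d with ≡-dec ℕ._≟_ (replicate k 0) d
      ... | yes p = F.trans (F.reflexive (≡.cong (coeff f) (≡.trans (≡.sym p) (sum≡0⇒replicate-0 e e≡0))))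
                      (F.sym (F.+-identityʳ _))
      ... | no d≢0 = F.trans (f< d (ℕ.n≢0⇒n>0 λ p → d≢0 (sum≡0⇒replicate-0 d p))) (F.sym (F.+-identityʳ _))

    hasTotalDegree-0⇒unit : ∀ {f} → HasTotalDegree 0 f → f ∣ 𝟙
    hasTotalDegree-0⇒unit {f} f-deg with hasTotalDegree-0 {f} f-deg
    ... | u , u≉0 , f≈u with inverse u≉0
    ... | v , vu≈1 = Div.∣ʳ-respˡ-≈ {𝟙} {constant u} {f} (≈-sym {f} {constant u} f≈u) (constant-unit vu≈1)

    unit⇒hasTotalDegree-0 : ∀ {f} → f ∣ 𝟙 → HasTotalDegree 0 f
    unit⇒hasTotalDegree-0 {f} (g , gf≈1) with hasTotalDegree-factor g f {𝟙} gf≈1 hasTotalDegree-𝟙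
    ... | i , j , _ , f-deg , i+j≡0 = ≡.subst (λ j → HasTotalDegree j f) (ℕ.m+n≡0⇒n≡0 i i+j≡0) f-deg

    open import Algebra.Definitions F._≈_ using (Invertible)

    invertible⇒≉0 : ∀ {u} → Invertible F.1# F._*_ u → ¬ u F.≈ F.0#
    invertible⇒≉0 (v , vu≈1 , _) u≈0 =
      𝔽.1≉0 (F.trans (F.sym vu≈1) (F.trans (F.*-congˡ u≈0) (F.zeroʳ v)))

    ≉0⇒invertible : ∀ {u} → ¬ u F.≈ F.0# → Invertible F.1# F._*_ u
    ≉0⇒invertible u≉0 with inverse u≉0
    ... | v , vu≈1 = v , vu≈1 , F.trans (F.*-comm _ v) vu≈1

    ∼⇒≈constant· : ∀ {f g} → ((u , _) : f ∼ g) → f ≈ constant u · g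
    ∼⇒≈constant· {f} {g} (u , _ , p) e = F.trans (p e) (F.sym (coeff-constant-· u g e))

    ≈constant·⇒∼ : ∀ {f g u} → ¬ u F.≈ F.0# → f ≈ constant u · g → f ∼ g
    ≈constant·⇒∼ {f} {g} {u} u≉0 p =
      u , ≉0⇒invertible u≉0 , λ e → F.trans (p e) (coeff-constant-· u g e)

    open Setoid ∼-setoid public using () renaming (refl to ∼-refl; sym to ∼-sym; trans to ∼-trans)

    ≈⇒∼ : ∀ {f g} → f ≈ g → f ∼ g
    ≈⇒∼ p = F.1# , (F.1# , F.*-identityˡ _ , F.*-identityˡ _) , λ e → F.trans (p e) (F.sym (F.*-identityˡ _))

    ·-congˡ-∼ : ∀ f {g h} → g ∼ h → f · g ∼ f · h
    ·-congˡ-∼ f {g} {h} g∼h@(u , inv , _) = ≈constant·⇒∼ {f · g} {f · h} (invertible⇒≉0 inv) (begin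
      f · g                  ≈⟨ ·-cong {f} {f} {g} {constant u · h} (≈-refl {f}) (∼⇒≈constant· {g} {h} g∼h) ⟩
      f · (constant u · h)   ≈⟨ CommutativeSemigroupProperties.x∙yz≈y∙xz M.commutativeSemigroup f (constant u) h ⟩
      constant u · (f · h)   ∎)
      where open SetoidReasoning ≈-setoid

    ·-cong-∼ : ∀ {f f′ g g′} → f ∼ f′ → g ∼ g′ → f · g ∼ f′ · g′
    ·-cong-∼ {f} {f′} {g} {g′} f∼f′ g∼g′ = ∼-trans {f · g} {f · g′} {f′ · g′} (·-congˡ-∼ f {g} {g′} g∼g′)
      (∼-trans {f · g′} {g′ · f} {f′ · g′} (≈⇒∼ {f · g′} {g′ · f} (·-comm f g′))
        (∼-trans {g′ · f} {g′ · f′} {f′ · g′} (·-congˡ-∼ g′ {f} {f′} f∼f′) (≈⇒∼ {g′ · f′} {f′ · g′} (·-comm g′ f′))))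

    ·-cancelˡ-∼ : ∀ f {g h} → ¬ f ≈ [] → f · g ∼ f · h → g ∼ h
    ·-cancelˡ-∼ f {g} {h} f≉0 fg∼fh@(u , inv , _) = ≈constant·⇒∼ {g} {h} (invertible⇒≉0 inv)
      (·-cancelˡ f {g} {constant u · h} f≉0 (begin
        f · g                  ≈⟨ ∼⇒≈constant· {f · g} {f · h} fg∼fh ⟩
        constant u · (f · h)   ≈⟨ CommutativeSemigroupProperties.x∙yz≈y∙xz M.commutativeSemigroup (constant u) f h ⟩
        f · (constant u · h)   ∎))
      where open SetoidReasoning ≈-setoid

    ∼⇒∣ : ∀ {f g} → f ∼ g → g ∣ f
    ∼⇒∣ {f} {g} f∼g = constant (proj₁ f∼g) ,
      ≈-sym {f} {constant (proj₁ f∼g) · g} (∼⇒≈constant· {f} {g} f∼g)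

    hasTotalDegree-resp-∼ : ∀ {m f g} → f ∼ g → HasTotalDegree m f → HasTotalDegree m g
    hasTotalDegree-resp-∼ {m} {f} {g} (u , inv , p) ((e , e≡m , fₑ≉0) , f<) =
      (e , e≡m , λ gₑ≈0 → fₑ≉0 (F.trans (p e) (F.trans (F.*-congˡ gₑ≈0) (F.zeroʳ u))))
      , λ d m<d → cancel (F.trans (F.sym (p d)) (f< d m<d))
      where
      cancel : ∀ {x} → u F.* x F.≈ F.0# → x F.≈ F.0#
      cancel ux≈0 with 𝔽.x*y≈0⇒x≈0⊎y≈0 ux≈0
      ... | inj₁ u≈0 = contradiction u≈0 (invertible⇒≉0 inv)
      ... | inj₂ x≈0 = x≈0

    -- In p′ = qp the factor p is not a unit, so q is one; it has degree 0 and is a nonzero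
    -- constant.
    irreducible∣irreducible⇒∼ : ∀ {p p′} → Irreducible p → Irreducible p′ → p ∣ p′ → p′ ∼ p
    irreducible∣irreducible⇒∼ {p} {p′} irr irr′ (q , qp≈p′)
      with Irreducible.split-∣1 irr′ {q} {p} (≈-sym {q · p} {p′} qp≈p′)
    ... | inj₂ p∣1 = contradiction p∣1 (Irreducible.p∤1 irr)
    ... | inj₁ q∣1 with hasTotalDegree-0 {q} (unit⇒hasTotalDegree-0 {q} q∣1)
    ... | u , u≉0 , q≈u = ≈constant·⇒∼ {p′} {p} u≉0 (≈-trans {p′} {q · p} {constant u · p}
          (≈-sym {q · p} {p′} qp≈p′) (·-cong {q} {constant u} {p} {p} q≈u (≈-refl {p})))

    irreducible-hasTotalDegree>0 : ∀ {p m} → Irreducible p → HasTotalDegree m p → 0 < m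
    irreducible-hasTotalDegree>0 {p} {zero}  irr p-deg = contradiction (hasTotalDegree-0⇒unit {p} p-deg) (Irreducible.p∤1 irr)
    irreducible-hasTotalDegree>0 {p} {suc m} irr p-deg = ℕ.z<s

-- Counting by relations, and the sieve for a graded action of primes

module Sieves where
  open import Defs
  open FiniteFields
  import Algebra.Properties.CommutativeMonoid.Sum as Sum
  open import Data.Bool.Base using (if_then_else_)
  open import Data.Fin.Base using (Fin; zero; suc)
  import Data.Fin.Properties as Fin
  open import Data.Integer.Base as ℤ using (ℤ; +_)
  import Data.Integer.Properties as ℤ
  open import Data.List.Base using (List; []; _∷_; foldr)
  open import Data.List.Relation.Unary.All as All using (All; []; _∷_)
  open import Data.List.Relation.Unary.AllPairs using (AllPairs; []; _∷_)
  open import Data.Nat.Base as ℕ using (ℕ; zero; suc; _+_)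
  import Data.Nat.Properties as ℕ
  open import Data.Product.Base using (_×_; _,_; Σ-syntax; ∃-syntax; proj₁; proj₂)
  open import Level as Level using (_⊔_)
  open import Data.Unit.Base using (tt)
  open import Function.Base using (_∘_)
  open import Relation.Binary.Bundles using (Setoid)
  import Relation.Binary.Construct.On as On
  open import Relation.Binary.PropositionalEquality.Core as ≡ using (_≡_; refl; cong; sym; trans)
  open import Relation.Nullary.Decidable.Core using (Dec; does; yes; no; map′; ¬?; _×-dec_)
  open import Relation.Nullary.Negation.Core using (¬_; contradiction)
  open import Relation.Unary using (Decidable)

  open Sum ℕ.+-0-commutativeMonoid using (sum; sum-cong-≗; ∑-comm; ∑-distrib-+)

  indicator : ∀ {a} {A : Set a} → Dec A → ℕ
  indicator a? = if does a? then 1 else 0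

  count : ∀ {n p} {P : Fin n → Set p} → Decidable P → ℕ
  count P? = sum (λ i → indicator (P? i))

  indicator-yes : ∀ {a} {A : Set a} (a? : Dec A) → A → indicator a? ≡ 1
  indicator-yes (yes _) a = refl
  indicator-yes (no ¬a) a = contradiction a ¬a

  indicator-no : ∀ {a} {A : Set a} (a? : Dec A) → ¬ A → indicator a? ≡ 0
  indicator-no (yes a) ¬a = contradiction a ¬a
  indicator-no (no _)  ¬a = refl

  indicator-split : ∀ {a b c} {A : Set a} {B : Set b} {C : Set c} (c? : Dec C) (a? : Dec A) (b? : Dec B) →
                    (C → A) → (C → ¬ B) → (A → ¬ B → C) →
                    indicator c? + indicator (a? ×-dec b?) ≡ indicator a?
  indicator-split c? (yes a) (yes b) c⇒a c⇒¬b a¬b⇒c = cong (_+ 1) (indicator-no c? (λ c → c⇒¬b c b))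
  indicator-split c? (yes a) (no ¬b) c⇒a c⇒¬b a¬b⇒c = cong (_+ 0) (indicator-yes c? (a¬b⇒c a ¬b))
  indicator-split c? (no ¬a) b?      c⇒a c⇒¬b a¬b⇒c = cong (_+ 0) (indicator-no c? (λ c → ¬a (c⇒a c)))

  count-none : ∀ {n p} {P : Fin n → Set p} (P? : Decidable P) → (∀ i → ¬ P i) → count P? ≡ 0
  count-none {zero}  P? none = refl
  count-none {suc n} P? none = ≡.cong₂ _+_ (indicator-no (P? zero) (none zero)) (count-none (P? ∘ suc) (none ∘ suc))

  count-all : ∀ {n p} {P : Fin n → Set p} (P? : Decidable P) → (∀ i → P i) → count P? ≡ n
  count-all {zero}  P? all = refl
  count-all {suc n} P? all = ≡.cong₂ _+_ (indicator-yes (P? zero) (all zero)) (count-all (P? ∘ suc) (all ∘ suc))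

  count-unique : ∀ {n p} {P : Fin n → Set p} (P? : Decidable P) i → P i →
                 (∀ {j} → P j → j ≡ i) → count P? ≡ 1
  count-unique P? zero    p unique = ≡.cong₂ _+_ (indicator-yes (P? zero) p)
    (count-none (P? ∘ suc) λ j q → contradiction (unique q) λ ())
  count-unique P? (suc i) p unique = ≡.cong₂ _+_
    (indicator-no (P? zero) λ q → contradiction (unique q) λ ())
    (count-unique (P? ∘ suc) i p λ q → Fin.suc-injective (unique q))

  module _ {m n r u} {R : Fin m → Fin n → Set r} (R? : ∀ i j → Dec (R i j))
           {P : Fin m → Set u} (P? : Decidable P)
           (R⇒P : ∀ {i j} → R i j → P i) (P⇒R : ∀ {i} → P i → ∃[ j ] R i j)
           (R-functional : ∀ {i j j′} → R i j → R i j′ → j ≡ j′) where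

    ∑-rows : sum (λ i → sum (λ j → indicator (R? i j))) ≡ count P?
    ∑-rows = sum-cong-≗ row
      where
      row : ∀ i → sum (λ j → indicator (R? i j)) ≡ indicator (P? i)
      row i with P? i
      ... | no ¬p = count-none (R? i) (λ j r → ¬p (R⇒P r))
      ... | yes p with P⇒R p
      ... | j , r = count-unique (R? i) j r (λ r′ → R-functional r′ r)

  -- Double counting. The incidence matrix of R has exactly one 1 in each row satisfying P and in
  -- each column satisfying Q, and zeros in all other rows and columns.
  count-≡ : ∀ {m n r u v} {R : Fin m → Fin n → Set r} (R? : ∀ i j → Dec (R i j))
            {P : Fin m → Set u} (P? : Decidable P) {Q : Fin n → Set v} (Q? : Decidable Q) →
            (∀ {i j} → R i j → P i) → (∀ {i j} → R i j → Q j) →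
            (∀ {i} → P i → ∃[ j ] R i j) → (∀ {j} → Q j → ∃[ i ] R i j) →
            (∀ {i j j′} → R i j → R i j′ → j ≡ j′) → (∀ {i i′ j} → R i j → R i′ j → i ≡ i′) →
            count P? ≡ count Q?
  count-≡ {m} {n} R? P? Q? R⇒P R⇒Q P⇒R Q⇒R functional injective =
    trans (sym (∑-rows R? P? R⇒P P⇒R functional))
      (trans (∑-comm (λ i j → indicator (R? i j)))
        (∑-rows (λ j i → R? i j) Q? R⇒Q Q⇒R injective))

  -- The two enumerations are independent of each other; they are matched by relating i to j when
  -- the i-th element of the subset lies in the j-th class of the whole.
  count-subsetoid : ∀ {a ℓ p} {S : Setoid a ℓ} {P : Setoid.Carrier S → Set p} {m n} →
    (card : HasCardinality S m) → HasCardinality (On.setoid {B = Σ[ x ∈ Setoid.Carrier S ] P x} S proj₁) n →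
    (∀ {x y} → Setoid._≈_ S x y → P x → P y) →
    (P? : Decidable (P ∘ Enumerated.from {S = S} card)) → n ≡ count P?
  count-subsetoid {S = S} {P} {m} {n} card subcard P-resp P? =
    trans (sym (count-all {n} (λ _ → yes tt) (λ _ → tt)))
      (count-≡ (λ i j → X.to (proj₁ (Y.from i)) Fin.≟ j) (λ _ → yes tt) P?
        (λ _ → tt)
        (λ {i} {j} p → P-resp (to≡⇒≈ p) (proj₂ (Y.from i)))
        (λ {i} _ → X.to (proj₁ (Y.from i)) , refl)
        (λ {j} p → Y.to (X.from j , p) , trans (X.cong (Y.from-to _)) (X.to-from j))
        (λ p q → trans (sym p) q)
        (λ {i} {i′} p q → Y.from-injective (X.injective (trans p (sym q)))))
    where
    module S = Setoid S
    module X = Enumerated {S = S} card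
    module Y = Enumerated {S = On.setoid {B = Σ[ x ∈ S.Carrier ] P x} S proj₁} subcard
    to≡⇒≈ : ∀ {x j} → X.to x ≡ j → x S.≈ X.from j
    to≡⇒≈ refl = S.sym (X.from-to _)

  -- Graded objects on which a family of primes acts; the object p ∙ x has lower
  -- grade than x, so the grade measures the distance from a fixed degree.
  record GradedAction a ℓ p b δ : Set (Level.suc (a ⊔ ℓ ⊔ p ⊔ b ⊔ δ)) where
    field
      setoid : Setoid a ℓ
    open Setoid setoid using (Carrier; _≈_) public
    infixr 5 _∙_
    field
      Graded      : ℕ → Carrier → Set p
      Graded-resp : ∀ {d x y} → x ≈ y → Graded d x → Graded d y
    Layer : ℕ → Setoid (a ⊔ p) ℓ
    Layer d = On.setoid {B = Σ[ x ∈ Carrier ] Graded d x} setoid proj₁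
    field
      size        : ℕ → ℕ
      card        : ∀ d → HasCardinality (Layer d) (size d)
      Prime       : Set b
      degree      : Prime → ℕ
      _∙_         : Prime → Carrier → Carrier
      ∙-cong      : ∀ p {x y} → x ≈ y → p ∙ x ≈ p ∙ y
      ∙-injective : ∀ p {x y} → p ∙ x ≈ p ∙ y → x ≈ y
      ∙-comm      : ∀ p p′ x → p ∙ p′ ∙ x ≈ p′ ∙ p ∙ x
      ∙-graded    : ∀ p {d x} → Graded (degree p + d) x → Graded d (p ∙ x)
      ∙-graded⁻¹  : ∀ p {d x} → Graded d (p ∙ x) → Graded (degree p + d) x
      -- Distinctness of primes. Primality enters the sieve through `⊥-divides`: a prime that
      -- divides p ∙ x and is distinct from p divides x.
      _⊥_         : Prime → Prime → Set δ
      ⊥-divides   : ∀ {p p′} → p ⊥ p′ → ∀ {x y} → p ∙ x ≈ p′ ∙ y → ∃[ z ] x ≈ p′ ∙ z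

  module GradedSieve {a ℓ p b δ} (G : GradedAction a ℓ p b δ) where
    open GradedAction G

    private
      module X d = Enumerated {S = Layer d} (card d)
      module S = Setoid setoid

    element : ∀ {d} → Fin (size d) → Carrier
    element {d} i = proj₁ (X.from d i)

    graded : ∀ {d} (i : Fin (size d)) → Graded d (element i)
    graded {d} i = proj₂ (X.from d i)

    index : ∀ {d x} → Graded d x → Fin (size d)
    index {d} {x} g = X.to d (x , g)

    element-index : ∀ {d x} (g : Graded d x) → element (index g) ≈ x
    element-index {d} {x} g = X.from-to d (x , g)

    equal? : ∀ {d x y} → Graded d x → Graded d y → Dec (x ≈ y)
    equal? {d} {x} {y} g h = X.decidable d (x , g) (y , h)

    _divides_ : Prime → Carrier → Set _
    p divides x = ∃[ y ] x ≈ (p ∙ y)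

    -- A quotient by p lies in the layer `degree p + d`, which is finite, so it can be searched for.
    divides? : ∀ p {d} (i : Fin (size d)) → Dec (p divides element i)
    divides? p {d} i = map′ (λ (j , q) → element j , q) witness
      (Fin.any? λ j → equal? (graded i) (∙-graded p (graded {degree p + d} j)))
      where
      witness : p divides element i → ∃[ j ] element i ≈ (p ∙ element j)
      witness (y , q) = index g , S.trans q (∙-cong p (S.sym (element-index g)))
        where g = ∙-graded⁻¹ p (Graded-resp q (graded i))

    Free : List Prime → Carrier → Set _
    Free ps x = All (λ p → ¬ p divides x) ps

    free? : ∀ ps {d} (i : Fin (size d)) → Dec (Free ps (element i))
    free? ps i = All.all? (λ p → ¬? (divides? p i)) ps

    #free : List Prime → ℕ → ℕ
    #free ps d = count (free? ps {d})

    free-resp : ∀ {ps x y} → x ≈ y → Free ps x → Free ps y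
    free-resp x≈y = All.map λ ¬p (z , q) → ¬p (z , S.trans x≈y q)

    free-∙ : ∀ {p ps x} → All (p ⊥_) ps → Free ps x → Free ps (p ∙ x)
    free-∙ []           []        = []
    free-∙ (p⊥p′ ∷ p⊥) (¬d ∷ fr) = (λ (z , q) → ¬d (⊥-divides p⊥p′ q)) ∷ free-∙ p⊥ fr

    free-∙⁻¹ : ∀ {p ps x} → Free ps (p ∙ x) → Free ps x
    free-∙⁻¹ {p} = All.map λ ¬d (z , q) → ¬d (p ∙ z , S.trans (∙-cong p q) (∙-comm p _ z))

    -- The elements free of ps are split by divisibility by p. Division by p maps the divisible ones
    -- bijectively to the elements of layer `degree p + d` that are free of ps: as p is distinct
    -- from the members of ps, they divide p ∙ x exactly when they divide x.
    #free-∷ : ∀ {p ps} → All (p ⊥_) ps → ∀ d → #free (p ∷ ps) d + #free ps (degree p + d) ≡ #free ps d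
    #free-∷ {p} {ps} p⊥ d = trans (cong (λ m → #free (p ∷ ps) d + m) (sym multiples))
      (trans (sym (∑-distrib-+ (λ i → indicator (free? (p ∷ ps) i)) (λ i → indicator (multiple? i))))
        (sum-cong-≗ split))
      where
      multiple? : (i : Fin (size d)) → Dec (Free ps (element i) × p divides element i)
      multiple? i = free? ps i ×-dec divides? p i
      R? : (i : Fin (size d)) (j : Fin (size (degree p + d))) → Dec (Free ps (element i) × element i ≈ (p ∙ element j))
      R? i j = free? ps i ×-dec equal? (graded i) (∙-graded p (graded j))
      multiples : count multiple? ≡ #free ps (degree p + d)
      multiples = count-≡ R? multiple? (free? ps)
        (λ {i} {j} (f , q) → f , element j , q)
        (λ (f , q) → free-∙⁻¹ (free-resp q f))
        (λ {i} (f , y , q) → let g = ∙-graded⁻¹ p (Graded-resp q (graded i))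
                             in index g , f , S.trans q (∙-cong p (S.sym (element-index g))))
        (λ {j} f → let g = ∙-graded p (graded j)
                   in index g , free-resp (S.sym (element-index g)) (free-∙ p⊥ f) , element-index g)
        (λ (_ , q) (_ , r) → X.from-injective (degree p + d) (∙-injective p (S.trans (S.sym q) r)))
        (λ (_ , q) (_ , r) → X.from-injective d (S.trans q (S.sym r)))
      split : ∀ i → indicator (free? (p ∷ ps) i) + indicator (multiple? i) ≡ indicator (free? ps i)
      split i = indicator-split (free? (p ∷ ps) i) (free? ps i) (divides? p i)
        (λ { (_ ∷ f) → f }) (λ { (¬d ∷ _) → ¬d }) (λ f ¬d → ¬d ∷ f)

    sieve : List Prime → (ℕ → ℤ) → ℕ → ℤ
    sieve ps f = foldr (λ p g d → g d ℤ.- g (degree p + d)) f ps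

    #free≡sieve : ∀ {ps} → AllPairs _⊥_ ps → ∀ d → + #free ps d ≡ sieve ps (λ d → + size d) d
    #free≡sieve []          d = cong +_ (count-all (free? []) (λ _ → []))
    #free≡sieve {p ∷ ps} (p⊥ ∷ ⊥s) d = begin
      + #free (p ∷ ps) d                                        ≡⟨ ℤ.+-identityʳ _ ⟨
      + #free (p ∷ ps) d ℤ.+ ℤ.0ℤ                               ≡⟨ cong (λ m → + #free (p ∷ ps) d ℤ.+ m) (ℤ.+-inverseʳ (+ m)) ⟨
      + #free (p ∷ ps) d ℤ.+ (+ m ℤ.- + m)                      ≡⟨ ℤ.+-assoc (+ #free (p ∷ ps) d) (+ m) (ℤ.- + m) ⟨
      (+ #free (p ∷ ps) d ℤ.+ + m) ℤ.- + m                      ≡⟨ cong (λ n → n ℤ.- + m) (ℤ.pos-+ (#free (p ∷ ps) d) m) ⟨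
      + (#free (p ∷ ps) d + m) ℤ.- + m                          ≡⟨ cong (λ n → + n ℤ.- + m) (#free-∷ p⊥ d) ⟩
      + #free ps d ℤ.- + m                                      ≡⟨ ≡.cong₂ ℤ._-_ (#free≡sieve ⊥s d) (#free≡sieve ⊥s (degree p + d)) ⟩
      sieve (p ∷ ps) (λ d → + size d) d                         ∎
      where
      open import Relation.Binary.PropositionalEquality.Properties using (module ≡-Reasoning)
      open ≡-Reasoning
      m = #free ps (degree p + d)

-- Difference operators and the coefficients A(d)

module InclusionExclusion where
  open import Defs
  open import Data.Integer.Base as ℤ using (ℤ; +_; 0ℤ; 1ℤ; -1ℤ; _+_; _*_; _-_; -_)
  import Data.Integer.Properties as ℤ
  open import Data.Integer.Tactic.RingSolver using (solve-∀)
  open import Data.Fin.Base using (toℕ)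
  open import Data.List.Base using (List; []; _∷_; _++_; map; filter; foldr; replicate; upTo; applyUpTo; cartesianProductWith)
  open import Data.List.Properties using (++-assoc; map-++; map-∘; filter-accept; filter-reject; map-applyUpTo)
  open import Data.List.Relation.Unary.All using (All; []; _∷_)
  import Data.List.Relation.Unary.All.Properties as All
  open import Data.Nat.Base as ℕ using (ℕ; zero; suc; _≤_; _<_; s≤s; z<s)
  open import Data.Nat.Combinatorics using (_C_; nCk≡nC[n∸k]; nCn≡1; nCk+nC[k+1]≡[n+1]C[k+1]; k>n⇒nCk≡0)
  import Data.Nat.Properties as ℕ
  import Data.Nat.Tactic.RingSolver as ℕ-Ring
  open import Data.Sum.Base using (inj₁; inj₂)
  open import Data.Vec.Base as Vec using (Vec; []; _∷_; lookup; tabulate)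
  open import Function.Base using (_∘_; id)
  open import Relation.Binary.PropositionalEquality using (_≡_; _≢_; refl; sym; trans; cong; cong₂; module ≡-Reasoning)
  open import Relation.Nullary.Decidable.Core using (Dec; yes; no)
  open import Relation.Nullary.Negation.Core using (contradiction)
  open ≡-Reasoning

  nC0≡1 : ∀ n → n C 0 ≡ 1
  nC0≡1 n = trans (sym (trans (nCk≡nC[n∸k] {n} ℕ.≤-refl) (cong (n C_) (ℕ.n∸n≡0 n)))) (nCn≡1 n)

  ∑ : ℕ → (ℕ → ℤ) → ℤ
  ∑ zero    f = 0ℤ
  ∑ (suc n) f = f 0 + ∑ n (f ∘ suc)

  sumℤ-upTo : ∀ f n → sumℤ (map f (upTo n)) ≡ ∑ n f
  sumℤ-upTo f n = trans (cong sumℤ (map-applyUpTo id f n)) (go f n)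
    where
    go : ∀ f n → sumℤ (applyUpTo f n) ≡ ∑ n f
    go f zero    = refl
    go f (suc n) = cong₂ _+_ {f 0} refl (go (f ∘ suc) n)

  ∑-cong : ∀ n {f g} → (∀ i → i < n → f i ≡ g i) → ∑ n f ≡ ∑ n g
  ∑-cong zero    p = refl
  ∑-cong (suc n) p = cong₂ _+_ (p 0 z<s) (∑-cong n (λ i i<n → p (suc i) (s≤s i<n)))

  ∑-last : ∀ n f → ∑ (suc n) f ≡ ∑ n f + f n
  ∑-last zero    f = ℤ.+-comm (f 0) 0ℤ
  ∑-last (suc n) f = trans (cong₂ _+_ {f 0} refl (∑-last n (f ∘ suc))) (sym (ℤ.+-assoc (f 0) _ _))

  ∑-0 : ∀ n {f} → (∀ i → i < n → f i ≡ 0ℤ) → ∑ n f ≡ 0ℤ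
  ∑-0 zero    p = refl
  ∑-0 (suc n) p = cong₂ _+_ (p 0 z<s) (∑-0 n (λ i i<n → p (suc i) (s≤s i<n)))

  ∑-- : ∀ n f g → ∑ n (λ i → f i - g i) ≡ ∑ n f - ∑ n g
  ∑-- zero    f g = refl
  ∑-- (suc n) f g = trans (cong₂ _+_ {f 0 - g 0} refl (∑-- n (f ∘ suc) (g ∘ suc))) (rearrange (f 0) (g 0) _ _)
    where
    rearrange : ∀ a b c d → (a - b) + (c - d) ≡ (a + c) - (b + d)
    rearrange = solve-∀

  ∑-split : ∀ m n f → ∑ (m ℕ.+ n) f ≡ ∑ m f + ∑ n (λ i → f (m ℕ.+ i))
  ∑-split zero    n f = sym (ℤ.+-identityˡ _)
  ∑-split (suc m) n f = trans (cong₂ _+_ {f 0} refl (∑-split m n (f ∘ suc))) (sym (ℤ.+-assoc (f 0) _ _))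

  -- The product over e in es of the operators 1 - Eᵉ, where E is the shift (Ef)(d) = f(d + 1).
  differences : List ℕ → (ℕ → ℤ) → ℕ → ℤ
  differences es f = foldr (λ e g d → g d - g (e ℕ.+ d)) f es

  differences-++ : ∀ es es′ f d → differences (es ++ es′) f d ≡ differences es (differences es′ f) d
  differences-++ []       es′ f d = refl
  differences-++ (e ∷ es) es′ f d = cong₂ _-_ (differences-++ es es′ f d) (differences-++ es es′ f (e ℕ.+ d))

  differences-cong : ∀ es {f g} → (∀ d → f d ≡ g d) → ∀ d → differences es f d ≡ differences es g d
  differences-cong []       p d = p d
  differences-cong (e ∷ es) p d = cong₂ _-_ (differences-cong es p d) (differences-cong es p (e ℕ.+ d))

  VanishesAbove : ℕ → (ℕ → ℤ) → Set
  VanishesAbove b f = ∀ n → b < n → f n ≡ 0ℤ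

  differences-vanishes : ∀ es {b f} → VanishesAbove b f → VanishesAbove b (differences es f)
  differences-vanishes []       p n b<n = p n b<n
  differences-vanishes (e ∷ es) p n b<n = cong₂ _-_ (differences-vanishes es p n b<n)
    (differences-vanishes es p (e ℕ.+ n) (ℕ.≤-trans b<n (ℕ.m≤n+m n e)))

  -- A shift by more than b moves the whole support away, so each factor 1 - Eᵉ acts as the
  -- identity.
  differences-large : ∀ {es b f} → VanishesAbove b f → All (b <_) es → ∀ d → differences es f d ≡ f d
  differences-large p []             d = refl
  differences-large {e ∷ es} {b} p (b<e ∷ b<es) d = trans
    (cong₂ _-_ (differences-large p b<es d)
      (differences-vanishes es p (e ℕ.+ d) (ℕ.≤-trans b<e (ℕ.m≤m+n e d))))
    (ℤ.+-identityʳ _)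

  δ : ℕ → ℕ → ℤ
  δ m n with m ℕ.≟ n
  ... | yes _ = 1ℤ
  ... | no  _ = 0ℤ

  δ-refl : ∀ n → δ n n ≡ 1ℤ
  δ-refl n with n ℕ.≟ n
  ... | yes _  = refl
  ... | no n≢n = contradiction refl n≢n

  δ-≢ : ∀ {m n} → m ≢ n → δ m n ≡ 0ℤ
  δ-≢ {m} {n} m≢n with m ℕ.≟ n
  ... | yes m≡n = contradiction m≡n m≢n
  ... | no  _   = refl

  δ-suc : ∀ m n → δ (suc m) (suc n) ≡ δ m n
  δ-suc m n with m ℕ.≟ n | suc m ℕ.≟ suc n
  ... | yes _    | yes _  = refl
  ... | no _     | no _   = refl
  ... | yes refl | no p   = contradiction refl p
  ... | no p     | yes q  = contradiction (ℕ.suc-injective q) p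

  δ-vanishes : ∀ n → VanishesAbove n (δ n)
  δ-vanishes n m n<m = δ-≢ (ℕ.<⇒≢ n<m)

  ∑-δ : ∀ n (f : ℕ → ℤ) d → d < n → ∑ n (λ i → f i * δ i d) ≡ f d
  ∑-δ (suc n) f zero    d<n = trans (cong₂ _+_ (ℤ.*-identityʳ (f 0)) (∑-0 n (λ i _ → ℤ.*-zeroʳ (f (suc i))))) (ℤ.+-identityʳ _)
  ∑-δ (suc n) f (suc d) (s≤s d<n) = trans (cong₂ _+_ (ℤ.*-zeroʳ (f 0))
    (trans (∑-cong n (λ i _ → cong (f (suc i) *_) (δ-suc i d))) (∑-δ n (f ∘ suc) d d<n))) (ℤ.+-identityˡ _)

  -- By linearity, as f is the sum of the f(n)·δₙ. At d = 0 the value `differences es (δ n) 0` is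
  -- the coefficient of xⁿ in the product of the polynomials 1 - xᵉ.
  differences-δ : ∀ es {M f} → VanishesAbove M f → ∀ d →
                  differences es f d ≡ ∑ (suc M) (λ n → f n * differences es (δ n) d)
  differences-δ [] {M} {f} p d with ℕ.≤-<-connex d M
  ... | inj₁ d≤M = sym (∑-δ (suc M) f d (s≤s d≤M))
  ... | inj₂ M<d = trans (p d M<d) (sym (∑-0 (suc M) λ i i<M →
          trans (cong (f i *_) (δ-vanishes i d (ℕ.≤-<-trans (ℕ.s≤s⁻¹ i<M) M<d))) (ℤ.*-zeroʳ (f i))))
  differences-δ (e ∷ es) {M} {f} p d = trans
    (cong₂ _-_ (differences-δ es p d) (differences-δ es p (e ℕ.+ d)))
    (trans (sym (∑-- (suc M) (λ n → f n * differences es (δ n) d) (λ n → f n * differences es (δ n) (e ℕ.+ d))))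
           (∑-cong (suc M) (λ i _ → sym (distribute (f i) (differences es (δ i) d) (differences es (δ i) (e ℕ.+ d))))))
    where
    distribute : ∀ a b c → a * (b - c) ≡ a * b - a * c
    distribute = solve-∀

  -- The binomial theorem for the k-th power of 1 - Eᵉ. The sum may stop at a = b for every k: since
  -- e is positive, a larger a evaluates g beyond b, where it vanishes. The induction on k is
  -- Pascal's rule.
  differences-replicate : ∀ k e {b g} → 0 < e → VanishesAbove b g → ∀ d →
    differences (replicate k e) g d ≡ ∑ (suc b) (λ a → (-1ℤ ℤ.^ a * + (k C a)) * g (e ℕ.* a ℕ.+ d))
  differences-replicate zero e {b} {g} 0<e p d = sym (trans
    (cong₂ _+_ (trans (ℤ.*-identityˡ _) (cong (λ x → g (x ℕ.+ d)) (ℕ.*-zeroʳ e)))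
      (∑-0 b λ i _ → trans (cong (λ x → (-1ℤ ℤ.^ suc i * + x) * g (e ℕ.* suc i ℕ.+ d)) (k>n⇒nCk≡0 {0} {suc i} z<s))
        (trans (cong (_* g (e ℕ.* suc i ℕ.+ d)) (ℤ.*-zeroʳ (-1ℤ ℤ.^ suc i))) refl)))
    (ℤ.+-identityʳ (g d)))
  differences-replicate (suc k) e {b} {g} 0<e p d = begin
    differences (replicate k e) g d - differences (replicate k e) g (e ℕ.+ d)
      ≡⟨ cong₂ _-_ (differences-replicate k e 0<e p d) (differences-replicate k e 0<e p (e ℕ.+ d)) ⟩
    (X 0 + ∑ b (X ∘ suc)) - ∑ (suc b) Y
      ≡⟨ cong₂ _-_ {X 0 + ∑ b (X ∘ suc)} refl (trans (∑-last b Y) (trans (cong₂ _+_ {∑ b Y} refl Yb≡0) (ℤ.+-identityʳ _))) ⟩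
    (X 0 + ∑ b (X ∘ suc)) - ∑ b Y
      ≡⟨ ℤ.+-assoc (X 0) (∑ b (X ∘ suc)) (- ∑ b Y) ⟩
    X 0 + (∑ b (X ∘ suc) - ∑ b Y)
      ≡⟨ cong₂ _+_ {X 0} refl (sym (∑-- b (X ∘ suc) Y)) ⟩
    X 0 + ∑ b (λ a → X (suc a) - Y a)
      ≡⟨ cong₂ _+_ (cong (λ c → (1ℤ * + c) * g (e ℕ.* 0 ℕ.+ d)) (trans (nC0≡1 k) (sym (nC0≡1 (suc k))))) (∑-cong b (λ a _ → pascal a)) ⟩
    ∑ (suc b) Z
      ∎
    where
    X Y Z : ℕ → ℤ
    X a = (-1ℤ ℤ.^ a * + (k C a)) * g (e ℕ.* a ℕ.+ d)
    Y a = (-1ℤ ℤ.^ a * + (k C a)) * g (e ℕ.* a ℕ.+ (e ℕ.+ d))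
    Z a = (-1ℤ ℤ.^ a * + (suc k C a)) * g (e ℕ.* a ℕ.+ d)
    ℕ-shift : ∀ e a d → e ℕ.* a ℕ.+ (e ℕ.+ d) ≡ e ℕ.* suc a ℕ.+ d
    ℕ-shift = ℕ-Ring.solve-∀
    b<e : b < e ℕ.* b ℕ.+ (e ℕ.+ d)
    b<e = ℕ.≤-trans (ℕ.≤-trans (ℕ.≤-reflexive (ℕ.+-comm 1 b))
      (ℕ.+-mono-≤ (ℕ.m≤n*m b e ⦃ ℕ.>-nonZero 0<e ⦄) 0<e)) (ℕ.+-monoʳ-≤ (e ℕ.* b) (ℕ.m≤m+n e d))
    -- The last summand of the shifted sum has its argument beyond b. Without it, `Y a` is paired
    -- with `X (suc a)`, and both have the same argument of g.
    Yb≡0 : Y b ≡ 0ℤ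
    Yb≡0 = trans (cong ((-1ℤ ℤ.^ b * + (k C b)) *_) (p _ b<e)) (ℤ.*-zeroʳ (-1ℤ ℤ.^ b * + (k C b)))
    shift : ∀ a → e ℕ.* a ℕ.+ (e ℕ.+ d) ≡ e ℕ.* suc a ℕ.+ d
    shift a = ℕ-shift e a d
    rearrange : ∀ s x y g → (-1ℤ * s * x) * g - (s * y) * g ≡ (-1ℤ * s * (y + x)) * g
    rearrange = solve-∀
    pascal : ∀ a → X (suc a) - Y a ≡ Z (suc a)
    pascal a = begin
      X (suc a) - Y a
        ≡⟨ cong (λ n → X (suc a) - (-1ℤ ℤ.^ a * + (k C a)) * g n) (shift a) ⟩
      X (suc a) - (-1ℤ ℤ.^ a * + (k C a)) * g (e ℕ.* suc a ℕ.+ d)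
        ≡⟨ rearrange (-1ℤ ℤ.^ a) (+ (k C suc a)) (+ (k C a)) _ ⟩
      (-1ℤ ℤ.^ suc a * (+ (k C a) + + (k C suc a))) * g (e ℕ.* suc a ℕ.+ d)
        ≡⟨ cong (λ n → (-1ℤ ℤ.^ suc a * + n) * g (e ℕ.* suc a ℕ.+ d)) (nCk+nC[k+1]≡[n+1]C[k+1] k a) ⟩
      Z (suc a) ∎

  -- The degrees h(0), ..., h(l - 1), each repeated once per irreducible. The general h makes room
  -- for the recursion, which passes to `h ∘ suc`; the sieve takes h = `suc`, that is, the degrees
  -- 1, ..., l.
  degrees : (ℕ → ℕ) → (ℕ → ℕ) → ℕ → List ℕ
  degrees I h zero    = []
  degrees I h (suc l) = replicate (I (h 0)) (h 0) ++ degrees I (h ∘ suc) l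

  -- At h = `suc`, `weightBy` and `termBy` unfold to `weight` and to the summand local to `A`.
  weightBy : (ℕ → ℕ) → ∀ {l} → Vec ℕ l → ℕ
  weightBy h a = Vec.sum (tabulate λ i → h (toℕ i) ℕ.* lookup a i)

  termBy : (ℕ → ℕ) → (ℕ → ℕ) → ∀ {l} → Vec ℕ l → ℤ
  termBy I h a = (-1ℤ ℤ.^ Vec.sum a) * + Vec.foldr _ ℕ._*_ 1 (tabulate λ i → I (h (toℕ i)) C lookup a i)

  sumℤ-++ : ∀ xs ys → sumℤ (xs ++ ys) ≡ sumℤ xs + sumℤ ys
  sumℤ-++ []       ys = sym (ℤ.+-identityˡ _)
  sumℤ-++ (x ∷ xs) ys = trans (cong₂ _+_ {x} refl (sumℤ-++ xs ys)) (sym (ℤ.+-assoc x _ _))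

  sumℤ-*ˡ : ∀ {a} {A : Set a} x (f : A → ℤ) xs → sumℤ (map (λ y → x * f y) xs) ≡ x * sumℤ (map f xs)
  sumℤ-*ˡ x f []       = sym (ℤ.*-zeroʳ x)
  sumℤ-*ˡ x f (y ∷ ys) = trans (cong₂ _+_ {x * f y} refl (sumℤ-*ˡ x f ys)) (sym (ℤ.*-distribˡ-+ x (f y) _))

  sumℤ-cong : ∀ {a} {A : Set a} {f g : A → ℤ} → (∀ x → f x ≡ g x) → ∀ xs → sumℤ (map f xs) ≡ sumℤ (map g xs)
  sumℤ-cong p []       = refl
  sumℤ-cong p (x ∷ xs) = cong₂ _+_ (p x) (sumℤ-cong p xs)

  sumℤ-cartesianProductWith : ∀ {a b c} {A : Set a} {B : Set b} {X : Set c} (f : A → B → X) (g : X → ℤ) xs ys →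
    sumℤ (map g (cartesianProductWith f xs ys)) ≡ sumℤ (map (λ x → sumℤ (map (g ∘ f x) ys)) xs)
  sumℤ-cartesianProductWith f g []       ys = refl
  sumℤ-cartesianProductWith f g (x ∷ xs) ys = trans
    (cong sumℤ (map-++ g (map (f x) ys) (cartesianProductWith f xs ys)))
    (trans (sumℤ-++ (map g (map (f x) ys)) _)
      (cong₂ _+_ (cong sumℤ (sym (map-∘ ys))) (sumℤ-cartesianProductWith f g xs ys)))

  sumℤ-filter : ∀ {a} {A : Set a} (f : A → ℤ) (w : A → ℕ) n xs →
    sumℤ (map f (filter (λ x → w x ℕ.≟ n) xs)) ≡ sumℤ (map (λ x → f x * δ n (w x)) xs)
  sumℤ-filter f w n [] = refl
  sumℤ-filter f w n (x ∷ xs) = step (w x ℕ.≟ n)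
    where
    P? = λ x → w x ℕ.≟ n
    step : Dec (w x ≡ n) → sumℤ (map f (filter P? (x ∷ xs))) ≡ sumℤ (map (λ x → f x * δ n (w x)) (x ∷ xs))
    step (yes refl) = trans (cong (λ ys → sumℤ (map f ys)) (filter-accept P? {x} {xs} refl))
      (cong₂ _+_ (sym (trans (cong (f x *_) (δ-refl (w x))) (ℤ.*-identityʳ (f x)))) (sumℤ-filter f w n xs))
    step (no w≢n) = trans (cong (λ ys → sumℤ (map f ys)) (filter-reject P? {x} {xs} w≢n))
      (trans (sumℤ-filter f w n xs) (trans (sym (ℤ.+-identityˡ _))
        (cong₂ _+_ (sym (trans (cong (f x *_) (δ-≢ (w≢n ∘ sym))) (ℤ.*-zeroʳ (f x)))) refl)))

  -- One application of the binomial theorem for each degree; the entry of the tuple at position i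
  -- is the summation index belonging to h(i).
  differences-tuples : ∀ I h → (∀ i → 0 < h i) → ∀ {b f} → VanishesAbove b f → ∀ l d →
    differences (degrees I h l) f d ≡ sumℤ (map (λ a → termBy I h a * f (weightBy h a ℕ.+ d)) (tuples≤ b l))
  differences-tuples I h h>0 {b} {f} p zero    d = sym (trans (ℤ.+-identityʳ _) (ℤ.*-identityˡ (f d)))
  differences-tuples I h h>0 {b} {f} p (suc l) d = begin
    differences (degrees I h (suc l)) f d
      ≡⟨ differences-++ (replicate k e) (degrees I (h ∘ suc) l) f d ⟩
    differences (replicate k e) g d
      ≡⟨ differences-replicate k e (h>0 0) (differences-vanishes (degrees I (h ∘ suc) l) p) d ⟩
    ∑ (suc b) (λ a → (-1ℤ ℤ.^ a * + (k C a)) * g (e ℕ.* a ℕ.+ d))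
      ≡⟨ ∑-cong (suc b) (λ a _ → inner a) ⟩
    ∑ (suc b) (λ a → sumℤ (map (λ v → T (a ∷ v)) (tuples≤ b l)))
      ≡⟨ sumℤ-upTo (λ a → sumℤ (map (λ v → T (a ∷ v)) (tuples≤ b l))) (suc b) ⟨
    sumℤ (map (λ a → sumℤ (map (λ v → T (a ∷ v)) (tuples≤ b l))) (upTo (suc b)))
      ≡⟨ sumℤ-cartesianProductWith _∷_ T (upTo (suc b)) (tuples≤ b l) ⟨
    sumℤ (map T (tuples≤ b (suc l)))
      ∎
    where
    e = h 0
    k = I e
    g = differences (degrees I (h ∘ suc) l) f
    T : Vec ℕ (suc l) → ℤ
    T a = termBy I h a * f (weightBy h a ℕ.+ d)
    inner : ∀ a → (-1ℤ ℤ.^ a * + (k C a)) * g (e ℕ.* a ℕ.+ d) ≡ sumℤ (map (λ v → T (a ∷ v)) (tuples≤ b l))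
    inner a = trans (cong ((-1ℤ ℤ.^ a * + (k C a)) *_) (differences-tuples I (h ∘ suc) (h>0 ∘ suc) p l (e ℕ.* a ℕ.+ d)))
      (trans (sym (sumℤ-*ˡ (-1ℤ ℤ.^ a * + (k C a)) (λ v → termBy I (h ∘ suc) v * f (weightBy (h ∘ suc) v ℕ.+ (e ℕ.* a ℕ.+ d))) (tuples≤ b l)))
        (sumℤ-cong step (tuples≤ b l)))
      where
      rearrange : ∀ s x s′ y z → (s * x) * ((s′ * y) * z) ≡ ((s * s′) * (x * y)) * z
      rearrange = solve-∀
      ℕ-rearrange : ∀ w m d → w ℕ.+ (m ℕ.+ d) ≡ (m ℕ.+ w) ℕ.+ d
      ℕ-rearrange = ℕ-Ring.solve-∀
      step : ∀ v → (-1ℤ ℤ.^ a * + (k C a)) * (termBy I (h ∘ suc) v * f (weightBy (h ∘ suc) v ℕ.+ (e ℕ.* a ℕ.+ d))) ≡ T (a ∷ v)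
      step v = trans (rearrange (-1ℤ ℤ.^ a) (+ (k C a)) (-1ℤ ℤ.^ Vec.sum v) (+ P) _)
        (cong₂ _*_ (cong₂ _*_ (sym (ℤ.^-distribˡ-+-* -1ℤ a (Vec.sum v))) (sym (ℤ.pos-* (k C a) P)))
                   (cong f (ℕ-rearrange (weightBy (h ∘ suc) v) (e ℕ.* a) d)))
        where P = Vec.foldr _ ℕ._*_ 1 (tabulate λ i → I (h (suc (toℕ i))) C lookup v i)

  -- Applying the operators to `δ n` at 0 keeps exactly the tuples of weight n, which is the filter
  -- in the definition of `A`.
  A≡differences : ∀ I n → A I n ≡ differences (degrees I suc n) (δ n) 0
  A≡differences I n = trans (sumℤ-filter (termBy I suc) weight n (tuples≤ n n))
    (trans (sumℤ-cong (λ a → cong (λ w → termBy I suc a * δ n w) (sym (ℕ.+-identityʳ (weight a)))) (tuples≤ n n))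
      (sym (differences-tuples I suc (λ _ → z<s) (δ-vanishes n) n 0)))

  degrees-+ : ∀ I h m n → degrees I h (m ℕ.+ n) ≡ degrees I h m ++ degrees I (λ i → h (m ℕ.+ i)) n
  degrees-+ I h zero    n = refl
  degrees-+ I h (suc m) n = trans (cong (replicate (I (h 0)) (h 0) ++_) (degrees-+ I (h ∘ suc) m n))
    (sym (++-assoc (replicate (I (h 0)) (h 0)) (degrees I (h ∘ suc) m) _))

  degrees-> : ∀ I h {b} → (∀ i → b < h i) → ∀ l → All (b <_) (degrees I h l)
  degrees-> I h b<h zero    = []
  degrees-> I h b<h (suc l) = All.++⁺ (All.replicate⁺ (I (h 0)) (b<h 0)) (degrees-> I (h ∘ suc) (b<h ∘ suc) l)

  -- The list of degrees reaches up to M for every n, whereas `A I n` uses degrees up to n only. The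
  -- two agree because factors 1 - xᵉ with e > n leave the coefficient of xⁿ unchanged.
  differences≡∑A : ∀ I {M f} → VanishesAbove M f →
                   differences (degrees I suc M) f 0 ≡ ∑ (suc M) (λ n → f n * A I n)
  differences≡∑A I {M} {f} p = trans (differences-δ (degrees I suc M) p 0)
    (∑-cong (suc M) λ n n<1+M → cong (f n *_) (truncate n (ℕ.s≤s⁻¹ n<1+M)))
    where
    truncate : ∀ n → n ≤ M → differences (degrees I suc M) (δ n) 0 ≡ A I n
    truncate n n≤M = begin
      differences (degrees I suc M) (δ n) 0
        ≡⟨ cong (λ m → differences (degrees I suc m) (δ n) 0) (ℕ.m+[n∸m]≡n n≤M) ⟨
      differences (degrees I suc (n ℕ.+ (M ℕ.∸ n))) (δ n) 0
        ≡⟨ cong (λ es → differences es (δ n) 0) (degrees-+ I suc n (M ℕ.∸ n)) ⟩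
      differences (degrees I suc n ++ degrees I _ (M ℕ.∸ n)) (δ n) 0
        ≡⟨ differences-++ (degrees I suc n) (degrees I _ (M ℕ.∸ n)) (δ n) 0 ⟩
      differences (degrees I suc n) (differences (degrees I _ (M ℕ.∸ n)) (δ n)) 0
        ≡⟨ differences-cong (degrees I suc n) (differences-large (δ-vanishes n)
             (degrees-> I (λ i → suc (n ℕ.+ i)) (λ i → s≤s (ℕ.m≤m+n n i)) (M ℕ.∸ n))) 0 ⟩
      differences (degrees I suc n) (δ n) 0
        ≡⟨ A≡differences I n ⟨
      A I n ∎

-- Growth of the number of monomials, and bounds for the tail of the sum

module GrowthEstimates where
  open import Defs using (extendByZero)
  open InclusionExclusion using (∑; ∑-last)
  open import Data.Integer.Base as ℤ using (ℤ; +_; ∣_∣; 0ℤ)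
  import Data.Integer.Properties as ℤ
  open import Data.Nat.Base
  open import Data.Nat.Properties
  open import Data.Nat.Induction using (<-rec)
  import Data.Integer.Tactic.RingSolver as ℤ-Ring
  open import Data.Nat.Tactic.RingSolver using (solve-∀)
  open import Data.Product.Base using (_,_; ∃-syntax; proj₁; proj₂)
  open import Data.Sum.Base using (inj₁; inj₂)
  open import Relation.Binary.PropositionalEquality using (_≡_; refl; sym; trans; cong; cong₂)

  -- suc (w k m) is the number of monomials of degree at most m in k variables.
  w : ℕ → ℕ → ℕ
  w zero    m       = 0
  w (suc k) zero    = 0
  w (suc k) (suc m) = w (suc k) m + suc (w k (suc m))

  W : ℕ → ℕ → ℕ
  W k m = suc (w k m)

  W-0 : ∀ k → W k 0 ≡ 1
  W-0 zero    = refl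
  W-0 (suc k) = refl

  W>0 : ∀ k m → 0 < W k m
  W>0 zero    m       = z<s
  W>0 (suc k) zero    = z<s
  W>0 (suc k) (suc m) = ≤-trans (W>0 (suc k) m) (m≤m+n _ _)

  W-step : ∀ k m → W k m ≤ W k (suc m)
  W-step zero    m = ≤-refl
  W-step (suc k) m = m≤m+n _ _

  W-mono : ∀ k m n → W k m ≤ W k (m + n)
  W-mono k m zero    = ≤-reflexive (cong (W k) (sym (+-identityʳ m)))
  W-mono k m (suc n) = ≤-trans (W-mono k m n)
    (≤-trans (W-step k (m + n)) (≤-reflexive (cong (W k) (sym (+-suc m n)))))

  -- This is superadditivity of `w`. It is stated for `W` because Pascal's rule `W (suc k) (suc m) =
  -- W (suc k) m + W k (suc m)` holds by computation.
  W-superadditive : ∀ k m n → W k m + W k n ≤ suc (W k (m + n))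
  W-superadditive k m zero = ≤-reflexive (trans (cong₂ _+_ (cong (W k) (sym (+-identityʳ m))) (W-0 k)) (+-comm _ 1))
  W-superadditive zero    m (suc n) = ≤-refl
  W-superadditive (suc k) m (suc n) rewrite +-suc m n = begin
    W (suc k) m + (W (suc k) n + W k (suc n))        ≡⟨ +-assoc (W (suc k) m) _ _ ⟨
    (W (suc k) m + W (suc k) n) + W k (suc n)        ≤⟨ +-mono-≤ (W-superadditive (suc k) m n) (W-mono k (suc n) m) ⟩
    suc (W (suc k) (m + n)) + W k (suc n + m)        ≡⟨ cong (λ x → suc (W (suc k) (m + n)) + W k (suc x)) (+-comm n m) ⟩
    suc (W (suc k) (m + n) + W k (suc (m + n)))      ∎
    where open ≤-Reasoning

  -- `W k e` is the binomial coefficient of e + k over k, and these are the absorption identities in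
  -- k and in e. Expanding by Pascal's rule reduces either one to both at smaller arguments, hence
  -- the mutual recursion.
  W-k-identity : ∀ k e → suc k * W (suc k) e ≡ suc (e + k) * W k e
  W-e-identity : ∀ k e → suc e * W k (suc e) ≡ suc (e + k) * W k e

  W-k-identity k zero    = cong (suc k *_) (sym (W-0 k))
  W-k-identity k (suc e) = trans (*-distribˡ-+ (suc k) (W (suc k) e) (W k (suc e)))
    (trans (cong (_+ suc k * W k (suc e)) (trans (W-k-identity k e) (sym (W-e-identity k e))))
      (rearrange e k (W k (suc e))))
    where
    rearrange : ∀ e k x → suc e * x + suc k * x ≡ suc (suc e + k) * x
    rearrange = solve-∀

  W-e-identity zero    e = cong (λ x → suc x * 1) (sym (+-identityʳ e))
  W-e-identity (suc k) e = trans (*-distribˡ-+ (suc e) (W (suc k) e) (W k (suc e)))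
    (trans (cong (_+_ (suc e * W (suc k) e)) (trans (W-e-identity k e) (sym (W-k-identity k e))))
      (rearrange e k (W (suc k) e)))
    where
    rearrange : ∀ e k x → suc e * x + suc k * x ≡ suc (e + suc k) * x
    rearrange = solve-∀

  -- A further variable multiplies the number of monomials by (e + k + 1)/(k + 1), which exceeds any
  -- constant B once e is large.
  W-dominates : ∀ B k e → B * suc k ≤ e → B * W k e ≤ W (suc k) e
  W-dominates B k e large = *-cancelˡ-≤ (suc k) (begin
    suc k * (B * W k e)    ≡⟨ rearrange k B (W k e) ⟩
    (B * suc k) * W k e    ≤⟨ *-monoˡ-≤ (W k e) (≤-trans large (≤-trans (m≤m+n e k) (n≤1+n _))) ⟩
    suc (e + k) * W k e    ≡⟨ W-k-identity k e ⟨
    suc k * W (suc k) e    ∎)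
    where
    open ≤-Reasoning
    rearrange : ∀ k B x → suc k * (B * x) ≡ (B * suc k) * x
    rearrange = solve-∀

  -- Pascal's rule unrolled s times; each increment is at most the last one.
  W-shift : ∀ k e s → W (suc k) (e + s) ≤ W (suc k) e + s * W k (e + s)
  W-shift k e zero    = ≤-reflexive (trans (cong (W (suc k)) (+-identityʳ e)) (sym (+-identityʳ _)))
  W-shift k e (suc s) rewrite +-suc e s = begin
    W (suc k) (e + s) + W k (suc (e + s))                     ≤⟨ +-monoˡ-≤ _ (W-shift k e s) ⟩
    (W (suc k) e + s * W k (e + s)) + W k (suc (e + s))       ≤⟨ +-monoˡ-≤ _ (+-monoʳ-≤ (W (suc k) e) (*-monoʳ-≤ s (W-step k (e + s)))) ⟩
    (W (suc k) e + s * W k (suc (e + s))) + W k (suc (e + s)) ≡⟨ rearrange (W (suc k) e) s (W k (suc (e + s))) ⟩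
    W (suc k) e + suc s * W k (suc (e + s))                   ∎
    where
    open ≤-Reasoning
    rearrange : ∀ a s x → (a + s * x) + x ≡ a + suc s * x
    rearrange = solve-∀

  e≤W : ∀ k e → e ≤ W (suc k) e
  e≤W k zero    = z≤n
  e≤W k (suc e) = ≤-trans (≤-reflexive (+-comm 1 e)) (+-mono-≤ (e≤W k e) (W>0 k (suc e)))

  -- Once e is large, W (e + s) ≤ 3/2 W e and 6 e ≤ W e.
  W-growth : ∀ k s → ∃[ c ] ∀ e → W (2 + k) (e + s) + 3 * e ≤ 2 * W (2 + k) e + c
  -- The constant is the left side at the threshold E, which by monotonicity covers all e ≤ E.
  W-growth k s = W (2 + k) (E + s) + 3 * E , bound
    where
    open ≤-Reasoning
    -- The first summand lets `W (2 + k)` absorb 3s copies of `W (1 + k)` at e + s, the second lets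
    -- it absorb 6 copies at e, each of which is at least e.
    E = (3 * s) * (2 + k) + 6 * (2 + k)
    large : ∀ e → E ≤ e → W (2 + k) (e + s) + 3 * e ≤ 2 * W (2 + k) e
    large e E≤e = *-cancelˡ-≤ 2 (begin
      2 * (W (2 + k) (e + s) + 3 * e)             ≡⟨ rearrange₁ (W (2 + k) (e + s)) e ⟩
      2 * W (2 + k) (e + s) + 6 * e               ≤⟨ +-mono-≤ three-halves sixfold ⟩
      3 * W (2 + k) e + W (2 + k) e               ≡⟨ rearrange₂ (W (2 + k) e) ⟩
      2 * (2 * W (2 + k) e)                       ∎)
      where
      rearrange₁ : ∀ a e → 2 * (a + 3 * e) ≡ 2 * a + 6 * e
      rearrange₁ = solve-∀
      rearrange₂ : ∀ a → 3 * a + a ≡ 2 * (2 * a)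
      rearrange₂ = solve-∀
      rearrange₃ : ∀ a s x → 3 * (a + s * x) ≡ 3 * a + (3 * s) * x
      rearrange₃ = solve-∀
      rearrange₄ : ∀ a → 2 * a + a ≡ 3 * a
      rearrange₄ = solve-∀
      sixfold : 6 * e ≤ W (2 + k) e
      sixfold = ≤-trans (*-monoʳ-≤ 6 (e≤W k e)) (W-dominates 6 (suc k) e (≤-trans (m≤n+m _ _) E≤e))
      three-halves : 2 * W (2 + k) (e + s) ≤ 3 * W (2 + k) e
      -- After tripling `W-shift`, the error term is at most `W (2 + k) (e + s)`, which is one third
      -- of the left side and is cancelled.
      three-halves = +-cancelʳ-≤ (W (2 + k) (e + s)) _ _ (begin
        2 * W (2 + k) (e + s) + W (2 + k) (e + s)          ≡⟨ rearrange₄ (W (2 + k) (e + s)) ⟩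
        3 * W (2 + k) (e + s)                              ≤⟨ *-monoʳ-≤ 3 (W-shift (suc k) e s) ⟩
        3 * (W (2 + k) e + s * W (suc k) (e + s))          ≡⟨ rearrange₃ (W (2 + k) e) s (W (suc k) (e + s)) ⟩
        3 * W (2 + k) e + (3 * s) * W (suc k) (e + s)      ≤⟨ +-monoʳ-≤ (3 * W (2 + k) e) (W-dominates (3 * s) (suc k) (e + s)
                                                                (≤-trans (m≤m+n _ _) (≤-trans E≤e (m≤m+n e s)))) ⟩
        3 * W (2 + k) e + W (2 + k) (e + s)                ∎)
    bound : ∀ e → W (2 + k) (e + s) + 3 * e ≤ 2 * W (2 + k) e + (W (2 + k) (E + s) + 3 * E)
    bound e with ≤-total E e
    ... | inj₁ E≤e = ≤-trans (large e E≤e) (m≤m+n _ _)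
    ... | inj₂ e≤E = ≤-trans (+-mono-≤ W≤ (*-monoʳ-≤ 3 e≤E)) (m≤n+m _ (2 * W (2 + k) e))
      where
      W≤ : W (2 + k) (e + s) ≤ W (2 + k) (E + s)
      W≤ = ≤-trans (W-mono (2 + k) (e + s) (E ∸ e)) (≤-reflexive (cong (W (2 + k))
        (trans (trans (+-assoc e s _) (trans (cong (_+_ e) (+-comm s _)) (sym (+-assoc e _ s)))) (cong (_+ s) (m+[n∸m]≡n e≤E)))))

  ∑ℕ : ℕ → (ℕ → ℕ) → ℕ
  ∑ℕ zero    f = 0
  ∑ℕ (suc n) f = ∑ℕ n f + f n

  ∣∑∣≤∑ℕ : ∀ n f {g} → (∀ i → i < n → ∣ f i ∣ ≤ g i) → ∣ ∑ n f ∣ ≤ ∑ℕ n g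
  ∣∑∣≤∑ℕ zero    f p = z≤n
  ∣∑∣≤∑ℕ (suc n) f p rewrite ∑-last n f = ≤-trans (ℤ.∣i+j∣≤∣i∣+∣j∣ (∑ n f) (f n))
    (+-mono-≤ (∣∑∣≤∑ℕ n f (λ i i<n → p i (m<n⇒m<1+n i<n))) (p n ≤-refl))

  -- The induction in `partial` proves the sharper bound 2Y(1 - 1/2ᴸ) for the partial sum, cleared
  -- of denominators; the bound 2Y alone would not reproduce itself.
  geometric-decay : ∀ (f : ℕ → ℕ) Y → (∀ e → f e * 2 ^ e ≤ Y) → ∀ L → ∑ℕ L f ≤ 2 * Y
  geometric-decay f Y p L = *-cancelʳ-≤ (∑ℕ L f) (2 * Y) (2 ^ L) ⦃ m^n≢0 2 L ⦄ (m+n≤o⇒m≤o _ (partial L))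
    where
    open ≤-Reasoning
    partial : ∀ L → ∑ℕ L f * 2 ^ L + 2 * Y ≤ 2 * Y * 2 ^ L
    partial zero    = ≤-reflexive (sym (*-identityʳ (2 * Y)))
    partial (suc L) = begin
      (∑ℕ L f + f L) * (2 * 2 ^ L) + 2 * Y           ≡⟨ rearrange (∑ℕ L f) (f L) (2 ^ L) Y ⟩
      2 * (∑ℕ L f * 2 ^ L + f L * 2 ^ L + Y)         ≤⟨ *-monoʳ-≤ 2 (+-monoˡ-≤ Y (+-monoʳ-≤ (∑ℕ L f * 2 ^ L) (p L))) ⟩
      2 * (∑ℕ L f * 2 ^ L + Y + Y)                   ≡⟨ cong (2 *_) (double (∑ℕ L f * 2 ^ L) Y) ⟩
      2 * (∑ℕ L f * 2 ^ L + 2 * Y)                   ≤⟨ *-monoʳ-≤ 2 (partial L) ⟩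
      2 * (2 * Y * 2 ^ L)                            ≡⟨ swap Y (2 ^ L) ⟩
      2 * Y * (2 * 2 ^ L)                            ∎
      where
      rearrange : ∀ S f t Y → (S + f) * (2 * t) + 2 * Y ≡ 2 * (S * t + f * t + Y)
      rearrange = solve-∀
      double : ∀ x Y → x + Y + Y ≡ x + 2 * Y
      double = solve-∀
      swap : ∀ Y t → 2 * (2 * Y * t) ≡ 2 * Y * (2 * t)
      swap = solve-∀

  module Growth (q : ℕ) (2≤q : 2 ≤ q) (k : ℕ) where
    open ≤-Reasoning

    instance
      q≢0 : NonZero q
      q≢0 = >-nonZero (≤-trans z<s 2≤q)

    G : ℕ → ℕ
    G m = q ^ w k m

    G>0 : ∀ m → 0 < G m
    G>0 m = m^n>0 q (w k m)

    G-supermultiplicative : ∀ m n → G m * G n ≤ G (m + n)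
    G-supermultiplicative m n = ≤-trans (≤-reflexive (sym (^-distribˡ-+-* q (w k m) (w k n))))
      (^-monoʳ-≤ q (s≤s⁻¹ (≤-trans (≤-reflexive (sym (+-suc (w k m) (w k n)))) (s≤s⁻¹ (W-superadditive k m n)))))

    -- The origin of the base q + 1. In the recursion for the inverse series, each earlier term
    -- contributes a factor q times its own bound, and these sum to less than the next power of q +
    -- 1.
    partial-geometric : ∀ d → suc (∑ℕ d (λ j → q * suc q ^ j)) ≡ suc q ^ d
    partial-geometric zero    = refl
    partial-geometric (suc d) = cong (_+ q * suc q ^ d) (partial-geometric d)

    -- The hypothesis says that the power series of a is the inverse of that of N.
    inverse-series-bound : ∀ (N : ℕ → ℕ) (a : ℕ → ℤ) → (∀ m → G m ≤ N m) → (∀ m → N m ≤ q * G m) →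
      ∣ a 0 ∣ ≤ 1 → (∀ d → 0 < d → ∑ (suc d) (λ j → + N (d ∸ j) ℤ.* a j) ≡ 0ℤ) →
      ∀ d → ∣ a d ∣ ≤ suc q ^ d * G d
    inverse-series-bound N a G≤N N≤qG a₀≤1 inverse = <-rec _ step
      where
      f : ℕ → ℕ → ℤ
      f d j = + N (d ∸ j) ℤ.* a j
      x+y≡0⇒y≡-x : ∀ x y → x ℤ.+ y ≡ 0ℤ → y ≡ ℤ.- x
      x+y≡0⇒y≡-x x y p = trans (rearrange x y) (trans (cong (ℤ._+ ℤ.- x) p) (ℤ.+-identityˡ _))
        where
        rearrange : ∀ x y → y ≡ (x ℤ.+ y) ℤ.+ ℤ.- x
        rearrange = ℤ-Ring.solve-∀
      ∑ℕ-*ʳ : ∀ n f c → ∑ℕ n (λ j → f j * c) ≡ ∑ℕ n f * c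
      ∑ℕ-*ʳ zero    f c = refl
      ∑ℕ-*ʳ (suc n) f c = trans (cong (_+ f n * c) (∑ℕ-*ʳ n f c)) (sym (*-distribʳ-+ c (∑ℕ n f) (f n)))
      rearrange : ∀ q g p h → q * g * (p * h) ≡ q * p * (g * h)
      rearrange = solve-∀
      term-bound : ∀ d → (∀ {j} → j < d → ∣ a j ∣ ≤ suc q ^ j * G j) →
                   ∀ j → j < d → ∣ f d j ∣ ≤ q * suc q ^ j * G d
      term-bound d rec j j<d = begin
        ∣ f d j ∣                                  ≡⟨ ℤ.abs-* (+ N (d ∸ j)) (a j) ⟩
        N (d ∸ j) * ∣ a j ∣                        ≤⟨ *-mono-≤ (N≤qG (d ∸ j)) (rec j<d) ⟩
        q * G (d ∸ j) * (suc q ^ j * G j)          ≡⟨ rearrange q (G (d ∸ j)) (suc q ^ j) (G j) ⟩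
        q * suc q ^ j * (G (d ∸ j) * G j)          ≤⟨ *-monoʳ-≤ (q * suc q ^ j) (G-supermultiplicative (d ∸ j) j) ⟩
        q * suc q ^ j * G (d ∸ j + j)              ≡⟨ cong (λ i → q * suc q ^ j * G i) (m∸n+n≡m (<⇒≤ j<d)) ⟩
        q * suc q ^ j * G d                        ∎
      step : ∀ d → (∀ {j} → j < d → ∣ a j ∣ ≤ suc q ^ j * G j) → ∣ a d ∣ ≤ suc q ^ d * G d
      step zero        rec = ≤-trans a₀≤1 (*-mono-≤ {1} {suc q ^ 0} ≤-refl (G>0 0))
      step d@(suc d-1) rec = begin
        -- The last term of the vanishing convolution is `N 0` times `a d`. As `N 0` is at least 1,
        -- its size bounds that of `a d`, and it is the negative of the sum of the other terms.
        ∣ a d ∣                                    ≤⟨ m≤n*m ∣ a d ∣ (N 0) ⦃ >-nonZero (≤-trans (G>0 0) (G≤N 0)) ⦄ ⟩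
        N 0 * ∣ a d ∣                              ≡⟨ cong (λ i → N i * ∣ a d ∣) (n∸n≡0 d) ⟨
        N (d ∸ d) * ∣ a d ∣                        ≡⟨ ℤ.abs-* (+ N (d ∸ d)) (a d) ⟨
        ∣ f d d ∣                                  ≡⟨ cong ∣_∣ (x+y≡0⇒y≡-x (∑ d (f d)) (f d d) (trans (sym (∑-last d (f d))) (inverse d z<s))) ⟩
        ∣ ℤ.- ∑ d (f d) ∣                          ≡⟨ ℤ.∣-i∣≡∣i∣ (∑ d (f d)) ⟩
        ∣ ∑ d (f d) ∣                              ≤⟨ ∣∑∣≤∑ℕ d (f d) (term-bound d rec) ⟩
        ∑ℕ d (λ j → q * suc q ^ j * G d)           ≡⟨ ∑ℕ-*ʳ d (λ j → q * suc q ^ j) (G d) ⟩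
        ∑ℕ d (λ j → q * suc q ^ j) * G d           ≤⟨ *-monoˡ-≤ (G d) (≤-trans (n≤1+n _) (≤-reflexive (partial-geometric d))) ⟩
        suc q ^ d * G d                            ∎

  -- The quantity N(m - d) in the form that it has in the theorem, so that it is zero for d > m.
  codegreeSize : (ℕ → ℕ) → ℕ → ℕ → ℕ
  codegreeSize N m d = extendByZero N (+ m ℤ.- + d)

  codegreeSize-+ : ∀ N d x → codegreeSize N (d + x) d ≡ N x
  codegreeSize-+ N d x = cong (extendByZero N)
    (trans (ℤ.m-n≡m⊖n (d + x) d) (trans (ℤ.⊖-≥ (m≤m+n d x)) (cong +_ (m+n∸m≡n d x))))

  codegreeSize-< : ∀ N {m d} → m < d → codegreeSize N m d ≡ 0
  codegreeSize-< N {m} {d} m<d =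
    trans (cong (extendByZero N) (trans (ℤ.m-n≡m⊖n m d) (ℤ.⊖-< m<d))) (negative (d ∸ m) (m<n⇒0<n∸m m<d))
    where
    negative : ∀ j → 0 < j → extendByZero N (ℤ.- + j) ≡ 0
    negative (suc j) _ = refl

  module TailBound (q : ℕ) (2≤q : 2 ≤ q) (k : ℕ) (s : ℕ) where
    open Growth q 2≤q (2 + k)
    open ≤-Reasoning

    -- Besides the constant of `W-growth`, 2s remains from 2(s + e), and 1 arises because `W` = `w`
    -- + 1 occurs once on the left and twice on the right.
    exponent : ℕ
    exponent = suc (2 * s + proj₁ (W-growth k s))

    1+q≤q² : suc q ≤ q ^ 2
    1+q≤q² = begin
      1 + q        ≤⟨ +-monoˡ-≤ q (≤-trans (s≤s z≤n) 2≤q) ⟩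
      q + q        ≡⟨ cong (_+_ q) (+-identityʳ q) ⟨
      2 * q        ≤⟨ *-mono-≤ 2≤q (≤-reflexive (sym (*-identityʳ q))) ⟩
      q ^ 2        ∎

    -- This is `W-growth` as needed in `decay`: 2(s + e) comes from q + 1 ≤ q², and the extra e from
    -- the factor 2ᵉ ≤ qᵉ that makes the tail geometric. Together they account for the 3e in
    -- `W-growth`.
    exponent-bound : ∀ e → 2 * (s + e) + w (2 + k) (s + e) + e ≤ exponent + 2 * w (2 + k) e
    exponent-bound e = +-cancelʳ-≤ 1 _ _ (begin
      2 * (s + e) + w (2 + k) (s + e) + e + 1           ≡⟨ rearrange₁ s e (w (2 + k) (s + e)) ⟩
      2 * s + (suc (w (2 + k) (s + e)) + 3 * e)         ≡⟨ cong (λ x → 2 * s + (x + 3 * e)) (cong (W (2 + k)) (+-comm s e)) ⟩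
      2 * s + (W (2 + k) (e + s) + 3 * e)       ≤⟨ +-monoʳ-≤ (2 * s) (proj₂ (W-growth k s) e) ⟩
      2 * s + (2 * W (2 + k) e + c)             ≡⟨ rearrange₂ s (w (2 + k) e) c ⟩
      exponent + 2 * w (2 + k) e + 1                    ∎)
      where
      c = proj₁ (W-growth k s)
      rearrange₁ : ∀ s e x → 2 * (s + e) + x + e + 1 ≡ 2 * s + (suc x + 3 * e)
      rearrange₁ = solve-∀
      rearrange₂ : ∀ s x c → 2 * s + (2 * suc x + c) ≡ suc (2 * s + c) + 2 * x + 1
      rearrange₂ = solve-∀

    decay : ∀ e → suc q ^ (s + e) * G (s + e) * 2 ^ e ≤ q ^ exponent * (G e * G e)
    decay e = begin
      suc q ^ (s + e) * G (s + e) * 2 ^ e                   ≤⟨ *-mono-≤ (*-monoˡ-≤ (G (s + e)) (^-monoˡ-≤ (s + e) 1+q≤q²)) (^-monoˡ-≤ e 2≤q) ⟩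
      (q ^ 2) ^ (s + e) * q ^ w (2 + k) (s + e) * q ^ e             ≡⟨ cong (λ x → x * q ^ w (2 + k) (s + e) * q ^ e) (^-*-assoc q 2 (s + e)) ⟩
      q ^ (2 * (s + e)) * q ^ w (2 + k) (s + e) * q ^ e             ≡⟨ cong (_* q ^ e) (^-distribˡ-+-* q (2 * (s + e)) (w (2 + k) (s + e))) ⟨
      q ^ (2 * (s + e) + w (2 + k) (s + e)) * q ^ e                 ≡⟨ ^-distribˡ-+-* q (2 * (s + e) + w (2 + k) (s + e)) e ⟨
      q ^ (2 * (s + e) + w (2 + k) (s + e) + e)                     ≤⟨ ^-monoʳ-≤ q (exponent-bound e) ⟩
      q ^ (exponent + 2 * w (2 + k) e)                              ≡⟨ ^-distribˡ-+-* q exponent (2 * w (2 + k) e) ⟩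
      q ^ exponent * q ^ (w (2 + k) e + (w (2 + k) e + 0))                  ≡⟨ cong (λ x → q ^ exponent * q ^ (w (2 + k) e + x)) (+-identityʳ (w (2 + k) e)) ⟩
      q ^ exponent * q ^ (w (2 + k) e + w (2 + k) e)                        ≡⟨ cong (q ^ exponent *_) (^-distribˡ-+-* q (w (2 + k) e) (w (2 + k) e)) ⟩
      q ^ exponent * (G e * G e)                            ∎

    bound : ℕ
    bound = 2 * (q * q * q ^ exponent)

    -- Write m = s + e + x and n = s + e + y; when this is impossible the term is zero. By `decay`,
    -- the bound on A(s + e) costs at most a constant times G(e)², even after multiplication by 2ᵉ.
    -- One factor G(e) joins G(x) to give at most N(m - s), the other joins G(y) to give at most N(n
    -- - s).
    tail-bound : ∀ N → (∀ m → G m ≤ N m) → (∀ m → N m ≤ q * G m) → ∀ m n L →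
      ∑ℕ L (λ e → codegreeSize N m (s + e) * codegreeSize N n (s + e) * (suc q ^ (s + e) * G (s + e)))
        ≤ bound * (codegreeSize N m s * codegreeSize N n s)
    tail-bound N G≤N N≤qG m n L = ≤-trans (geometric-decay _ Y term-bound L)
      (≤-reflexive (sym (*-assoc 2 (q * q * q ^ exponent) (c m s * c n s))))
      where
      c = codegreeSize N
      Y = q * q * q ^ exponent * (c m s * c n s)
      term-bound : ∀ e → c m (s + e) * c n (s + e) * (suc q ^ (s + e) * G (s + e)) * 2 ^ e ≤ Y
      term-bound e with <-≤-connex m (s + e) | <-≤-connex n (s + e)
      ... | inj₁ m< | _ = ≤-trans (≤-reflexive (cong (λ x → x * c n (s + e) * (suc q ^ (s + e) * G (s + e)) * 2 ^ e)
                            (codegreeSize-< N m<))) z≤n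
      ... | inj₂ _ | inj₁ n< = ≤-trans (≤-reflexive (trans (cong (λ x → c m (s + e) * x * (suc q ^ (s + e) * G (s + e)) * 2 ^ e)
                            (codegreeSize-< N n<)) (cong (λ x → x * (suc q ^ (s + e) * G (s + e)) * 2 ^ e) (*-zeroʳ (c m (s + e)))))) z≤n
      ... | inj₂ ≤m | inj₂ ≤n with m≤n⇒∃[o]m+o≡n ≤m | m≤n⇒∃[o]m+o≡n ≤n
      ... | x , refl | y , refl = begin
        c (s + e + x) (s + e) * c (s + e + y) (s + e) * (suc q ^ (s + e) * G (s + e)) * 2 ^ e
          ≡⟨ cong₂ (λ i j → i * j * (suc q ^ (s + e) * G (s + e)) * 2 ^ e) (codegreeSize-+ N (s + e) x) (codegreeSize-+ N (s + e) y) ⟩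
        N x * N y * (suc q ^ (s + e) * G (s + e)) * 2 ^ e
          ≤⟨ *-monoˡ-≤ (2 ^ e) (*-monoˡ-≤ (suc q ^ (s + e) * G (s + e)) (*-mono-≤ (N≤qG x) (N≤qG y))) ⟩
        q * G x * (q * G y) * (suc q ^ (s + e) * G (s + e)) * 2 ^ e
          ≡⟨ *-assoc (q * G x * (q * G y)) (suc q ^ (s + e) * G (s + e)) (2 ^ e) ⟩
        q * G x * (q * G y) * (suc q ^ (s + e) * G (s + e) * 2 ^ e)
          ≤⟨ *-monoʳ-≤ (q * G x * (q * G y)) (decay e) ⟩
        q * G x * (q * G y) * (q ^ exponent * (G e * G e))
          ≡⟨ rearrange q (G x) (G y) (q ^ exponent) (G e) ⟩
        q * q * q ^ exponent * (G e * G x * (G e * G y))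
          ≤⟨ *-monoʳ-≤ (q * q * q ^ exponent) (*-mono-≤ (larger x) (larger y)) ⟩
        q * q * q ^ exponent * (c (s + e + x) s * c (s + e + y) s)
          ∎
        where
        rearrange : ∀ q x y p e → q * x * (q * y) * (p * (e * e)) ≡ q * q * p * (e * x * (e * y))
        rearrange = solve-∀
        larger : ∀ x → G e * G x ≤ c (s + e + x) s
        larger x = begin
          G e * G x             ≤⟨ G-supermultiplicative e x ⟩
          G (e + x)             ≤⟨ G≤N (e + x) ⟩
          N (e + x)             ≡⟨ codegreeSize-+ N s (e + x) ⟨
          c (s + (e + x)) s     ≡⟨ cong (λ m → c m s) (+-assoc s e x) ⟨
          c (s + e + x) s       ∎

-- Bounds for the number of normalized polynomials of given degree

module NumbersOfPolynomials where
  open import Defs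
  open GCDDomains
  open FiniteFields
  open MultivariateArithmetic
  open GrowthEstimates
  open import Algebra.Apartness.Bundles using (HeytingField)
  open import Data.Fin.Base using (Fin; zero; suc; _↑ˡ_; _↑ʳ_; splitAt; combine; funToFin; finToFun)
  import Data.Fin.Properties as Fin
  open import Data.List.Base using (List; []; _∷_)
  import Data.List.Base as List
  open import Data.Nat.Base as ℕ using (ℕ; zero; suc; _≤_; _^_; _*_; z≤n; s≤s; s≤s⁻¹)
  import Data.Nat.Properties as ℕ
  open import Data.Product.Base using (_,_; ∃-syntax; proj₁; proj₂)
  open import Data.Sum.Base using (inj₁; inj₂; [_,_]′)
  open import Data.Vec.Base as Vec using (Vec; []; _∷_; replicate)
  open import Data.Vec.Properties using (≡-dec; ∷-injectiveʳ)
  open import Function.Base using (_∘_)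
  open import Function.Definitions using (Injective)
  open import Relation.Binary.PropositionalEquality using (_≡_; _≢_; refl; sym; trans; cong; cong₂)
  open import Relation.Nullary.Decidable.Core using (yes; no)
  open import Relation.Nullary.Negation.Core using (contradiction)

  raise : ∀ {k} → Vec ℕ (suc k) → Vec ℕ (suc k)
  raise (n ∷ e) = suc n ∷ e

  raise-injective : ∀ {k} {d e : Vec ℕ (suc k)} → raise d ≡ raise e → d ≡ e
  raise-injective {d = m ∷ d} {n ∷ e} refl = refl

  raise≢0∷ : ∀ {k} {d : Vec ℕ (suc k)} {e} → raise d ≢ 0 ∷ e
  raise≢0∷ {d = n ∷ d} ()

  -- The monomials of degree at most m, beginning with x₁ᵐ.
  monomialAt : ∀ k m → Fin (W k m) → Vec ℕ k
  monomialAt zero    m       _ = []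
  monomialAt (suc k) zero    _ = replicate (suc k) 0
  monomialAt (suc k) (suc m) i = [ raise ∘ monomialAt (suc k) m , (0 ∷_) ∘ monomialAt k (suc m) ]′ (splitAt (W (suc k) m) i)

  sum-raise : ∀ {k} (e : Vec ℕ (suc k)) → Vec.sum (raise e) ≡ suc (Vec.sum e)
  sum-raise (n ∷ e) = refl

  sum-monomialAt : ∀ k m i → Vec.sum (monomialAt k m i) ≤ m
  sum-monomialAt zero    m       i = z≤n
  sum-monomialAt (suc k) zero    i = ℕ.≤-reflexive (sum-replicate-0 k)
  sum-monomialAt (suc k) (suc m) i with splitAt (W (suc k) m) i
  ... | inj₁ j = ℕ.≤-trans (ℕ.≤-reflexive (sum-raise (monomialAt (suc k) m j))) (s≤s (sum-monomialAt (suc k) m j))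
  ... | inj₂ j = sum-monomialAt k (suc m) j

  sum-monomialAt-zero : ∀ k m → Vec.sum (monomialAt (suc k) m zero) ≡ m
  sum-monomialAt-zero k zero    = sum-replicate-0 k
  sum-monomialAt-zero k (suc m) = trans (sum-raise (monomialAt (suc k) m zero)) (cong suc (sum-monomialAt-zero k m))

  monomialAt-injective : ∀ k m → Injective _≡_ _≡_ (monomialAt k m)
  monomialAt-injective zero    m       {zero} {zero} _ = refl
  monomialAt-injective (suc k) zero    {zero} {zero} _ = refl
  monomialAt-injective (suc k) (suc m) {i} {j} p with splitAt (W (suc k) m) i in eqᵢ | splitAt (W (suc k) m) j in eqⱼ
  ... | inj₁ i′ | inj₁ j′ = trans (sym (Fin.splitAt⁻¹-↑ˡ eqᵢ))
          (trans (cong (_↑ˡ _) (monomialAt-injective (suc k) m (raise-injective p))) (Fin.splitAt⁻¹-↑ˡ eqⱼ))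
  ... | inj₂ i′ | inj₂ j′ = trans (sym (Fin.splitAt⁻¹-↑ʳ eqᵢ))
          (trans (cong (W (suc k) m ↑ʳ_) (monomialAt-injective k (suc m) (∷-injectiveʳ p))) (Fin.splitAt⁻¹-↑ʳ eqⱼ))
  ... | inj₁ i′ | inj₂ j′ = contradiction p raise≢0∷
  ... | inj₂ i′ | inj₁ j′ = contradiction (sym p) raise≢0∷

  monomialAt-surjective : ∀ k m e → Vec.sum e ≤ m → ∃[ i ] monomialAt k m i ≡ e
  monomialAt-surjective zero    m       []            _ = zero , refl
  monomialAt-surjective (suc k) zero    e             p = zero , sum≡0⇒replicate-0 e (ℕ.n≤0⇒n≡0 p)
  monomialAt-surjective (suc k) (suc m) (suc n ∷ e) p with monomialAt-surjective (suc k) m (n ∷ e) (s≤s⁻¹ p)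
  ... | i , q = i ↑ˡ W k (suc m) , trans (cong [ raise ∘ monomialAt (suc k) m , (0 ∷_) ∘ monomialAt k (suc m) ]′ (Fin.splitAt-↑ˡ (W (suc k) m) i _)) (cong raise q)
  monomialAt-surjective (suc k) (suc m) (zero ∷ e)  p with monomialAt-surjective k (suc m) e p
  ... | i , q = W (suc k) m ↑ʳ i , trans (cong [ raise ∘ monomialAt (suc k) m , (0 ∷_) ∘ monomialAt k (suc m) ]′ (Fin.splitAt-↑ʳ (W (suc k) m) _ i)) (cong (0 ∷_) q)

  module NumberOfPolynomials {c ℓ₁ ℓ₂} (F : HeytingField c ℓ₁ ℓ₂) {q}
                             (card : HasCardinality (HeytingField.setoid F) q) (k : ℕ) where
    open PolynomialArithmetic F card (suc k)
    private
      module F = HeytingField F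
      module E = Enumerated {S = F.setoid} card
    open FiniteHeytingField F card using (1≉0)

    fromCoefficients : ∀ {n} → (Fin n → F.Carrier) → (Fin n → Monomial) → Poly
    fromCoefficients a e = List.tabulate (λ i → a i , e i)

    coeff-∉ : ∀ {n} a (e : Fin n → Monomial) {d} → (∀ i → e i ≢ d) → coeff (fromCoefficients a e) d F.≈ F.0#
    coeff-∉ {zero}  a e e≢d = F.refl
    coeff-∉ {suc n} a e {d} e≢d with ≡-dec ℕ._≟_ (e zero) d
    ... | yes p = contradiction p (e≢d zero)
    ... | no  _ = F.trans (F.+-identityˡ _) (coeff-∉ (a ∘ suc) (e ∘ suc) (e≢d ∘ suc))

    coeff-∈ : ∀ {n} a (e : Fin n → Monomial) → Injective _≡_ _≡_ e → ∀ i → coeff (fromCoefficients a e) (e i) F.≈ a i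
    coeff-∈ {suc n} a e inj zero with ≡-dec ℕ._≟_ (e zero) (e zero)
    ... | yes _ = F.trans (F.+-congˡ (coeff-∉ (a ∘ suc) (e ∘ suc) λ i p → contradiction (inj p) λ ())) (F.+-identityʳ _)
    ... | no ¬p = contradiction refl ¬p
    coeff-∈ {suc n} a e inj (suc i) with ≡-dec ℕ._≟_ (e zero) (e (suc i))
    ... | yes p = contradiction (inj p) λ ()
    ... | no _  = F.trans (F.+-identityˡ _) (coeff-∈ (a ∘ suc) (e ∘ suc) (λ p → Fin.suc-injective (inj p)) i)

    -- The coefficient of x₁ᵐ is 1, which secures the degree; the other `w (suc k) m` coefficients
    -- are the base q digits of i.
    monicCoefficients : ∀ m → Fin (q ^ w (suc k) m) → Fin (W (suc k) m) → F.Carrier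
    monicCoefficients m i zero    = F.1#
    monicCoefficients m i (suc j) = E.from (finToFun i j)

    monic : ∀ m → Fin (q ^ w (suc k) m) → Poly
    monic m i = fromCoefficients (monicCoefficients m i) (monomialAt (suc k) m)

    coeff-monic : ∀ m i j → coeff (monic m i) (monomialAt (suc k) m j) F.≈ monicCoefficients m i j
    coeff-monic m i = coeff-∈ (monicCoefficients m i) (monomialAt (suc k) m) (monomialAt-injective (suc k) m)

    hasTotalDegree-monic : ∀ m i → HasTotalDegree m (monic m i)
    hasTotalDegree-monic m i =
      (monomialAt (suc k) m zero , sum-monomialAt-zero k m , λ p → 1≉0 (F.trans (F.sym (coeff-monic m i zero)) p))
      , λ e m<e → coeff-∉ (monicCoefficients m i) (monomialAt (suc k) m)
          λ j p → ℕ.<⇒≱ m<e (ℕ.≤-trans (ℕ.≤-reflexive (cong Vec.sum (sym p))) (sum-monomialAt (suc k) m j))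

    funToFin-cong : ∀ {m n} {f g : Fin m → Fin n} → (∀ i → f i ≡ g i) → funToFin f ≡ funToFin g
    funToFin-cong {zero}  p = refl
    funToFin-cong {suc m} p = cong₂ combine (p zero) (funToFin-cong (p ∘ suc))

    funToFin-injective : ∀ {m n} {f g : Fin m → Fin n} → funToFin f ≡ funToFin g → ∀ i → f i ≡ g i
    funToFin-injective {f = f} {g} p i =
      trans (sym (Fin.finToFun-funToFin f i)) (trans (cong (λ x → finToFun x i) p) (Fin.finToFun-funToFin g i))

    -- Comparing the coefficients of x₁ᵐ shows that the constant factor u is 1, so equivalent
    -- polynomials of this shape have the same digits.
    monic-injective : ∀ m {i j} → monic m i ∼ monic m j → i ≡ j
    monic-injective m {i} {j} (u , _ , p) = trans (sym (Fin.funToFin-finToFin {w (suc k) m} {q} i))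
      (trans (funToFin-cong agree) (Fin.funToFin-finToFin {w (suc k) m} {q} j))
      where
      scaled : ∀ a → monicCoefficients m i a F.≈ u F.* monicCoefficients m j a
      scaled a = F.trans (F.sym (coeff-monic m i a)) (F.trans (p (monomialAt (suc k) m a)) (F.*-congˡ (coeff-monic m j a)))
      u≈1 : u F.≈ F.1#
      u≈1 = F.trans (F.sym (F.*-identityʳ u)) (F.sym (scaled zero))
      agree : ∀ a → finToFun {q} i a ≡ finToFun j a
      agree a = E.from-injective (F.trans (scaled (suc a)) (F.trans (F.*-congʳ u≈1) (F.*-identityˡ _)))

    module _ {m n} (card𝒩 : HasCardinality (𝒩 m) n) where
      private module X = Enumerated {S = 𝒩 m} card𝒩

      lower-bound : q ^ w (suc k) m ≤ n
      lower-bound = Fin.injective⇒≤ {f = λ i → X.to (monic m i , hasTotalDegree-monic m i)}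
        λ p → monic-injective m (X.injective p)

      -- A class is determined by the coefficients of any representative, and those above degree m
      -- vanish. By computation the bound is q·G(m), the form required by the growth estimates.
      upper-bound : n ≤ q ^ W (suc k) m
      upper-bound = Fin.injective⇒≤ {f = code} code-injective
        where
        digit : Fin n → Fin (W (suc k) m) → Fin q
        digit i j = E.to (coeff (proj₁ (X.from i)) (monomialAt (suc k) m j))
        code : Fin n → Fin (q ^ W (suc k) m)
        code i = funToFin (digit i)
        code-injective : Injective _≡_ _≡_ code
        code-injective {i} {j} p = X.from-injective (≈⇒∼ {proj₁ (X.from i)} {proj₁ (X.from j)} agree)
          where
          agree : proj₁ (X.from i) ≈ proj₁ (X.from j)
          agree e with ℕ.≤-<-connex (Vec.sum e) m
          ... | inj₂ m<e = F.trans (proj₂ (proj₂ (X.from i)) e m<e) (F.sym (proj₂ (proj₂ (X.from j)) e m<e))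
          ... | inj₁ e≤m with monomialAt-surjective (suc k) m e e≤m
          ... | a , refl = E.injective (funToFin-injective {f = digit i} {digit j} p a)

-- The sieve applied to polynomials and to pairs of polynomials

module CoprimePairCounts where
  open import Defs
  open FiniteFields
  open MultivariateArithmetic
  open Sieves
  open InclusionExclusion
  open GrowthEstimates using (codegreeSize; codegreeSize-+; codegreeSize-<)
  open import Algebra.Apartness.Bundles using (HeytingField)
  open import Algebra.Bundles using (CommutativeMonoid)
  import Algebra.Properties.CommutativeSemigroup as CommutativeSemigroupProperties
  import Algebra.Properties.Monoid.Divisibility as MonoidDivisibility
  open import Data.Fin.Base using (Fin; toℕ; fromℕ<; combine; remQuot)
  import Data.Fin.Properties as Fin
  open import Data.Integer.Base as ℤ using (ℤ; +_; 0ℤ)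
  import Data.Integer.Properties as ℤ
  open import Data.List.Base using (List; []; _∷_; _++_; map; replicate; allFin)
  open import Data.List.Properties using (map-++)
  import Data.List.Membership.Propositional as Membership
  import Data.List.Membership.Propositional.Properties as Membership
  open import Data.List.Relation.Unary.All as All using (All; []; _∷_)
  import Data.List.Relation.Unary.All.Properties as All
  open import Data.List.Relation.Unary.AllPairs as AllPairs using (AllPairs; []; _∷_)
  import Data.List.Relation.Unary.AllPairs.Properties as AllPairs
  open import Data.List.Relation.Unary.Unique.Propositional.Properties using (allFin⁺)
  open import Data.Nat.Base as ℕ using (ℕ; zero; suc; _+_; _*_; _∸_; _≤_; _<_; s≤s⁻¹; z<s)
  import Data.Nat.Properties as ℕ
  open import Data.Nat.Induction using (<-rec)
  open import Data.Product.Base using (_×_; _,_; Σ-syntax; ∃-syntax; proj₁; proj₂)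
  open import Data.Product.Relation.Binary.Pointwise.NonDependent using (×-setoid)
  open import Data.Sum.Base using (_⊎_; inj₁; inj₂)
  open import Function.Base using (_∘_)
  open import Relation.Binary.Bundles using (Setoid)
  import Relation.Binary.Construct.On as On
  open import Relation.Binary.PropositionalEquality using (_≡_; _≢_; refl; sym; trans; cong; cong₂; subst)
  open import Relation.Nullary.Decidable.Core using (Dec; yes; no; _×-dec_)
  open import Relation.Nullary.Negation.Core using (¬_; contradiction)

  transport : ∀ {a ℓ b ℓ′ n} {S : Setoid a ℓ} {S′ : Setoid b ℓ′} (f : Setoid.Carrier S → Setoid.Carrier S′) →
    (∀ {x y} → Setoid._≈_ S x y → Setoid._≈_ S′ (f x) (f y)) →
    (∀ {x y} → Setoid._≈_ S′ (f x) (f y) → Setoid._≈_ S x y) →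
    (∀ y → ∃[ x ] Setoid._≈_ S′ (f x) y) → HasCardinality S′ n → HasCardinality S n
  transport {S = S} {S′} f f-cong f-injective f-surjective card = record
    { to        = λ x → E.to (f x)
    ; cong      = λ x≈y → E.cong (f-cong x≈y)
    ; bijective = (λ p → f-injective (E.injective p))
                , λ i → let x , fx≈y = f-surjective (E.from i)
                        in x , λ z≈x → trans (E.cong (S′.trans (f-cong z≈x) fx≈y)) (E.to-from i)
    }
    where
    module S′ = Setoid S′
    module E = Enumerated {S = S′} card

  hasCardinality-× : ∀ {a ℓ b ℓ′ m n} {S : Setoid a ℓ} {S′ : Setoid b ℓ′} →
    HasCardinality S m → HasCardinality S′ n → HasCardinality (×-setoid S S′) (m * n)
  hasCardinality-× {m = m} {n} {S} {S′} card card′ = record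
    { to        = λ (x , y) → combine (E.to x) (E′.to y)
    ; cong      = λ (p , r) → cong₂ combine (E.cong p) (E′.cong r)
    ; bijective = (λ {(x , y)} {(x′ , y′)} p →
                      let r , s = Fin.combine-injective (E.to x) (E′.to y) (E.to x′) (E′.to y′) p
                      in E.injective r , E′.injective s)
                , λ i → let a , b = remQuot n i
                        in (E.from a , E′.from b) , λ (p , r) → trans
                             (cong₂ combine (trans (E.cong p) (E.to-from a)) (trans (E′.cong r) (E′.to-from b)))
                             (Fin.combine-remQuot {m} n i)
    }
    where
    module E = Enumerated {S = S} card
    module E′ = Enumerated {S = S′} card′

  module Counts {c ℓ₁ ℓ₂} (F : HeytingField c ℓ₁ ℓ₂) {q}
                (card : HasCardinality (HeytingField.setoid F) q) (k : ℕ)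
                (N I : ℕ → ℕ)
                (card𝒩 : ∀ m → HasCardinality (Polynomials.𝒩 F k m) (N m))
                (cardI : ∀ m → HasCardinality (Polynomials.Irreducibles F k m) (I m)) where
    open PolynomialArithmetic F card k
    private
      module M = CommutativeMonoid *-commutativeMonoid
      module Div = MonoidDivisibility M.monoid
      module 𝒩 m = Enumerated {S = 𝒩 m} (card𝒩 m)
      module ℐ m = Enumerated {S = Irreducibles m} (cardI m)

    -- A class of irreducibles is named by its degree and its number in the enumeration, so
    -- inequivalence of irreducibles becomes propositional inequality.
    PrimeIndex : Set
    PrimeIndex = Σ[ e ∈ ℕ ] Fin (I e)

    π : PrimeIndex → Poly
    π (e , i) = proj₁ (proj₁ (ℐ.from e i))

    hasTotalDegree-π : ∀ p → HasTotalDegree (proj₁ p) (π p)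
    hasTotalDegree-π (e , i) = proj₂ (proj₁ (ℐ.from e i))

    irreducible-π : ∀ p → Irreducible (π p)
    irreducible-π (e , i) = proj₂ (ℐ.from e i)

    π-injective : ∀ {p p′} → π p ∼ π p′ → p ≡ p′
    π-injective {e , i} {e′ , i′} p∼p′
      with hasTotalDegree-unique {f = π (e′ , i′)}
             (hasTotalDegree-resp-∼ {f = π (e , i)} {π (e′ , i′)} p∼p′ (hasTotalDegree-π (e , i))) (hasTotalDegree-π (e′ , i′))
    ... | refl = cong (e ,_) (ℐ.from-injective e p∼p′)

    -- The prime π p′ divides π p · f. If it divided π p, the two irreducibles would be equivalent
    -- and their indices equal; hence it divides f.
    prime-cancel : ∀ {p p′} → p ≢ p′ → ∀ {f g} → π p · f ∼ π p′ · g → ∃[ h ] f ∼ π p′ · h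
    prime-cancel {p} {p′} p≢p′ {f} {g} pf∼p′g
      with irreducible⇒prime (irreducible-π p′) {π p} {f}
             (Div.∣ʳ-trans {π p′} {π p′ · g} {π p · f} (g , ·-comm g (π p′)) (∼⇒∣ {π p · f} {π p′ · g} pf∼p′g))
    ... | inj₁ p′∣p = contradiction (π-injective {p} {p′}
            (irreducible∣irreducible⇒∼ {π p′} {π p} (irreducible-π p′) (irreducible-π p) p′∣p)) p≢p′
    ... | inj₂ (h , hp′≈f) = h , ≈⇒∼ {f} {π p′ · h}
            (≈-trans {f} {h · π p′} {π p′ · h} (≈-sym {h · π p′} {f} hp′≈f) (·-comm h (π p′)))

    -- An equation d + j = m in place of a subtraction leaves the layers with d > m empty, in
    -- agreement with N(m - d) = 0.
    HasCodegree : ℕ → ℕ → Poly → Set _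
    HasCodegree m d f = ∃[ j ] (HasTotalDegree j f × d + j ≡ m)

    𝒩-codegree : ℕ → ℕ → Setoid _ _
    𝒩-codegree m d = On.setoid {B = Σ[ f ∈ Poly ] HasCodegree m d f} ∼-setoid proj₁

    card-codegree : ∀ m d → HasCardinality (𝒩-codegree m d) (codegreeSize N m d)
    card-codegree m d with ℕ.≤-<-connex d m
    ... | inj₂ m<d = subst (HasCardinality (𝒩-codegree m d)) (sym (codegreeSize-< N m<d)) (record
      { to        = λ (f , j , _ , d+j≡m) → contradiction (ℕ.≤-trans (ℕ.m≤m+n d j) (ℕ.≤-reflexive d+j≡m)) (ℕ.<⇒≱ m<d)
      ; cong      = λ { {f , j , _ , d+j≡m} _ → contradiction (ℕ.≤-trans (ℕ.m≤m+n d j) (ℕ.≤-reflexive d+j≡m)) (ℕ.<⇒≱ m<d) }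
      ; bijective = (λ { {f , j , _ , d+j≡m} _ → contradiction (ℕ.≤-trans (ℕ.m≤m+n d j) (ℕ.≤-reflexive d+j≡m)) (ℕ.<⇒≱ m<d) })
                  , λ ()
      })
    ... | inj₁ d≤m with ℕ.m≤n⇒∃[o]m+o≡n d≤m
    ... | x , refl = subst (HasCardinality (𝒩-codegree m d)) (sym (codegreeSize-+ N d x))
      (transport {S = 𝒩-codegree m d} {S′ = 𝒩 x}
        (λ (f , j , f-deg , d+j≡m) → f , subst (λ j → HasTotalDegree j f) (ℕ.+-cancelˡ-≡ d j x d+j≡m) f-deg)
        (λ p → p) (λ p → p)
        (λ (f , f-deg) → (f , x , f-deg , refl) , ∼-refl {f})
        (card𝒩 x))

    hasCodegree-· : ∀ {m d} p f → HasCodegree m (proj₁ p + d) f → HasCodegree m d (π p · f)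
    hasCodegree-· {m} {d} p f (j , f-deg , eq) = proj₁ p + j , hasTotalDegree-· (π p) f (hasTotalDegree-π p) f-deg
      , trans (CommutativeSemigroupProperties.x∙yz≈yx∙z ℕ.+-commutativeSemigroup d (proj₁ p) j) eq

    hasCodegree-·⁻¹ : ∀ {m d} p f → HasCodegree m d (π p · f) → HasCodegree m (proj₁ p + d) f
    hasCodegree-·⁻¹ {m} {d} p f (j , pf-deg , d+j≡m)
      with hasTotalDegree-factor (π p) f {π p · f} (≈-refl {π p · f}) pf-deg
    ... | e , i , p-deg , f-deg , e+i≡j with hasTotalDegree-unique {f = π p} (hasTotalDegree-π p) p-deg
    ... | refl = i , f-deg
      , trans (sym (CommutativeSemigroupProperties.x∙yz≈yx∙z ℕ.+-commutativeSemigroup d (proj₁ p) i)) (trans (cong (_+_ d) e+i≡j) d+j≡m)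

    π≉0 : ∀ p → ¬ π p ≈ []
    π≉0 p = hasTotalDegree⇒≉0 {f = π p} (hasTotalDegree-π p)

    π-∙-comm : ∀ p p′ f → π p · (π p′ · f) ∼ π p′ · (π p · f)
    π-∙-comm p p′ f = ≈⇒∼ {π p · (π p′ · f)} {π p′ · (π p · f)}
      (CommutativeSemigroupProperties.x∙yz≈y∙xz M.commutativeSemigroup (π p) (π p′) f)

    polynomials : ℕ → GradedAction _ _ _ _ _
    polynomials m = record
      { setoid      = ∼-setoid
      ; Graded      = HasCodegree m
      ; Graded-resp = λ {_} {f} {g} f∼g (j , f-deg , eq) → j , hasTotalDegree-resp-∼ {f = f} {g} f∼g f-deg , eq
      ; size        = codegreeSize N m
      ; card        = card-codegree m
      ; Prime       = PrimeIndex
      ; degree      = proj₁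
      ; _∙_         = λ p f → π p · f
      ; ∙-cong      = λ p {f} {g} → ·-congˡ-∼ (π p) {f} {g}
      ; ∙-injective = λ p {f} {g} → ·-cancelˡ-∼ (π p) {f} {g} (π≉0 p)
      ; ∙-comm      = π-∙-comm
      ; ∙-graded    = λ p {_} {f} → hasCodegree-· p f
      ; ∙-graded⁻¹  = λ p {_} {f} → hasCodegree-·⁻¹ p f
      ; _⊥_         = _≢_
      ; ⊥-divides   = λ {p} {p′} p≢p′ {f} {g} → prime-cancel {p} {p′} p≢p′ {f} {g}
      }

    -- The primes act diagonally, so dividing a pair means being a common divisor. A single codegree
    -- d grades both components, whose degrees are m - d and n - d.
    pairs : ℕ → ℕ → GradedAction _ _ _ _ _
    pairs m n = record
      { setoid      = ×-setoid ∼-setoid ∼-setoid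
      ; Graded      = λ d (f , g) → HasCodegree m d f × HasCodegree n d g
      ; Graded-resp = λ {_} {(f , g)} {(f′ , g′)} (f∼f′ , g∼g′) (f-deg , g-deg) →
                        X.Graded-resp {_} {f} {f′} f∼f′ f-deg , Y.Graded-resp {_} {g} {g′} g∼g′ g-deg
      ; size        = λ d → codegreeSize N m d * codegreeSize N n d
      ; card        = λ d → transport
                        {S = On.setoid {B = Σ[ (f , g) ∈ Poly × Poly ] (HasCodegree m d f × HasCodegree n d g)} (×-setoid ∼-setoid ∼-setoid) proj₁}
                        {S′ = ×-setoid (𝒩-codegree m d) (𝒩-codegree n d)}
                        (λ ((f , g) , f-deg , g-deg) → (f , f-deg) , (g , g-deg)) (λ p → p) (λ p → p)
                        (λ ((f , f-deg) , (g , g-deg)) → ((f , g) , f-deg , g-deg) , ∼-refl {f} , ∼-refl {g})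
                        (hasCardinality-× {S = 𝒩-codegree m d} {𝒩-codegree n d} (card-codegree m d) (card-codegree n d))
      ; Prime       = PrimeIndex
      ; degree      = proj₁
      ; _∙_         = λ p (f , g) → π p · f , π p · g
      ; ∙-cong      = λ p {(f , g)} {(f′ , g′)} (r , s) → X.∙-cong p {f} {f′} r , Y.∙-cong p {g} {g′} s
      ; ∙-injective = λ p {(f , g)} {(f′ , g′)} (r , s) → X.∙-injective p {f} {f′} r , Y.∙-injective p {g} {g′} s
      ; ∙-comm      = λ p p′ (f , g) → X.∙-comm p p′ f , Y.∙-comm p p′ g
      ; ∙-graded    = λ p {_} {(f , g)} (r , s) → X.∙-graded p {_} {f} r , Y.∙-graded p {_} {g} s
      ; ∙-graded⁻¹  = λ p {_} {(f , g)} (r , s) → X.∙-graded⁻¹ p {_} {f} r , Y.∙-graded⁻¹ p {_} {g} s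
      ; _⊥_         = _≢_
      ; ⊥-divides   = λ p≢p′ {(f , g)} {(f′ , g′)} (r , s) →
                        let h , u = X.⊥-divides p≢p′ {f} {f′} r
                            h′ , v = Y.⊥-divides p≢p′ {g} {g′} s
                        in (h , h′) , (u , v)
      }
      where
      module X = GradedAction (polynomials m)
      module Y = GradedAction (polynomials n)

    primes : (ℕ → ℕ) → ℕ → List PrimeIndex
    primes h zero    = []
    primes h (suc l) = map (h 0 ,_) (allFin (I (h 0))) ++ primes (h ∘ suc) l

    primes-degrees : ∀ h l → map proj₁ (primes h l) ≡ degrees I h l
    primes-degrees h zero    = refl
    primes-degrees h (suc l) = trans (map-++ proj₁ (map (h 0 ,_) (allFin (I (h 0)))) (primes (h ∘ suc) l))
      (cong₂ _++_ (trans (sym (map-∘ (allFin (I (h 0))))) (same-degree (I (h 0)) (λ i → i)))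
                  (primes-degrees (h ∘ suc) l))
      where
      open import Data.List.Base using (tabulate)
      open import Data.List.Properties using (map-∘)
      same-degree : ∀ n {A : Set} (f : Fin n → A) → map (λ _ → h 0) (tabulate f) ≡ replicate n (h 0)
      same-degree zero    f = refl
      same-degree (suc n) f = cong (h 0 ∷_) (same-degree n (f ∘ Fin.suc))

    ∈-primes : ∀ h l {i} → i < l → (j : Fin (I (h i))) → (h i , j) Membership.∈ primes h l
    ∈-primes h (suc l) {zero}  i<l j = Membership.∈-++⁺ˡ (Membership.∈-map⁺ (h 0 ,_) (Membership.∈-allFin j))
    ∈-primes h (suc l) {suc i} i<l j = Membership.∈-++⁺ʳ (map (h 0 ,_) (allFin (I (h 0)))) (∈-primes (h ∘ suc) l (s≤s⁻¹ i<l) j)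

    primes-distinct : ∀ h → (∀ {i j} → h i ≡ h j → i ≡ j) → ∀ l → AllPairs _≢_ (primes h l)
    primes-distinct h h-injective zero    = []
    primes-distinct h h-injective (suc l) = AllPairs.++⁺
      (AllPairs.map⁺ (AllPairs.map (λ i≢j p → i≢j (second p)) (allFin⁺ (I (h 0)))))
      (primes-distinct (h ∘ suc) (ℕ.suc-injective ∘ h-injective) l)
      (All.map⁺ (All.tabulate λ {j} _ → different (h ∘ suc) (λ i p → ℕ.0≢1+n (h-injective p)) l))
      where
      second : ∀ {i j : Fin (I (h 0))} → (h 0 , i) ≡ (h 0 , j) → i ≡ j
      second refl = refl
      different : ∀ h′ → (∀ i → h 0 ≢ h′ i) → ∀ l {j} → All ((h 0 , j) ≢_) (primes h′ l)
      different h′ h≢h′ zero    = []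
      different h′ h≢h′ (suc l) = All.++⁺ (All.map⁺ (All.tabulate λ _ p → h≢h′ 0 (cong proj₁ p)))
        (different (h′ ∘ suc) (h≢h′ ∘ suc) l)

    primesUpTo : ℕ → List PrimeIndex
    primesUpTo = primes suc

    -- Stated for an arbitrary action because it is used twice: for single polynomials it yields the
    -- inverse series, for pairs the number of coprime ones.
    #free≡∑A : ∀ {a ℓ p b δ} (G : GradedAction a ℓ p b δ) M ps →
      AllPairs (GradedAction._⊥_ G) ps → map (GradedAction.degree G) ps ≡ degrees I suc M →
      VanishesAbove M (λ d → + GradedAction.size G d) →
      + GradedSieve.#free G ps 0 ≡ ∑ (suc M) (λ d → + GradedAction.size G d ℤ.* A I d)
    #free≡∑A G M ps ps-distinct ps-degrees vanishes = trans (GradedSieve.#free≡sieve G ps-distinct 0)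
      (trans (sieve≡differences ps (λ d → + GradedAction.size G d) 0)
        (trans (cong (λ es → differences es (λ d → + GradedAction.size G d) 0) ps-degrees) (differences≡∑A I vanishes)))
      where
      sieve≡differences : ∀ ps f d → GradedSieve.sieve G ps f d ≡ differences (map (GradedAction.degree G) ps) f d
      sieve≡differences []       f d = refl
      sieve≡differences (p ∷ ps) f d = cong₂ ℤ._-_ (sieve≡differences ps f d) (sieve≡differences ps f (GradedAction.degree G p + d))

    PrimeFactor : ℕ → Poly → Set _
    PrimeFactor j f = ∃[ p ] (proj₁ p ≤ j × π p ∣ f)

    -- Strong induction on the degree. All products of representatives of complementary degrees i
    -- and j - i with 0 < i < j are compared with f. If one is equivalent to f, its factor of degree
    -- i is treated by induction; if none is, f is irreducible.
    primeFactor : ∀ j {f} → 0 < j → HasTotalDegree j f → PrimeFactor j f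
    primeFactor = <-rec _ step
      where
      step : ∀ j → (∀ {i} → i < j → ∀ {f} → 0 < i → HasTotalDegree i f → PrimeFactor i f) →
             ∀ {f} → 0 < j → HasTotalDegree j f → PrimeFactor j f
      step j rec {f} 0<j f-deg = decide (Fin.any? λ i → (0 ℕ.<? toℕ i) ×-dec Fin.any? λ a → Fin.any? λ b → factor? i a b)
        where
        x : ∀ {i} → Fin (N i) → Poly
        x {i} a = proj₁ (𝒩.from i a)
        Factor : (i : Fin j) → Fin (N (toℕ i)) → Fin (N (j ∸ toℕ i)) → Set _
        Factor i a b = x {toℕ i} a · x {j ∸ toℕ i} b ∼ f
        factor? : ∀ i a b → Dec (Factor i a b)
        factor? i a b = 𝒩.decidable j (x {toℕ i} a · x {j ∸ toℕ i} b ,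
          subst (λ m → HasTotalDegree m (x {toℕ i} a · x {j ∸ toℕ i} b)) (ℕ.m+[n∸m]≡n (ℕ.<⇒≤ (Fin.toℕ<n i)))
            (hasTotalDegree-· (x {toℕ i} a) (x {j ∸ toℕ i} b) (proj₂ (𝒩.from (toℕ i) a)) (proj₂ (𝒩.from (j ∸ toℕ i) b))))
          (f , f-deg)
        decide : Dec (∃[ i ] (0 < toℕ i × ∃[ a ] ∃[ b ] Factor i a b)) → PrimeFactor j f
        decide (yes (i , 0<i , a , b , ab∼f)) with rec (Fin.toℕ<n i) {x {toℕ i} a} 0<i (proj₂ (𝒩.from (toℕ i) a))
        ... | p , p≤i , p∣a = p , ℕ.≤-trans p≤i (ℕ.<⇒≤ (Fin.toℕ<n i))
          , Div.∣ʳ-trans {π p} {x {toℕ i} a} {f} p∣a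
              (Div.∣ʳ-trans {x {toℕ i} a} {x {toℕ i} a · x {j ∸ toℕ i} b} {f}
                (x {j ∸ toℕ i} b , ·-comm (x {j ∸ toℕ i} b) (x {toℕ i} a))
                (∼⇒∣ {f} {x {toℕ i} a · x {j ∸ toℕ i} b} (∼-sym {x {toℕ i} a · x {j ∸ toℕ i} b} {f} ab∼f)))
        decide (no none) = (j , ℐ.to j ((f , f-deg) , irr)) , ℕ.≤-refl
          , ∼⇒∣ {f} {π (j , ℐ.to j ((f , f-deg) , irr))}
              (∼-sym {π (j , ℐ.to j ((f , f-deg) , irr))} {f} (ℐ.from-to j ((f , f-deg) , irr)))
          where
          irr : Irreducible f
          irr = record { p∤1 = λ f∣1 → ℕ.<⇒≢ 0<j (hasTotalDegree-unique {f = f} (unit⇒hasTotalDegree-0 {f} f∣1) f-deg)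
                       ; split-∣1 = λ {g} {h} → split {g} {h} }
            where
            split : ∀ {g h} → f ≈ g · h → g ∣ 𝟙 ⊎ h ∣ 𝟙
            split {g} {h} f≈gh with hasTotalDegree-factor g h {f} (≈-sym {f} {g · h} f≈gh) f-deg
            ... | zero  , _     , g-deg , _     , _ = inj₁ (hasTotalDegree-0⇒unit {g} g-deg)
            ... | suc i , zero  , _     , h-deg , _ = inj₂ (hasTotalDegree-0⇒unit {h} h-deg)
            ... | suc i , suc i′ , g-deg , h-deg , refl = contradiction (fromℕ< i<j , witness (Fin.toℕ-fromℕ< i<j)
                (trans (cong (suc i + suc i′ ∸_) (Fin.toℕ-fromℕ< i<j)) (ℕ.m+n∸m≡n (suc i) (suc i′)))) none
              where
              i<j : suc i < suc i + suc i′
              i<j = ℕ.m<m+n (suc i) z<s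
              witness : ∀ {m m′} → m ≡ suc i → m′ ≡ suc i′ → 0 < m × ∃[ a ] ∃[ b ] (x {m} a · x {m′} b ∼ f)
              witness refl refl = z<s , 𝒩.to (suc i) (g , g-deg) , 𝒩.to (suc i′) (h , h-deg) ,
                ∼-trans {x {suc i} _ · x {suc i′} _} {g · h} {f}
                  (·-cong-∼ {x {suc i} _} {g} {x {suc i′} _} {h} (𝒩.from-to (suc i) (g , g-deg)) (𝒩.from-to (suc i′) (h , h-deg)))
                  (≈⇒∼ {g · h} {f} (≈-sym {f} {g · h} f≈gh))

    -- A polynomial of degree m > 0 has an irreducible factor of degree at most m, so nothing
    -- survives the sieve by these irreducibles, and the sieve formula has the value 0.
    inverse-series : ∀ m → 0 < m → ∑ (suc m) (λ d → + N (m ∸ d) ℤ.* A I d) ≡ 0ℤ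
    inverse-series m 0<m = trans
      (∑-cong (suc m) λ d d<1+m → cong (λ x → + x ℤ.* A I d) (sym (size≡ (s≤s⁻¹ d<1+m))))
      (trans (sym (#free≡∑A G m (primesUpTo m) (primes-distinct suc ℕ.suc-injective m) (primes-degrees suc m)
                     (λ d m<d → cong +_ (codegreeSize-< N m<d))))
        (cong +_ (count-none (free? (primesUpTo m) {0}) not-free)))
      where
      G = polynomials m
      open GradedSieve G
      size≡ : ∀ {d} → d ≤ m → codegreeSize N m d ≡ N (m ∸ d)
      size≡ {d} d≤m = trans (cong (λ i → codegreeSize N i d) (sym (ℕ.m+[n∸m]≡n d≤m))) (codegreeSize-+ N d (m ∸ d))
      not-free : ∀ i → ¬ Free (primesUpTo m) (element {0} i)
      not-free i free with graded {0} i
      ... | j , f-deg , refl with primeFactor j {element {0} i} 0<m f-deg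
      ... | (zero , a) , _ , _ = contradiction (irreducible-hasTotalDegree>0 (irreducible-π (zero , a)) (hasTotalDegree-π (zero , a))) λ ()
      ... | (suc e , a) , e≤j , (g , gp≈f) = All.lookup free (∈-primes suc j e≤j a)
        (g , ≈⇒∼ {element {0} i} {π (suc e , a) · g} (≈-trans {element {0} i} {g · π (suc e , a)} {π (suc e , a) · g}
               (≈-sym {g · π (suc e , a)} {element {0} i} gp≈f) (·-comm g (π (suc e , a)))))

    -- A common divisor of positive degree has an irreducible factor of degree at most m, so being
    -- coprime is the same as being free of the irreducibles up to any M ≥ m. The freedom in M
    -- allows the sum to be extended beyond the main terms for every t.
    coprime-count : ∀ {P} m n → HasCardinality (CoprimePairs m n) P → ∀ M → m ≤ M →
      + P ≡ ∑ (suc M) (λ d → + (codegreeSize N m d * codegreeSize N n d) ℤ.* A I d)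
    coprime-count {P} m n cardP M m≤M = trans
      (cong +_ (count-subsetoid {S = Layer 0} {P = Free (primesUpTo M) ∘ proj₁} (GradedAction.card G 0)
        (transport {S = On.setoid {B = Σ[ x ∈ Setoid.Carrier (Layer 0) ] Free (primesUpTo M) (proj₁ x)} (Layer 0) proj₁}
                   {S′ = CoprimePairs m n} to′ (λ p → p) (λ p → p) surjective cardP)
        (λ {x} {y} p → free-resp {primesUpTo M} {proj₁ x} {proj₁ y} p)
        (free? (primesUpTo M) {0})))
      (#free≡∑A G M (primesUpTo M) (primes-distinct suc ℕ.suc-injective M) (primes-degrees suc M)
        (λ d M<d → cong (λ x → + (x * codegreeSize N n d)) (codegreeSize-< N (ℕ.≤-<-trans m≤M M<d))))
      where
      G = pairs m n
      open GradedAction G using (Layer)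
      open GradedSieve G
      ∣⇒∼π : ∀ p {f} → π p ∣ f → ∃[ g ] f ∼ π p · g
      ∣⇒∼π p {f} (g , gp≈f) = g , ≈⇒∼ {f} {π p · g} (≈-trans {f} {g · π p} {π p · g} (≈-sym {g · π p} {f} gp≈f) (·-comm g (π p)))
      ∼π⇒∣ : ∀ p {f g} → f ∼ π p · g → π p ∣ f
      ∼π⇒∣ p {f} {g} f∼pg = Div.∣ʳ-trans {π p} {π p · g} {f} (g , ·-comm g (π p)) (∼⇒∣ {f} {π p · g} f∼pg)
      free⇒coprime : ∀ {f g} → HasTotalDegree m f → Free (primesUpTo M) (f , g) → Coprime f g
      free⇒coprime {f} {g} f-deg free {z} z∣f@(y , yz≈f) z∣g with hasTotalDegree-factor y z {f} yz≈f f-deg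
      ... | _ , zero  , _ , z-deg , _ = hasTotalDegree-0⇒unit {z} z-deg
      ... | i , suc j , _ , z-deg , i+j≡m with primeFactor (suc j) {z} z<s z-deg
      ... | (zero , a) , _ , _ = contradiction (irreducible-hasTotalDegree>0 (irreducible-π (zero , a)) (hasTotalDegree-π (zero , a))) λ ()
      ... | p@(suc e , a) , e≤j , p∣z = contradiction
          (let u , f∼ = ∣⇒∼π p {f} (Div.∣ʳ-trans {π p} {z} {f} p∣z z∣f)
               v , g∼ = ∣⇒∼π p {g} (Div.∣ʳ-trans {π p} {z} {g} p∣z z∣g)
           in (u , v) , (f∼ , g∼))
          (All.lookup free (∈-primes suc M (ℕ.≤-trans e≤j (ℕ.≤-trans (ℕ.m≤n+m (suc j) i) (ℕ.≤-trans (ℕ.≤-reflexive i+j≡m) m≤M))) a))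
      coprime⇒free : ∀ {f g} → Coprime f g → Free (primesUpTo M) (f , g)
      coprime⇒free {f} {g} coprime = All.tabulate λ {p} _ → λ ((u , v) , (f∼pu , g∼pv)) →
        Irreducible.p∤1 (irreducible-π p) (coprime (∼π⇒∣ p {f} {u} f∼pu) (∼π⇒∣ p {g} {v} g∼pv))
      degree-0 : ∀ {m} f → HasCodegree m 0 f → HasTotalDegree m f
      degree-0 f (_ , f-deg , refl) = f-deg
      to′ : Σ[ x ∈ Setoid.Carrier (Layer 0) ] Free (primesUpTo M) (proj₁ x) → Setoid.Carrier (CoprimePairs m n)
      to′ (((f , g) , f-deg , g-deg) , free) =
        ((f , degree-0 f f-deg) , (g , degree-0 g g-deg)) , free⇒coprime {f} {g} (degree-0 f f-deg) free
      surjective : ∀ y → ∃[ x ] Setoid._≈_ (CoprimePairs m n) (to′ x) y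
      surjective (((f , f-deg) , (g , g-deg)) , coprime) =
        (((f , g) , (m , f-deg , refl) , (n , g-deg , refl)) , coprime⇒free {f} {g} coprime) , ∼-refl {f} , ∼-refl {g}

-- The asymptotic formula

open import Defs
open InclusionExclusion
open GrowthEstimates
open NumbersOfPolynomials
open CoprimePairCounts
open import Algebra.Apartness.Bundles using (HeytingField)
open import Data.Integer.Base using (ℤ; +_; _-_; ∣_∣) renaming (_+_ to _+ᶻ_; _*_ to _*ᶻ_)
import Data.Integer.Properties as ℤ
open import Data.List.Base using (map; upTo)
open import Data.Nat.Base using (ℕ; zero; suc; _+_; _*_; _≤_; _^_; >-nonZero; nonTrivial⇒n>1; s≤s)
import Data.Nat.Properties as ℕ
open import Data.Nat.Primality using (prime⇒nonTrivial)
open import Data.Product.Base using (Σ-syntax; _,_)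
open import Level using (Level)
open import Relation.Binary.PropositionalEquality using (_≡_; refl; trans; cong)

primePower≥2 : ∀ {q} → PrimePower q → 2 ≤ q
primePower≥2 (p , r , p-prime , refl) = ℕ.≤-trans p≥2 (ℕ.m≤m*n p (p ^ r) ⦃ ℕ.m^n≢0 p r ⦃ >-nonZero (ℕ.<⇒≤ p≥2) ⦄ ⦄)
  where
  p≥2 : 2 ≤ p
  p≥2 = nonTrivial⇒n>1 p ⦃ prime⇒nonTrivial p-prime ⦄

theorem4p2 : ∀ {c ℓ₁ ℓ₂ : Level} (q : ℕ) → PrimePower q →
    (k : ℕ) → 2 ≤ k → (t : ℕ) →
    Σ[ K ∈ ℕ ]
    ((F : HeytingField c ℓ₁ ℓ₂) → HasCardinality (HeytingField.setoid F) q →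
    let open Polynomials F k in
    (N I : ℕ → ℕ) (P : ℕ → ℕ → ℕ) →
    (∀ m → HasCardinality (𝒩 m) (N m)) →
    (∀ m → HasCardinality (Irreducibles m) (I m)) →
    (∀ m n → HasCardinality (CoprimePairs m n) (P m n)) →
    let N′ = extendByZero N in
    ∀ m n →
    ∣ + P m n - sumℤ (map (λ d → + (N′ (+ m - + d) * N′ (+ n - + d)) *ᶻ A I d) (upTo (suc t))) ∣
    ≤ K * (N′ (+ m - + suc t) * N′ (+ n - + suc t)))
theorem4p2 q q-primePower (suc zero)    (s≤s ()) t
theorem4p2 q q-primePower (suc (suc k)) _        t = bound , λ F card N I P card𝒩 cardI cardP m n →
  let open Counts F card (2 + k) N I card𝒩 cardI
      open NumberOfPolynomials F card (suc k)
      term : ℕ → ℤ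
      term d = + (codegreeSize N m d * codegreeSize N n d) *ᶻ A I d
      G≤N = λ i → lower-bound (card𝒩 i)
      N≤qG = λ i → upper-bound (card𝒩 i)
      -- The bound on `A I 0` is reflexivity because `A I 0` computes to 1.
      A-bound : ∀ d → ∣ A I d ∣ ≤ suc q ^ d * G d
      A-bound = inverse-series-bound N (A I) G≤N N≤qG ℕ.≤-refl inverse-series
      remainder : + P m n - sumℤ (map term (upTo (suc t))) ≡ ∑ (suc m) (λ e → term (suc t + e))
      -- M = t + (m + 1) is at least m, and the t + 1 + (m + 1) summands up to M split by
      -- computation into the main terms and m + 1 further ones.
      remainder = trans
        (cong₂ _-_ (trans (coprime-count m n (cardP m n) (t + suc m) (ℕ.≤-trans (ℕ.n≤1+n m) (ℕ.m≤n+m (suc m) t)))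
                          (∑-split (suc t) (suc m) term))
                   (sumℤ-upTo term (suc t)))
        (x+y-x≡y (∑ (suc t) term) _)
  in ℕ.≤-trans (ℕ.≤-reflexive (cong ∣_∣ remainder))
       (ℕ.≤-trans (∣∑∣≤∑ℕ (suc m) (λ e → term (suc t + e)) λ e _ →
           ℕ.≤-trans (ℕ.≤-reflexive (ℤ.abs-* (+ (codegreeSize N m (suc t + e) * codegreeSize N n (suc t + e))) (A I (suc t + e))))
             (ℕ.*-monoʳ-≤ (codegreeSize N m (suc t + e) * codegreeSize N n (suc t + e)) (A-bound (suc t + e))))
         (tail-bound N G≤N N≤qG m n (suc m)))
  where
  2≤q = primePower≥2 q-primePower
  open Growth q 2≤q (2 + k)
  open TailBound q 2≤q k (suc t)
  open import Data.Integer.Tactic.RingSolver using (solve-∀)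
  open import Relation.Binary.PropositionalEquality using (cong₂)
  x+y-x≡y : ∀ x y → (x +ᶻ y) - x ≡ y
  x+y-x≡y = solve-∀
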